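{- Let $m$ be an odd prime and $\alpha,\beta$ positive integers, and let $\mathcal{P}$ be an atomic chiral polyhedron of type $\{2m^{\alpha}, m^{\alpha + \beta}\}$, with rotation group $\Gamma^+(\mathcal P)=\langle\sigma_1,\sigma_2\rangle$. Then $\alpha = 1$, and $\Gamma^+(\mathcal{P}) = \Gamma^{2m, m^{\beta+1}}(3,\ 1+k m^{\beta},\ -3,\ -1+k m^{\beta})$ for some integer $k$ with $1 \leq k \leq m-1$.
   Context: For integers $p,q,i_1,j_1,i_2,j_2$, $\Gamma^{p,q}(i_1,j_1,i_2,j_2)$ denotes the group with presentation $\langle \sigma_1,\sigma_2 \mid \sigma_1^p=\sigma_2^q=(\sigma_1\sigma_2)^2=1,\ \sigma_2^{ -1}\sigma_1=\sigma_1^{i_1}\sigma_2^{j_1},\ \sigma_2\sigma_1^{ -1}=\sigma_1^{i_2}\sigma_2^{j_2}\rangle$; an equality $\Gamma^+(\mathcal P)=\Gamma^{p,q}(\dots)$ means the map sending the generators $\sigma_1,\sigma_2$ of the presented group to the distinguished generators of $\Gamma^+(\mathcal P)$ is an isomorphism. An (abstract) polyhedron is a partially ordered set whose elements have rank $0$, $1$, $2$ (vertices, edges, faces), incidence meaning comparability, such that every edge is incident to exactly two vertices and two faces, whenever a vertex is incident to a face exactly two edges are incident to both, the incidence graph is connected, and for each vertex or face the subgraph of the incidence graph induced on its neighbours is connected. A flag is a mutually incident (vertex, edge, face) triple; $\Phi^i$ is the flag differing from $\Phi$ exactly in its rank-$i$ element. Type $\{p,q\}$: faces are incident to $p$ edges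 and vertices to $q$ edges. A polyhedron is regular if its automorphism group is flag-transitive, and chiral if its flags split into two classes with $\Phi,\Phi^i$ always in different classes and the automorphism group transitive on each class but not on all flags. For a regular or chiral polyhedron with base flag $\Phi$, $\sigma_1:\Phi\mapsto(\Phi^1)^0$ and $\sigma_2:\Phi\mapsto(\Phi^2)^1$ generate the rotation group $\Gamma^+(\mathcal P)$. Tight: exactly $2pq$ flags. $\mathcal P$ covers $\mathcal Q$ if there is a homomorphism $\Gamma^+(\mathcal P)\to\Gamma^+(\mathcal Q)$ sending distinguished generators to distinguished generators. A chiral polyhedron of type $\{p,q\}$ is atomic if it is tight and covers no tight chiral polyhedron of type $\{p',q\}$ with $p'<p$ or $\{p,q'\}$ with $q'<q$. -}

module Defs where

open import Level using (0ℓ)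
open import Data.Bool using (Bool; true; false; T; not)
open import Data.Nat using (ℕ; zero; suc; _*_; _<_)
open import Data.Fin using (Fin)
open import Data.Integer as ℤ using (ℤ; +_; -[1+_])
open import Data.Product using (Σ; _×_; _,_; proj₁)
open import Data.Sum using (_⊎_; inj₁; inj₂)
open import Data.Empty using (⊥)
open import Data.List using (List; []; _∷_; _++_; replicate)
open import Data.List.Membership.Propositional using (_∈_)
open import Relation.Nullary using (¬_)
open import Relation.Binary.PropositionalEquality using (_≡_; _≢_; subst; sym)
open import Relation.Binary.Construct.Closure.ReflexiveTransitive using (Star)
open import Function.Bundles using (_↔_)

ExactlyTwo : (A : Set) → (A → Set) → Set
ExactlyTwo A P =
  Σ A λ a → Σ A λ b → a ≢ b × P a × P b × (∀ c → P c → c ≡ a ⊎ c ≡ b)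

-- The incidence graph of a ranked poset with ranks 0,1,2.
-- Elements: vertices (V), edges (E), faces (F); elements of rank 0,1,2.
-- The order is given by the three Bool-valued relations
--   ve v e  (v < e),  ef e f  (e < f),  vf v f  (v < f);
-- incidence = comparability.

Elt : Set → Set → Set → Set
Elt V E F = V ⊎ E ⊎ F

Inc : {V E F : Set} → (V → E → Bool) → (E → F → Bool) → (V → F → Bool) →
      Elt V E F → Elt V E F → Set
Inc ve ef vf (inj₁ v)        (inj₂ (inj₁ e)) = T (ve v e)
Inc ve ef vf (inj₁ v)        (inj₂ (inj₂ f)) = T (vf v f)
Inc ve ef vf (inj₂ (inj₁ e)) (inj₁ v)        = T (ve v e)
Inc ve ef vf (inj₂ (inj₁ e)) (inj₂ (inj₂ f)) = T (ef e f)
Inc ve ef vf (inj₂ (inj₂ f)) (inj₁ v)        = T (vf v f)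
Inc ve ef vf (inj₂ (inj₂ f)) (inj₂ (inj₁ e)) = T (ef e f)
Inc ve ef vf _               _               = ⊥

Nbr : {V E F : Set} → (V → E → Bool) → (E → F → Bool) → (V → F → Bool) →
      Elt V E F → Set
Nbr ve ef vf x = Σ (Elt _ _ _) λ y → Inc ve ef vf x y

NbrConnected : {V E F : Set} → (V → E → Bool) → (E → F → Bool) → (V → F → Bool) →
               Elt V E F → Set
NbrConnected ve ef vf x =
  (a b : Nbr ve ef vf x) →
  Star (λ (c d : Nbr ve ef vf x) → Inc ve ef vf (proj₁ c) (proj₁ d)) a b

record Polyhedron : Set₁ where
  field
    V E F : Set
    ve : V → E → Bool
    ef : E → F → Bool
    vf : V → F → Bool
    -- transitivity of the partial order (the only nontrivial instance)
    ve-ef-trans : ∀ v e f → T (ve v e) → T (ef e f) → T (vf v f)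
    edge-vertices : ∀ e → ExactlyTwo V (λ v → T (ve v e))
    edge-faces    : ∀ e → ExactlyTwo F (λ f → T (ef e f))
    diamond : ∀ v f → T (vf v f) →
              ExactlyTwo E (λ e → T (ve v e) × T (ef e f))
    connected : ∀ x y → Star (Inc ve ef vf) x y
    vertex-nbr-connected : ∀ v → NbrConnected ve ef vf (inj₁ v)
    face-nbr-connected   : ∀ f → NbrConnected ve ef vf (inj₂ (inj₂ f))

module _ (P : Polyhedron) where
  open Polyhedron P

  record Flag : Set where
    constructor flag
    field
      fv : V
      fe : E
      ff : F
      fve : T (ve fv fe)
      fef : T (ef fe ff)

  open Flag

  _≐_ : Flag → Flag → Set
  Φ ≐ Ψ = fv Φ ≡ fv Ψ × fe Φ ≡ fe Ψ × ff Φ ≡ ff Ψ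

  Adj₀ Adj₁ Adj₂ : Flag → Flag → Set
  Adj₀ Φ Ψ = fv Φ ≢ fv Ψ × fe Φ ≡ fe Ψ × ff Φ ≡ ff Ψ
  Adj₁ Φ Ψ = fv Φ ≡ fv Ψ × fe Φ ≢ fe Ψ × ff Φ ≡ ff Ψ
  Adj₂ Φ Ψ = fv Φ ≡ fv Ψ × fe Φ ≡ fe Ψ × ff Φ ≢ ff Ψ

  record Aut : Set where
    field
      fV : V → V
      gV : V → V
      fE : E → E
      gE : E → E
      fF : F → F
      gF : F → F
      fgV : ∀ x → fV (gV x) ≡ x
      gfV : ∀ x → gV (fV x) ≡ x
      fgE : ∀ x → fE (gE x) ≡ x
      gfE : ∀ x → gE (fE x) ≡ x
      fgF : ∀ x → fF (gF x) ≡ x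
      gfF : ∀ x → gF (fF x) ≡ x
      pres-ve : ∀ v e → ve (fV v) (fE e) ≡ ve v e
      pres-ef : ∀ e f → ef (fE e) (fF f) ≡ ef e f
      pres-vf : ∀ v f → vf (fV v) (fF f) ≡ vf v f

  open Aut

  act : Aut → Flag → Flag
  act γ Φ = flag (fV γ (fv Φ)) (fE γ (fe Φ)) (fF γ (ff Φ))
                 (subst T (sym (pres-ve γ (fv Φ) (fe Φ))) (fve Φ))
                 (subst T (sym (pres-ef γ (fe Φ) (ff Φ))) (fef Φ))

  IsChiral : Set
  IsChiral =
    Σ (Flag → Bool) λ c →
      (∀ Φ Ψ → Adj₀ Φ Ψ ⊎ Adj₁ Φ Ψ ⊎ Adj₂ Φ Ψ → c Φ ≢ c Ψ) ×
      (∀ Φ Ψ → c Φ ≡ c Ψ → Σ Aut λ γ → act γ Φ ≐ Ψ) ×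
      ¬ (∀ Φ Ψ → Σ Aut λ γ → act γ Φ ≐ Ψ)

  HasType : ℕ → ℕ → Set
  HasType p q =
    (∀ f → Fin p ↔ (Σ E λ e → T (ef e f))) ×
    (∀ v → Fin q ↔ (Σ E λ e → T (ve v e)))

  Tight : ℕ → ℕ → Set
  Tight p q = Fin (2 * p * q) ↔ Flag

  record Rotations (Φ : Flag) : Set where
    field
      σ₁ σ₂ : Aut
      σ₁-spec : Σ Flag λ Φ' → Adj₁ Φ Φ' × Adj₀ Φ' (act σ₁ Φ)
      σ₂-spec : Σ Flag λ Φ' → Adj₂ Φ Φ' × Adj₁ Φ' (act σ₂ Φ)

data Gen : Set where
  g₁ g₂ : Gen

-- (g , true) is the generator, (g , false) its inverse
Letter : Set
Letter = Gen × Bool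

inv : Letter → Letter
inv (g , b) = g , not b

Word : Set
Word = List Letter

zpow : Gen → ℤ → Word
zpow g (+ n)    = replicate n (g , true)
zpow g -[1+ n ] = replicate (suc n) (g , false)

-- the group presented by generators σ₁, σ₂ and relations rels:
-- words modulo the congruence generated by free cancellation and rels
data Derivable (rels : List (Word × Word)) : Word → Word → Set where
  d-refl  : ∀ {u} → Derivable rels u u
  d-sym   : ∀ {u w} → Derivable rels u w → Derivable rels w u
  d-trans : ∀ {u w z} → Derivable rels u w → Derivable rels w z → Derivable rels u z
  d-cancel : ∀ x → Derivable rels (x ∷ inv x ∷ []) []
  d-rel   : ∀ {u w} → (u , w) ∈ rels → Derivable rels u w
  d-ctx   : ∀ a b {u w} → Derivable rels u w →
            Derivable rels (a ++ u ++ b) (a ++ w ++ b)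

ΓRels : ℕ → ℕ → ℤ → ℤ → ℤ → ℤ → List (Word × Word)
ΓRels p q i₁ j₁ i₂ j₂ =
  (zpow g₁ (+ p) , []) ∷
  (zpow g₂ (+ q) , []) ∷
  ((g₁ , true) ∷ (g₂ , true) ∷ (g₁ , true) ∷ (g₂ , true) ∷ [] , []) ∷
  ((g₂ , false) ∷ (g₁ , true) ∷ [] , zpow g₁ i₁ ++ zpow g₂ j₁) ∷
  ((g₂ , true) ∷ (g₁ , false) ∷ [] , zpow g₁ i₂ ++ zpow g₂ j₂) ∷
  []

module _ (P : Polyhedron) {Φ : Flag P} (R : Rotations P Φ) where
  open Polyhedron P
  open Rotations R
  open Aut

  gen : Gen → Aut P
  gen g₁ = σ₁
  gen g₂ = σ₂

  evV : Word → V → V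
  evV [] x = x
  evV ((g , true)  ∷ w) x = fV (gen g) (evV w x)
  evV ((g , false) ∷ w) x = gV (gen g) (evV w x)

  evE : Word → E → E
  evE [] x = x
  evE ((g , true)  ∷ w) x = fE (gen g) (evE w x)
  evE ((g , false) ∷ w) x = gE (gen g) (evE w x)

  evF : Word → F → F
  evF [] x = x
  evF ((g , true)  ∷ w) x = fF (gen g) (evF w x)
  evF ((g , false) ∷ w) x = gF (gen g) (evF w x)

  SameIn : Word → Word → Set
  SameIn u w = (∀ x → evV u x ≡ evV w x) ×
               (∀ x → evE u x ≡ evE w x) ×
               (∀ x → evF u x ≡ evF w x)

  -- Γ⁺(P) = Γ^{p,q}(i₁,j₁,i₂,j₂): the map from the presented group
  -- sending σᵢ ↦ σᵢ is well defined and injective (it is onto, as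
  -- Γ⁺(P) is generated by σ₁, σ₂)
  IsPresentation : ℕ → ℕ → ℤ → ℤ → ℤ → ℤ → Set
  IsPresentation p q i₁ j₁ i₂ j₂ =
    ∀ u w → (Derivable (ΓRels p q i₁ j₁ i₂ j₂) u w → SameIn u w) ×
            (SameIn u w → Derivable (ΓRels p q i₁ j₁ i₂ j₂) u w)

-- P (with base flag Φ and its generators R) covers Q: there is a
-- homomorphism Γ⁺(P) → Γ⁺(Q) sending distinguished generators to
-- distinguished generators (for some base flag of Q)
Covers : (P : Polyhedron) {Φ : Flag P} → Rotations P Φ → Polyhedron → Set
Covers P R Q =
  Σ (Flag Q) λ Ψ → Σ (Rotations Q Ψ) λ S →
    ∀ u w → SameIn P R u w → SameIn Q S u w

Atomic : (P : Polyhedron) {Φ : Flag P} → Rotations P Φ → ℕ → ℕ → Set₁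
Atomic P R p q =
  IsChiral P × HasType P p q × Tight P p q ×
  ((Q : Polyhedron) (p' q' : ℕ) →
     IsChiral Q → HasType Q p' q' → Tight Q p' q' →
     (p' < p × q' ≡ q) ⊎ (p' ≡ p × q' < q) →
     ¬ Covers P R Q)

{-# OPTIONS --safe #-}
module Submission where

-- Write a = σ₁ and b = σ₂.  Tightness means that the rotation group is ⟨a⟩⟨b⟩
-- with ⟨a⟩ ∩ ⟨b⟩ = 1, and conversely every such group with (ab)² = 1 is the
-- rotation group of a tight polyhedron (the coset geometry of ⟨b⟩, ⟨ba⟩, ⟨a⟩),
-- which is chiral unless a ↦ a⁻¹, b ↦ b⁻¹ respects the relations.
--
-- If it does, b⁻¹a = aⁱbʲ implies ba⁻¹ = a⁻ⁱb⁻ʲ, so that aⁱ⁺¹ commutes with bʲ.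
-- Counting orbits of b on vertices and of a on faces yields normal subgroups
-- inside ⟨b⟩ or ⟨a⟩, and dividing them out one after the other leads to type
-- {2m, m}, where one reads off i ≡ 3 (mod 2m) and j ≡ 1 (mod m).  Hence a²
-- commutes with b in every regular quotient.
--
-- In an atomic chiral P the subgroup ⟨z⟩ of order m of ⟨b⟩ is normal and its
-- quotient is regular, so ba² = a²bzᵏ, and zᵏ ≠ 1 since otherwise P would be
-- regular.  Then a²ᵐ is central.  If α ≥ 2, the quotient by ⟨a²ᵐ⟩ would be
-- regular too, forcing zᵏ ∈ ⟨a⟩ ∩ ⟨b⟩ = 1.  So α = 1, and the relation
-- ba² = a²bzᵏ already bounds the order of the presented group by that of Γ⁺(P).

open import Defs
open import Data.Bool using (Bool; true; false; not; T; T?)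
import Data.Bool as Bool
open import Data.Bool.Properties using (T-irrelevant; not-involutive; ¬-not; not-¬)
open import Data.Empty using (⊥; ⊥-elim)
open import Data.Fin as Fin using (Fin; toℕ; fromℕ<; zero; suc; remQuot; combine)
import Data.Fin.Properties as Fin
open import Data.Integer as ℤ using (ℤ; +_; -[1+_])
open import Data.List using (List; []; _∷_; _++_; replicate; map)
open import Data.List.Membership.Propositional using (_∈_)
open import Data.List.Properties using (++-assoc; ++-identityʳ; map-++)
open import Data.List.Relation.Unary.Any using (here; there)
open import Data.Nat using (ℕ; zero; suc; _+_; _*_; _^_; _∸_; _≤_; _<_; _≤ᵇ_; z≤n; s≤s; _%_; _/_; NonZero; >-nonZero; ≢-nonZero; ≢-nonZero⁻¹; nonTrivial⇒n>1)
open import Data.Nat.Coprimality as Coprimality using (Coprime; coprime-divisor; coprime⇒gcd≡1)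
open import Data.Nat.DivMod using (m%n<n; m≡m%n+[m/n]*n; m<n⇒m%n≡m; [m+kn]%n≡m%n; %-congˡ; _mod_)
open import Data.Nat.Divisibility
open import Data.Nat.GCD using (gcd; gcd[m,n]∣m; gcd[m,n]∣n; gcd-GCD; module Bézout)
open import Data.Nat.Primality using (Prime; prime⇒irreducible; prime⇒nonZero; prime⇒nonTrivial)
open import Data.Nat.Properties
open import Data.Nat.Tactic.RingSolver using (solve-∀)
open import Data.Product using (Σ; _×_; _,_; proj₁; proj₂; ∃-syntax)
open import Data.Sum as Sum using (_⊎_; inj₁; inj₂)
open import Data.Unit using (tt)
open import Data.Vec as Vec using (Vec; []; _∷_)
open import Function.Bundles using (_↔_; Inverse; mk↔ₛ′)
open import Level using (0ℓ)
open import Relation.Binary.Bundles using (Setoid)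
open import Relation.Binary.Construct.Closure.ReflexiveTransitive using (Star; ε; _◅_; _◅◅_; reverse)
open import Relation.Binary.Definitions using (tri<; tri≈; tri>)
open import Relation.Binary.PropositionalEquality using (_≡_; _≢_; refl; sym; trans; cong; cong₂; subst; subst₂; ≢-sym; module ≡-Reasoning)
import Relation.Binary.Reasoning.Setoid as SetoidReasoning
open import Relation.Nullary using (¬_; Dec; yes; no; contradiction)
open import Relation.Nullary.Decidable using (isYes; toWitness; fromWitness; _⊎-dec_)

-- Exponents and prime powers

-- The residues 3 and 1 matter through coprimality: modulo the odd prime `m`, `(i + 1) / 2 ≡ 2` and
-- `j ≡ 1` are units, so `a^(i+1)` and `b^j` generate `⟨a²⟩` and `⟨b⟩`. A group is throughout a
-- congruence on words in two letters; a quotient is a coarser congruence and a covering is an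
-- inclusion of congruences. The normal form `aⁱbʲ` makes each such group decidable, so that "the
-- quotient cannot be chiral" yields the commutation of `a²` and `b` in it without excluded middle.
-- The obstacle is that `Covers` speaks of polyhedra: for a quotient an actual polyhedron has to be
-- built and shown to be tight and chiral of the right type. Conversely, the vertices, edges and
-- faces of `P` form arbitrary sets, so questions about them are moved to flags, where a rotation is
-- determined by one image and the two colours exclude half of the candidates.

record ExponentGroup (D : ℕ → Set) : Set where
  field
    has-0 : D 0
    closed-+ : ∀ i j → D i → D j → D (i + j)
    -- Closure under differences replaces negatives: `D` is the nonnegative part of a subgroup of
    -- the integers.
    closed-∸ : ∀ i j → D i → D (i + j) → D j

  closed-* : ∀ k i → D i → D (k * i)
  closed-* zero    i Di = has-0
  closed-* (suc k) i Di = closed-+ i (k * i) Di (closed-* k i Di)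

  closed-∣ : ∀ {i j} → i ∣ j → D i → D j
  closed-∣ {i} (divides k refl) = closed-* k i

  -- Over the natural numbers Bézout's identity comes in two sign patterns; in both the gcd is a
  -- difference of two multiples.
  closed-gcd : ∀ i j → D i → D j → D (gcd i j)
  closed-gcd i j Di Dj with Bézout.identity (gcd-GCD i j)
  ... | Bézout.+- x y eq = closed-∸ (y * j) (gcd i j) (closed-* y j Dj)
          (subst D (trans (sym eq) (+-comm (gcd i j) (y * j))) (closed-* x i Di))
  ... | Bézout.-+ x y eq = closed-∸ (x * i) (gcd i j) (closed-* x i Di)
          (subst D (trans (sym eq) (+-comm (gcd i j) (x * i))) (closed-* y j Dj))

  closed-coprime : ∀ {i j} → Coprime i j → D i → D j → D 1
  closed-coprime {i} {j} c Di Dj = subst D (coprime⇒gcd≡1 c) (closed-gcd i j Di Dj)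

module _ {m : ℕ} (m-prime : Prime m) where

  private instance
    m≢0 : NonZero m
    m≢0 = prime⇒nonZero m-prime

  prime>1 : 1 < m
  prime>1 = nonTrivial⇒n>1 m {{prime⇒nonTrivial m-prime}}

  -- A common divisor `d` is itself coprime to `m`, because otherwise `m` would divide `n` through
  -- `d`. Hence one factor `m` after the other can be removed from the power.
  ∤⇒coprime-^ : ∀ {n} → ¬ (m ∣ n) → ∀ k → Coprime n (m ^ k)
  ∤⇒coprime-^ {n} m∤n zero    (_ , d∣1) = ∣1⇒≡1 d∣1
  ∤⇒coprime-^ {n} m∤n (suc k) {d} (d∣n , d∣m^) =
    ∤⇒coprime-^ m∤n k (d∣n , coprime-divisor d⊥m d∣m^)
    where
    d⊥m : Coprime d m
    d⊥m (e∣d , e∣m) with prime⇒irreducible m-prime e∣m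
    ... | inj₁ e≡1  = e≡1
    ... | inj₂ refl = contradiction (∣-trans e∣d d∣n) m∤n

  -- If the cofactor `h` is divisible by `m`, that factor can be cancelled. If not, `h` is coprime
  -- to the power it divides, so it is 1 and `g` is the whole power.
  proper-∣-^ : ∀ {g} k → g ∣ m ^ suc k → g ≢ m ^ suc k → g ∣ m ^ k
  proper-∣-^ {g} k (divides h eq) g≢ with m ∣? h
  ... | yes (divides h' refl) = divides h' (*-cancelˡ-≡ (m ^ k) (h' * g) m
          (trans eq (trans (cong (_* g) (*-comm h' m)) (*-assoc m h' g))))
  ... | no m∤h = contradiction
          (sym (trans eq (trans (cong (_* g) h≡1) (*-identityˡ g)))) g≢
    where
    h≡1 : h ≡ 1
    h≡1 = ∤⇒coprime-^ m∤h (suc k) (∣-refl , divides g (trans eq (*-comm h g)))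

  -- The period of a point under a permutation of m-power order is itself a
  -- power of m, and it is the size of the orbit.
  orbit-bound : ∀ {D N} → ExponentGroup D → (∀ l → Dec (D l)) →
    (f : ℕ → Fin N) → (∀ i d → f i ≡ f (i + d) → D d) →
    ∀ k → D (m ^ k) → Σ ℕ λ δ → D (m ^ δ) × m ^ δ ≤ N
  orbit-bound {D} {N} grp D? f f-reflects = search
    where
    open ExponentGroup grp

    -- A return after `d < m ^ suc k` steps has a gcd with `m ^ suc k` that is again a period and a
    -- proper divisor of it, hence divides `m ^ k`.
    repeat⇒ : ∀ k → D (m ^ suc k) → ∀ d → 0 < d → d < m ^ suc k → D d → D (m ^ k)
    repeat⇒ k Dm d 0<d d< Dd =
      closed-∣ (proper-∣-^ k (gcd[m,n]∣n d (m ^ suc k)) g≢)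
               (closed-gcd d (m ^ suc k) Dd Dm)
      where
      instance
        d≢0 : NonZero d
        d≢0 = >-nonZero 0<d
      g≢ : gcd d (m ^ suc k) ≢ m ^ suc k
      g≢ eq = <⇒≱ d< (subst (_≤ d) eq (∣⇒≤ (gcd[m,n]∣m d (m ^ suc k))))

    injective : ∀ k → D (m ^ suc k) → ¬ D (m ^ k) →
      ∀ {i j : Fin (m ^ suc k)} → f (toℕ i) ≡ f (toℕ j) → ¬ (toℕ i < toℕ j)
    injective k Dm ¬D {i} {j} eq i<j = ¬D (repeat⇒ k Dm (toℕ j ∸ toℕ i) (m<n⇒0<n∸m i<j)
      (≤-<-trans (m∸n≤m (toℕ j) (toℕ i)) (Fin.toℕ<n j))
      (f-reflects (toℕ i) (toℕ j ∸ toℕ i)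
        (trans eq (cong f (sym (m+[n∸m]≡n (<⇒≤ i<j)))))))

    -- Descent on the known period: either the next smaller power is a period too, or the first
    -- `m ^ suc k` points of the orbit are distinct and inject into `Fin N`.
    search : ∀ k → D (m ^ k) → Σ ℕ λ δ → D (m ^ δ) × m ^ δ ≤ N
    search zero    D1 = 0 , D1 , 1≤ (f 0)
      where
      1≤ : ∀ {N} → Fin N → 1 ≤ N
      1≤ {suc N} _ = s≤s z≤n
    search (suc k) Dm with D? (m ^ k)
    ... | yes D' = search k D'
    ... | no ¬D  = suc k , Dm , Fin.injective⇒≤ {f = λ i → f (toℕ i)} inj
      where
      inj : ∀ {i j} → f (toℕ i) ≡ f (toℕ j) → i ≡ j
      inj {i} {j} eq with <-cmp (toℕ i) (toℕ j)
      ... | tri< i<j _ _ = contradiction i<j (injective k Dm ¬D {i} {j} eq)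
      ... | tri≈ _ i≡j _ = Fin.toℕ-injective i≡j
      ... | tri> _ _ j<i = contradiction j<i (injective k Dm ¬D {j} {i} (sym eq))

  ^-cancelˡ-≤ : ∀ {i j} → m ^ i < m ^ suc j → i ≤ j
  ^-cancelˡ-≤ {i} {j} lt with <-cmp i (suc j)
  ... | tri< i<j _ _ = ≤-pred i<j
  ... | tri≈ _ refl _ = contradiction lt (<-irrefl refl)
  ... | tri> _ _ j<i = contradiction (<-trans lt (^-monoʳ-< m prime>1 j<i)) (<-irrefl refl)

-- Group congruences on words

pow : Gen → ℕ → Word
pow g n = replicate n (g , true)

A B : ℕ → Word
A = pow g₁
B = pow g₂

winv : Word → Word
winv []      = []
winv (x ∷ w) = winv w ++ inv x ∷ []

inv-involutive : ∀ x → inv (inv x) ≡ x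
inv-involutive (g , b) = cong (g ,_) (not-involutive b)

pow-+ : ∀ g i j → pow g (i + j) ≡ pow g i ++ pow g j
pow-+ g zero    j = refl
pow-+ g (suc i) j = cong (_ ∷_) (pow-+ g i j)

pow-comm : ∀ g i j → pow g i ++ pow g j ≡ pow g j ++ pow g i
pow-comm g i j = trans (sym (pow-+ g i j)) (trans (cong (pow g) (+-comm i j)) (pow-+ g j i))

-- A congruence on words in which letters cancel is a quotient of the free group of rank two, that
-- is, a group with two marked generators.
record Congruence : Set₁ where
  infix 4 _≈_
  field
    _≈_ : Word → Word → Set
    ≈-refl : ∀ {u} → u ≈ u
    ≈-sym : ∀ {u w} → u ≈ w → w ≈ u
    ≈-trans : ∀ {u w z} → u ≈ w → w ≈ z → u ≈ z
    ≈-cancel : ∀ x → x ∷ inv x ∷ [] ≈ []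
    ≈-ctx : ∀ s t {u w} → u ≈ w → s ++ u ++ t ≈ s ++ w ++ t

infixr 5 _⊙_
infix 8 _⁻
data Term (n : ℕ) : Set where
  var : Fin n → Term n
  _⊙_ : Term n → Term n → Term n
  _⁻  : Term n → Term n
  𝟙   : Term n

module CongruenceProperties (C : Congruence) where
  open Congruence C public

  wordSetoid : Setoid 0ℓ 0ℓ
  wordSetoid = record
    { Carrier = Word ; _≈_ = _≈_
    ; isEquivalence = record { refl = ≈-refl ; sym = ≈-sym ; trans = ≈-trans } }

  module ≈-Reasoning = SetoidReasoning wordSetoid
  open ≈-Reasoning

  ≈-reflexive : ∀ {u w} → u ≡ w → u ≈ w
  ≈-reflexive refl = ≈-refl

  ++-congˡ : ∀ s {u w} → u ≈ w → s ++ u ≈ s ++ w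
  ++-congˡ s {u} {w} e = subst₂ (λ x y → s ++ x ≈ s ++ y) (++-identityʳ u) (++-identityʳ w) (≈-ctx s [] e)

  ++-congʳ : ∀ t {u w} → u ≈ w → u ++ t ≈ w ++ t
  ++-congʳ t e = ≈-ctx [] t e

  ++-cong : ∀ {s u t w} → s ≈ u → t ≈ w → s ++ t ≈ u ++ w
  ++-cong {s} {u} {t} e f = ≈-trans (++-congʳ t e) (++-congˡ u f)

  cancel-in : ∀ s x t → s ++ x ∷ inv x ∷ t ≈ s ++ t
  cancel-in s x t = ≈-ctx s t (≈-cancel x)

  cancel-in′ : ∀ s x t → s ++ inv x ∷ x ∷ t ≈ s ++ t
  cancel-in′ s x t = subst (λ y → s ++ inv x ∷ y ∷ t ≈ s ++ t) (inv-involutive x) (cancel-in s (inv x) t)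

  inverseʳ : ∀ w → w ++ winv w ≈ []
  inverseʳ []      = ≈-refl
  inverseʳ (x ∷ w) = begin
    x ∷ w ++ winv w ++ inv x ∷ []   ≡⟨ cong (x ∷_) (sym (++-assoc w (winv w) _)) ⟩
    x ∷ (w ++ winv w) ++ inv x ∷ [] ≈⟨ ≈-ctx (x ∷ []) (inv x ∷ []) (inverseʳ w) ⟩
    x ∷ inv x ∷ []                  ≈⟨ ≈-cancel x ⟩
    []                              ∎

  inverseˡ : ∀ w → winv w ++ w ≈ []
  inverseˡ []      = ≈-refl
  inverseˡ (x ∷ w) = begin
    (winv w ++ inv x ∷ []) ++ x ∷ w ≡⟨ ++-assoc (winv w) _ _ ⟩
    winv w ++ inv x ∷ x ∷ w         ≈⟨ cancel-in′ (winv w) x w ⟩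
    winv w ++ w                     ≈⟨ inverseˡ w ⟩
    []                              ∎

  winv-cong : ∀ {u w} → u ≈ w → winv u ≈ winv w
  winv-cong {u} {w} e = begin
    winv u                ≡⟨ sym (++-identityʳ _) ⟩
    winv u ++ []          ≈⟨ ++-congˡ (winv u) (≈-sym (inverseʳ w)) ⟩
    winv u ++ w ++ winv w ≈⟨ ≈-ctx (winv u) (winv w) (≈-sym e) ⟩
    winv u ++ u ++ winv w ≡⟨ sym (++-assoc (winv u) u (winv w)) ⟩
    (winv u ++ u) ++ winv w ≈⟨ ++-congʳ (winv w) (inverseˡ u) ⟩
    winv w                ∎

  ++-cancelˡ : ∀ s {u w} → s ++ u ≈ s ++ w → u ≈ w
  ++-cancelˡ s {u} {w} e = begin
    u                    ≈⟨ ++-congʳ u (inverseˡ s) ⟨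
    (winv s ++ s) ++ u   ≡⟨ ++-assoc (winv s) s u ⟩
    winv s ++ (s ++ u)   ≈⟨ ++-congˡ (winv s) e ⟩
    winv s ++ (s ++ w)   ≡⟨ sym (++-assoc (winv s) s w) ⟩
    (winv s ++ s) ++ w   ≈⟨ ++-congʳ w (inverseˡ s) ⟩
    w                    ∎

  ++-cancelʳ : ∀ t {u w} → u ++ t ≈ w ++ t → u ≈ w
  ++-cancelʳ t {u} {w} e = begin
    u                    ≡⟨ sym (++-identityʳ u) ⟩
    u ++ []              ≈⟨ ++-congˡ u (inverseʳ t) ⟨
    u ++ (t ++ winv t)   ≡⟨ sym (++-assoc u t (winv t)) ⟩
    (u ++ t) ++ winv t   ≈⟨ ++-congʳ (winv t) e ⟩
    (w ++ t) ++ winv t   ≡⟨ ++-assoc w t (winv t) ⟩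
    w ++ (t ++ winv t)   ≈⟨ ++-congˡ w (inverseʳ t) ⟩
    w ++ []              ≡⟨ ++-identityʳ w ⟩
    w                    ∎

  -- A solver for group identities: terms are compared by free reduction.
  module _ {n : ℕ} (ρ : Vec Word n) where

    ⟦_⟧ : Term n → Word
    ⟦ var i ⟧ = Vec.lookup ρ i
    ⟦ s ⊙ t ⟧ = ⟦ s ⟧ ++ ⟦ t ⟧
    ⟦ t ⁻ ⟧   = winv ⟦ t ⟧
    ⟦ 𝟙 ⟧     = []

    Signed : Set
    Signed = Fin n × Bool

    ⟦_⟧ˢ : Signed → Word
    ⟦ i , true  ⟧ˢ = Vec.lookup ρ i
    ⟦ i , false ⟧ˢ = winv (Vec.lookup ρ i)

    ⟦_⟧ᴺ : List Signed → Word
    ⟦ [] ⟧ᴺ     = []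
    ⟦ x ∷ xs ⟧ᴺ = ⟦ x ⟧ˢ ++ ⟦ xs ⟧ᴺ

    push : Signed → List Signed → List Signed
    push x [] = x ∷ []
    push (i , b) ((j , c) ∷ xs) with i Fin.≟ j | b Bool.≟ not c
    ... | yes _ | yes _ = xs
    ... | _     | _     = (i , b) ∷ (j , c) ∷ xs

    -- normalise b t xs reduces t (b = true) or t⁻¹ (b = false), followed by xs.
    normalise : Bool → Term n → List Signed → List Signed
    normalise b     (var i) xs = push (i , b) xs
    normalise true  (s ⊙ t) xs = normalise true s (normalise true t xs)
    normalise false (s ⊙ t) xs = normalise false t (normalise false s xs)
    normalise b     (t ⁻)   xs = normalise (not b) t xs
    normalise b     𝟙       xs = xs

    push-correct : ∀ x xs → ⟦ push x xs ⟧ᴺ ≈ ⟦ x ⟧ˢ ++ ⟦ xs ⟧ᴺ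
    push-correct x [] = ≈-refl
    push-correct (i , b) ((j , c) ∷ xs) with i Fin.≟ j | b Bool.≟ not c
    ... | yes refl | yes refl = ≈-sym (≈-trans (≈-reflexive (sym (++-assoc ⟦ i , not c ⟧ˢ _ _)))
                                               (++-congʳ ⟦ xs ⟧ᴺ (annihilate c)))
      where
      annihilate : ∀ c → ⟦ i , not c ⟧ˢ ++ ⟦ i , c ⟧ˢ ≈ []
      annihilate true  = inverseˡ (Vec.lookup ρ i)
      annihilate false = inverseʳ (Vec.lookup ρ i)
    ... | yes _ | no _  = ≈-refl
    ... | no _  | yes _ = ≈-refl
    ... | no _  | no _  = ≈-refl

    ⟦_⟧± : Bool → Term n → Word
    ⟦ true  ⟧± t = ⟦ t ⟧
    ⟦ false ⟧± t = winv ⟦ t ⟧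

    winv-++ : ∀ u w → winv (u ++ w) ≈ winv w ++ winv u
    winv-++ []      w = ≈-reflexive (sym (++-identityʳ (winv w)))
    winv-++ (x ∷ u) w = ≈-trans (++-congʳ (inv x ∷ []) (winv-++ u w)) (≈-reflexive (++-assoc (winv w) (winv u) _))

    winv-involutive : ∀ w → winv (winv w) ≈ w
    winv-involutive w = ++-cancelˡ (winv w) (≈-trans (inverseʳ (winv w)) (≈-sym (inverseˡ w)))

    normalise-correct : ∀ b t xs → ⟦ normalise b t xs ⟧ᴺ ≈ ⟦ b ⟧± t ++ ⟦ xs ⟧ᴺ
    normalise-correct true  (var i) xs = push-correct (i , true) xs
    normalise-correct false (var i) xs = push-correct (i , false) xs
    normalise-correct true  (s ⊙ t) xs = begin
      ⟦ normalise true s (normalise true t xs) ⟧ᴺ ≈⟨ normalise-correct true s _ ⟩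
      ⟦ s ⟧ ++ ⟦ normalise true t xs ⟧ᴺ           ≈⟨ ++-congˡ ⟦ s ⟧ (normalise-correct true t xs) ⟩
      ⟦ s ⟧ ++ ⟦ t ⟧ ++ ⟦ xs ⟧ᴺ                   ≡⟨ sym (++-assoc ⟦ s ⟧ _ _) ⟩
      (⟦ s ⟧ ++ ⟦ t ⟧) ++ ⟦ xs ⟧ᴺ                 ∎
    normalise-correct false (s ⊙ t) xs = begin
      ⟦ normalise false t (normalise false s xs) ⟧ᴺ ≈⟨ normalise-correct false t _ ⟩
      winv ⟦ t ⟧ ++ ⟦ normalise false s xs ⟧ᴺ       ≈⟨ ++-congˡ (winv ⟦ t ⟧) (normalise-correct false s xs) ⟩
      winv ⟦ t ⟧ ++ winv ⟦ s ⟧ ++ ⟦ xs ⟧ᴺ           ≡⟨ sym (++-assoc (winv ⟦ t ⟧) _ _) ⟩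
      (winv ⟦ t ⟧ ++ winv ⟦ s ⟧) ++ ⟦ xs ⟧ᴺ         ≈⟨ ++-congʳ ⟦ xs ⟧ᴺ (winv-++ ⟦ s ⟧ ⟦ t ⟧) ⟨
      winv (⟦ s ⟧ ++ ⟦ t ⟧) ++ ⟦ xs ⟧ᴺ              ∎
    normalise-correct true  (t ⁻)   xs = normalise-correct false t xs
    normalise-correct false (t ⁻)   xs =
      ≈-trans (normalise-correct true t xs) (++-congʳ ⟦ xs ⟧ᴺ (≈-sym (winv-involutive ⟦ t ⟧)))

    normalise-correct true  𝟙       xs = ≈-refl
    normalise-correct false 𝟙       xs = ≈-refl

    group : ∀ s t → normalise true s [] ≡ normalise true t [] → ⟦ s ⟧ ≈ ⟦ t ⟧
    group s t eq = begin
      ⟦ s ⟧                       ≡⟨ sym (++-identityʳ _) ⟩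
      ⟦ s ⟧ ++ []                 ≈⟨ normalise-correct true s [] ⟨
      ⟦ normalise true s [] ⟧ᴺ    ≡⟨ cong ⟦_⟧ᴺ eq ⟩
      ⟦ normalise true t [] ⟧ᴺ    ≈⟨ normalise-correct true t [] ⟩
      ⟦ t ⟧ ++ []                 ≡⟨ ++-identityʳ _ ⟩
      ⟦ t ⟧                       ∎

derivable : List (Word × Word) → Congruence
derivable rels = record
  { _≈_ = Derivable rels ; ≈-refl = d-refl ; ≈-sym = d-sym ; ≈-trans = d-trans
  ; ≈-cancel = d-cancel ; ≈-ctx = d-ctx }

-- This is von Dyck's theorem: the presented group maps onto every marked group in which its
-- relations hold.
derivable-least : ∀ {rels} (C : Congruence) → let open Congruence C in
  (∀ {u w} → (u , w) ∈ rels → u ≈ w) → ∀ {u w} → Derivable rels u w → u ≈ w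
derivable-least C holds d-refl        = Congruence.≈-refl C
derivable-least C holds (d-sym d)     = Congruence.≈-sym C (derivable-least C holds d)
derivable-least C holds (d-trans d e) = Congruence.≈-trans C (derivable-least C holds d) (derivable-least C holds e)
derivable-least C holds (d-cancel x)  = Congruence.≈-cancel C x
derivable-least C holds (d-rel r)     = holds r
derivable-least C holds (d-ctx s t d) = Congruence.≈-ctx C s t (derivable-least C holds d)

-- Groups ⟨a⟩⟨b⟩ with ⟨a⟩ ∩ ⟨b⟩ = 1

a b : Word
a = A 1
b = B 1

pattern v₀ = var zero
pattern v₁ = var (suc zero)
pattern v₂ = var (suc (suc zero))
pattern v₃ = var (suc (suc (suc zero)))

-- Since `n ∸ 1` is `-1` modulo `n`, the sum `i * (n ∸ 1) + j` stands for `j - i`. The same device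
-- turns inverses of powers into positive powers, so that exponents stay natural numbers.
mod-eq : ∀ n {{_ : NonZero n}} i j → n ∣ i * (n ∸ 1) + j → i % n ≡ j % n
mod-eq n@(suc n-1) i j (divides c eq) = begin
  i % n           ≡⟨ [m+kn]%n≡m%n i c n ⟨
  (i + c * n) % n ≡⟨ %-congˡ {o = n} (trans (cong (λ z → i + z) (sym eq)) (lemma i j n-1)) ⟩
  (j + i * n) % n ≡⟨ [m+kn]%n≡m%n j i n ⟩
  j % n           ∎
  where
  open ≡-Reasoning
  lemma : ∀ i j k → i + (i * k + j) ≡ j + i * suc k
  lemma = solve-∀

module _ (C : Congruence) where
  open CongruenceProperties C

  pow-∣ : ∀ g {n i} → pow g n ≈ [] → n ∣ i → pow g i ≈ []
  pow-∣ g {n} gn (divides k refl) = multiple k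
    where
    multiple : ∀ k → pow g (k * n) ≈ []
    multiple zero    = ≈-refl
    multiple (suc k) = ≈-trans (≈-reflexive (pow-+ g n (k * n))) (++-cong gn (multiple k))

  winv-pow : ∀ g {n} {{_ : NonZero n}} → pow g n ≈ [] → ∀ i → winv (pow g i) ≈ pow g (i * (n ∸ 1))
  winv-pow g {n@(suc n-1)} gn i = ++-cancelˡ (pow g i) (begin
    pow g i ++ winv (pow g i)    ≈⟨ inverseʳ (pow g i) ⟩
    []                           ≈⟨ pow-∣ g gn (divides i refl) ⟨
    pow g (i * n)                ≡⟨ cong (pow g) (*-suc i n-1) ⟩
    pow g (i + i * n-1)          ≡⟨ pow-+ g i (i * n-1) ⟩
    pow g i ++ pow g (i * n-1)   ∎)
    where open ≈-Reasoning

  pow-% : ∀ g {n} {{_ : NonZero n}} → pow g n ≈ [] → ∀ i → pow g i ≈ pow g (i % n)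
  pow-% g {n} gn i = begin
    pow g i                              ≡⟨ cong (pow g) (m≡m%n+[m/n]*n i n) ⟩
    pow g (i % n + i / n * n)            ≡⟨ pow-+ g (i % n) _ ⟩
    pow g (i % n) ++ pow g (i / n * n)   ≈⟨ ++-congˡ (pow g (i % n)) (pow-∣ g gn (divides (i / n) refl)) ⟩
    pow g (i % n) ++ []                  ≡⟨ ++-identityʳ _ ⟩
    pow g (i % n)                        ∎
    where open ≈-Reasoning

  pow-≡% : ∀ g {n} {{_ : NonZero n}} → pow g n ≈ [] → ∀ i j → i % n ≡ j % n → pow g i ≈ pow g j
  pow-≡% g {n} gn i j eq = ≈-trans (pow-% g gn i)
    (≈-trans (≈-reflexive (cong (pow g) eq)) (≈-sym (pow-% g gn j)))

  -- The scale `d` is 2 where powers of `a²` are meant and 1 otherwise. Being an `ExponentGroup`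
  -- allows to pass from two commuting exponents to their gcd.
  commuting-exponents : ∀ g d w → ExponentGroup (λ l → w ++ pow g (d * l) ≈ pow g (d * l) ++ w)
  commuting-exponents g d w = record
    { has-0 = ≈-reflexive (subst (λ z → w ++ pow g z ≡ pow g z ++ w) (sym (*-zeroʳ d)) (++-identityʳ w))
    ; closed-+ = λ i j ci cj → begin
        w ++ pow g (d * (i + j))                ≡⟨ cong (w ++_) (split i j) ⟩
        w ++ pow g (d * i) ++ pow g (d * j)     ≡⟨ sym (++-assoc w _ _) ⟩
        (w ++ pow g (d * i)) ++ pow g (d * j)   ≈⟨ ++-congʳ _ ci ⟩
        (pow g (d * i) ++ w) ++ pow g (d * j)   ≡⟨ ++-assoc (pow g (d * i)) _ _ ⟩
        pow g (d * i) ++ w ++ pow g (d * j)     ≈⟨ ++-congˡ (pow g (d * i)) cj ⟩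
        pow g (d * i) ++ pow g (d * j) ++ w     ≡⟨ sym (++-assoc (pow g (d * i)) _ _) ⟩
        (pow g (d * i) ++ pow g (d * j)) ++ w   ≡⟨ cong (_++ w) (sym (split i j)) ⟩
        pow g (d * (i + j)) ++ w                ∎
    ; closed-∸ = λ i j ci cij → ++-cancelˡ (pow g (d * i)) (begin
        pow g (d * i) ++ w ++ pow g (d * j)     ≡⟨ sym (++-assoc (pow g (d * i)) _ _) ⟩
        (pow g (d * i) ++ w) ++ pow g (d * j)   ≈⟨ ++-congʳ _ ci ⟨
        (w ++ pow g (d * i)) ++ pow g (d * j)   ≡⟨ ++-assoc w _ _ ⟩
        w ++ pow g (d * i) ++ pow g (d * j)     ≡⟨ cong (w ++_) (split i j) ⟨
        w ++ pow g (d * (i + j))                ≈⟨ cij ⟩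
        pow g (d * (i + j)) ++ w                ≡⟨ cong (_++ w) (split i j) ⟩
        (pow g (d * i) ++ pow g (d * j)) ++ w   ≡⟨ ++-assoc (pow g (d * i)) _ _ ⟩
        pow g (d * i) ++ pow g (d * j) ++ w     ∎)
    }
    where
    open ≈-Reasoning
    split : ∀ i j → pow g (d * (i + j)) ≡ pow g (d * i) ++ pow g (d * j)
    split i j = trans (cong (pow g) (*-distribˡ-+ d i j)) (pow-+ g (d * i) (d * j))

-- Beyond trivial intersection, `indep` makes `p` and `q` the exact orders of `a` and `b`: set one
-- of the two exponents to 0.
record TightPair (C : Congruence) (p q : ℕ) : Set where
  open Congruence C
  field
    {{p≢0}} : NonZero p
    {{q≢0}} : NonZero q
    a-order : A p ≈ []
    b-order : B q ≈ []
    abab    : a ++ b ++ a ++ b ≈ []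
    factor  : ∀ w → ∃[ i ] ∃[ j ] w ≈ A i ++ B j
    indep   : ∀ i j → A i ≈ B j → p ∣ i × q ∣ j

-- Normal forms, and labels for the cosets of ⟨b⟩ and ⟨a⟩

module TightProperties {C : Congruence} {p q : ℕ} (tight : TightPair C p q) where
  open CongruenceProperties C public
  open TightPair tight public
  open ≈-Reasoning

  Ā B̄ : ℕ → ℕ
  Ā i = i * (p ∸ 1)
  B̄ j = j * (q ∸ 1)

  winv-A : ∀ i → winv (A i) ≈ A (Ā i)
  winv-A = winv-pow C g₁ a-order

  winv-B : ∀ j → winv (B j) ≈ B (B̄ j)
  winv-B = winv-pow C g₂ b-order

  ba≈ : b ++ a ≈ winv a ++ winv b
  ba≈ = begin
    b ++ a                                       ≈⟨ group (a ∷ b ∷ []) (v₁ ⊙ v₀) (v₀ ⁻ ⊙ (v₀ ⊙ v₁ ⊙ v₀ ⊙ v₁) ⊙ v₁ ⁻) refl ⟩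
    winv a ++ (a ++ b ++ a ++ b) ++ winv b       ≈⟨ ≈-ctx (winv a) (winv b) abab ⟩
    winv a ++ winv b                             ∎

  baba : (b ++ a) ++ (b ++ a) ≈ []
  baba = ≈-trans (++-congˡ (b ++ a) ba≈) (group (a ∷ b ∷ []) ((v₁ ⊙ v₀) ⊙ (v₀ ⁻ ⊙ v₁ ⁻)) 𝟙 refl)

  unique : ∀ i j i' j' → A i ++ B j ≈ A i' ++ B j' → i % p ≡ i' % p × j % q ≡ j' % q
  unique i j i' j' e =
      sym (mod-eq p i' i (proj₁ ind)) , mod-eq q j j' (subst (q ∣_) (+-comm j' (B̄ j)) (proj₂ ind))
    where
    step : A (Ā i' + i) ≈ B (j' + B̄ j)
    step = begin
      A (Ā i' + i)                            ≡⟨ pow-+ g₁ (Ā i') i ⟩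
      A (Ā i') ++ A i                         ≈⟨ ++-congʳ (A i) (winv-A i') ⟨
      winv (A i') ++ A i                      ≈⟨ group (A i ∷ B j ∷ A i' ∷ []) (v₂ ⁻ ⊙ v₀) (v₂ ⁻ ⊙ (v₀ ⊙ v₁) ⊙ v₁ ⁻) refl ⟩
      winv (A i') ++ (A i ++ B j) ++ winv (B j)   ≈⟨ ≈-ctx (winv (A i')) (winv (B j)) e ⟩
      winv (A i') ++ (A i' ++ B j') ++ winv (B j) ≈⟨ group (B j ∷ A i' ∷ B j' ∷ []) (v₁ ⁻ ⊙ (v₁ ⊙ v₂) ⊙ v₀ ⁻) (v₂ ⊙ v₀ ⁻) refl ⟩
      B j' ++ winv (B j)                      ≈⟨ ++-congˡ (B j') (winv-B j) ⟩
      B j' ++ B (B̄ j)                         ≡⟨ sym (pow-+ g₂ j' (B̄ j)) ⟩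
      B (j' + B̄ j)                            ∎
    ind = indep _ _ step

  vtx : Word → Fin p
  vtx w = proj₁ (factor w) mod p

  col : Word → Fin q
  col w = proj₁ (proj₂ (factor w)) mod q

  -- Inversion turns the left coset `g⟨a⟩` into the right coset `⟨a⟩g⁻¹`, and the latter is
  -- determined by the exponent of `b` in the normal form of `g⁻¹`.
  fac : Word → Fin q
  fac w = col (winv w)

  private
    mod≡⇒%≡ : ∀ {n} {{_ : NonZero n}} i j → i mod n ≡ j mod n → i % n ≡ j % n
    mod≡⇒%≡ {n} i j eq = trans (sym (Fin.toℕ-fromℕ< (m%n<n i n))) (trans (cong toℕ eq) (Fin.toℕ-fromℕ< (m%n<n j n)))

    %≡⇒mod≡ : ∀ {n} {{_ : NonZero n}} i j → i % n ≡ j % n → i mod n ≡ j mod n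
    %≡⇒mod≡ {n} i j eq = Fin.fromℕ<-cong _ _ eq (m%n<n i n) (m%n<n j n)

    toℕ-mod : ∀ {n} {{_ : NonZero n}} (i : Fin n) → toℕ i mod n ≡ i
    toℕ-mod {n} i = Fin.toℕ-injective (trans (Fin.toℕ-fromℕ< (m%n<n (toℕ i) n)) (m<n⇒m%n≡m (Fin.toℕ<n i)))

  coords : ∀ {w} i j → w ≈ A i ++ B j → vtx w ≡ i mod p × col w ≡ j mod q
  coords {w} i j e with factor w
  ... | i' , j' , e' with unique i' j' i j (≈-trans (≈-sym e') e)
  ... | ei , ej = %≡⇒mod≡ i' i ei , %≡⇒mod≡ j' j ej

  vtx-sound : ∀ g h → vtx g ≡ vtx h → ∃[ j ] h ≈ g ++ B j
  vtx-sound g h eq with factor g | factor h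
  ... | i , j , e | i' , j' , e' = B̄ j + j' , (begin
    h                                     ≈⟨ e' ⟩
    A i' ++ B j'                          ≈⟨ ++-congʳ (B j') (pow-≡% C g₁ a-order i i' (mod≡⇒%≡ i i' eq)) ⟨
    A i ++ B j'                           ≈⟨ group (A i ∷ B j ∷ B j' ∷ []) (v₀ ⊙ v₂) ((v₀ ⊙ v₁) ⊙ v₁ ⁻ ⊙ v₂) refl ⟩
    (A i ++ B j) ++ winv (B j) ++ B j'    ≈⟨ ++-cong (≈-sym e) (++-congʳ (B j') (winv-B j)) ⟩
    g ++ B (B̄ j) ++ B j'                  ≡⟨ cong (g ++_) (sym (pow-+ g₂ (B̄ j) j')) ⟩
    g ++ B (B̄ j + j')                     ∎)

  vtx-complete : ∀ g h j → h ≈ g ++ B j → vtx g ≡ vtx h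
  vtx-complete g h k eq = sym (proj₁ (coords (proj₁ (factor g)) (proj₁ (proj₂ (factor g)) + k) (begin
    h                       ≈⟨ eq ⟩
    g ++ B k                ≈⟨ ++-congʳ (B k) (proj₂ (proj₂ (factor g))) ⟩
    (A i ++ B j) ++ B k     ≡⟨ ++-assoc (A i) _ _ ⟩
    A i ++ B j ++ B k       ≡⟨ cong (A i ++_) (sym (pow-+ g₂ j k)) ⟩
    A i ++ B (j + k)        ∎)))
    where
    i = proj₁ (factor g)
    j = proj₁ (proj₂ (factor g))

  vtx-cong : ∀ {g h} → g ≈ h → vtx g ≡ vtx h
  vtx-cong {g} {h} e = vtx-complete g h 0 (≈-trans (≈-sym e) (≈-reflexive (sym (++-identityʳ g))))

  fac-sound : ∀ g h → fac g ≡ fac h → ∃[ i ] h ≈ g ++ A i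
  fac-sound g h eq with factor (winv g) | factor (winv h)
  ... | i , j , e | i' , j' , e' = i + Ā i' , (begin
    h                                     ≈⟨ group (h ∷ []) v₀ (v₀ ⁻ ⁻) refl ⟩
    winv (winv h)                         ≈⟨ winv-cong e' ⟩
    winv (A i' ++ B j')                   ≈⟨ winv-cong (++-congˡ (A i') (pow-≡% C g₂ b-order j j' (mod≡⇒%≡ j j' eq))) ⟨
    winv (A i' ++ B j)                    ≈⟨ group (A i ∷ B j ∷ A i' ∷ []) ((v₂ ⊙ v₁) ⁻) ((v₀ ⊙ v₁) ⁻ ⊙ v₀ ⊙ v₂ ⁻) refl ⟩
    winv (A i ++ B j) ++ A i ++ winv (A i') ≈⟨ ++-cong (winv-cong (≈-sym e)) (++-congˡ (A i) (winv-A i')) ⟩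
    winv (winv g) ++ A i ++ A (Ā i')      ≈⟨ ++-congʳ _ (group (g ∷ []) v₀ (v₀ ⁻ ⁻) refl) ⟨
    g ++ A i ++ A (Ā i')                  ≡⟨ cong (g ++_) (sym (pow-+ g₁ i (Ā i'))) ⟩
    g ++ A (i + Ā i')                     ∎)

  fac-complete : ∀ g h i → h ≈ g ++ A i → fac g ≡ fac h
  fac-complete g h k eq = sym (proj₂ (coords (Ā k + i) j (begin
    winv h                       ≈⟨ winv-cong eq ⟩
    winv (g ++ A k)              ≈⟨ group (g ∷ A k ∷ []) ((v₀ ⊙ v₁) ⁻) (v₁ ⁻ ⊙ v₀ ⁻) refl ⟩
    winv (A k) ++ winv g         ≈⟨ ++-cong (winv-A k) (proj₂ (proj₂ (factor (winv g)))) ⟩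
    A (Ā k) ++ A i ++ B j        ≡⟨ sym (++-assoc (A (Ā k)) _ _) ⟩
    (A (Ā k) ++ A i) ++ B j      ≡⟨ cong (_++ B j) (sym (pow-+ g₁ (Ā k) i)) ⟩
    A (Ā k + i) ++ B j           ∎)))
    where
    i = proj₁ (factor (winv g))
    j = proj₁ (proj₂ (factor (winv g)))

  fac-cong : ∀ {g h} → g ≈ h → fac g ≡ fac h
  fac-cong {g} {h} e = fac-complete g h 0 (≈-trans (≈-sym e) (≈-reflexive (sym (++-identityʳ g))))

  powers-meet : ∀ g h i j → h ≈ g ++ A i → h ≈ g ++ B j → g ≈ h
  powers-meet g h i j ea eb = ≈-sym (begin
    h        ≈⟨ ea ⟩
    g ++ A i ≈⟨ ++-congˡ g (pow-∣ C g₁ a-order (proj₁ (indep i j (++-cancelˡ g (≈-trans (≈-sym ea) eb))))) ⟩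
    g ++ []  ≡⟨ ++-identityʳ g ⟩
    g        ∎)

  vtx-fac-injective : ∀ g h → vtx g ≡ vtx h → fac g ≡ fac h → g ≈ h
  vtx-fac-injective g h ev ef = powers-meet g h _ _ (proj₂ (fac-sound g h ef)) (proj₂ (vtx-sound g h ev))

  vtx-rep : ∀ v → vtx (A (toℕ v)) ≡ v
  vtx-rep v = trans (proj₁ (coords (toℕ v) 0 (≈-reflexive (sym (++-identityʳ _))))) (toℕ-mod v)

  fac-rep : ∀ f → fac (winv (B (toℕ f))) ≡ f
  fac-rep f = trans (proj₂ (coords 0 (toℕ f) (group (B (toℕ f) ∷ []) (v₀ ⁻ ⁻) v₀ refl))) (toℕ-mod f)

  code-rep : ∀ i j → vtx (A (toℕ i) ++ B (toℕ j)) ≡ i × col (A (toℕ i) ++ B (toℕ j)) ≡ j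
  code-rep i j with coords {A (toℕ i) ++ B (toℕ j)} (toℕ i) (toℕ j) ≈-refl
  ... | ei , ej = trans ei (toℕ-mod i) , trans ej (toℕ-mod j)

  code-sound : ∀ g h → vtx g ≡ vtx h → col g ≡ col h → g ≈ h
  code-sound g h ei ej with factor g | factor h
  ... | i , j , e | i' , j' , e' = ≈-trans e (≈-trans
    (++-cong (pow-≡% C g₁ a-order i i' (mod≡⇒%≡ i i' ei)) (pow-≡% C g₂ b-order j j' (mod≡⇒%≡ j j' ej))) (≈-sym e'))

  col-cong : ∀ {g h} → g ≈ h → col g ≡ col h
  col-cong {g} {h} e = trans (proj₂ (coords (proj₁ (factor h)) (proj₁ (proj₂ (factor h)))
    (≈-trans e (proj₂ (proj₂ (factor h)))))) refl

  -- The factorisation is used to exchange the two cyclic groups: from `bʲaⁱ = aˡbᵏ` the element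
  -- `aⁱb⁻ᵏ = b⁻ʲaˡ` lies both in `aⁱ⟨b⟩` and in `b⁻ʲ⟨a⟩`.
  meet : ∀ v f → Σ Word λ g → vtx g ≡ v × fac g ≡ f
  meet v f = g ,
      trans (sym (vtx-complete (A i) g (B̄ k) (++-congˡ (A i) (winv-B k)))) (vtx-rep v) ,
      trans (sym (fac-complete (winv (B j)) g l (begin
        A i ++ winv (B k)                             ≈⟨ group (B j ∷ A i ∷ B k ∷ []) (v₁ ⊙ v₂ ⁻) (v₀ ⁻ ⊙ (v₀ ⊙ v₁) ⊙ v₂ ⁻) refl ⟩
        winv (B j) ++ (B j ++ A i) ++ winv (B k)      ≈⟨ ≈-ctx (winv (B j)) (winv (B k)) e ⟩
        winv (B j) ++ (A l ++ B k) ++ winv (B k)      ≈⟨ group (B j ∷ A l ∷ B k ∷ []) (v₀ ⁻ ⊙ (v₁ ⊙ v₂) ⊙ v₂ ⁻) (v₀ ⁻ ⊙ v₁) refl ⟩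
        winv (B j) ++ A l                             ∎))) (fac-rep f)
    where
    i = toℕ v
    j = toℕ f
    l = proj₁ (factor (B j ++ A i))
    k = proj₁ (proj₂ (factor (B j ++ A i)))
    e = proj₂ (proj₂ (factor (B j ++ A i)))
    g = A i ++ winv (B k)

  _≟ʷ_ : ∀ u w → Dec (u ≈ w)
  u ≟ʷ w with vtx u Fin.≟ vtx w | col u Fin.≟ col w
  ... | yes ei | yes ej = yes (code-sound u w ei ej)
  ... | no ¬ei | _      = no λ e → ¬ei (vtx-cong e)
  ... | yes _  | no ¬ej = no λ e → ¬ej (col-cong e)

-- Quotients by normal cyclic subgroups

Normal : Congruence → Gen → ℕ → Set
Normal C g d = ∀ i w → ∃[ j ] pow g (d * i) ++ w ≈ w ++ pow g (d * j)
  where open Congruence C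

module _ (C : Congruence) (g : Gen) (d : ℕ) where
  open CongruenceProperties C
  open ≈-Reasoning

  infix 4 _~_
  -- Equality modulo the powers of `g^d`. With a power on either side no negative exponent occurs
  -- and symmetry is immediate, whether or not `g` has finite order.
  _~_ : Word → Word → Set
  u ~ w = ∃[ i ] ∃[ j ] u ++ pow g (d * i) ≈ w ++ pow g (d * j)

  pow-split : ∀ i j → pow g (d * (i + j)) ≡ pow g (d * i) ++ pow g (d * j)
  pow-split i j = trans (cong (pow g) (*-distribˡ-+ d i j)) (pow-+ g (d * i) (d * j))

  ≈⇒~ : ∀ {u w} → u ≈ w → u ~ w
  ≈⇒~ e = 0 , 0 , ++-congʳ (pow g (d * 0)) e

  ~-trans : ∀ {u w z} → u ~ w → w ~ z → u ~ z
  ~-trans {u} {w} {z} (i , j , e) (i' , j' , e') = i + i' , j' + j , (begin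
    u ++ pow g (d * (i + i'))                   ≡⟨ cong (u ++_) (pow-split i i') ⟩
    u ++ pow g (d * i) ++ pow g (d * i')        ≡⟨ ++-assoc u _ _ ⟨
    (u ++ pow g (d * i)) ++ pow g (d * i')      ≈⟨ ++-congʳ _ e ⟩
    (w ++ pow g (d * j)) ++ pow g (d * i')      ≡⟨ ++-assoc w _ _ ⟩
    w ++ pow g (d * j) ++ pow g (d * i')        ≡⟨ cong (w ++_) (pow-comm g (d * j) (d * i')) ⟩
    w ++ pow g (d * i') ++ pow g (d * j)        ≡⟨ ++-assoc w _ _ ⟨
    (w ++ pow g (d * i')) ++ pow g (d * j)      ≈⟨ ++-congʳ _ e' ⟩
    (z ++ pow g (d * j')) ++ pow g (d * j)      ≡⟨ ++-assoc z _ _ ⟩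
    z ++ pow g (d * j') ++ pow g (d * j)        ≡⟨ cong (z ++_) (pow-split j' j) ⟨
    z ++ pow g (d * (j' + j))                   ∎)

  ~-ctx : Normal C g d → ∀ s t {u w} → u ~ w → s ++ u ++ t ~ s ++ w ++ t
  ~-ctx normal s t {u} {w} (i , j , e) with normal i t | normal j t
  ... | i' , ei | j' , ej = i' , j' , (begin
    (s ++ u ++ t) ++ pow g (d * i')   ≈⟨ shift u i i' ei ⟩
    s ++ (u ++ pow g (d * i)) ++ t    ≈⟨ ≈-ctx s t e ⟩
    s ++ (w ++ pow g (d * j)) ++ t    ≈⟨ shift w j j' ej ⟨
    (s ++ w ++ t) ++ pow g (d * j')   ∎)
    where
    shift : ∀ u i i' → pow g (d * i) ++ t ≈ t ++ pow g (d * i') →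
      (s ++ u ++ t) ++ pow g (d * i') ≈ s ++ (u ++ pow g (d * i)) ++ t
    shift u i i' e = begin
      (s ++ u ++ t) ++ pow g (d * i')   ≡⟨ ++-assoc s _ _ ⟩
      s ++ (u ++ t) ++ pow g (d * i')   ≡⟨ cong (s ++_) (++-assoc u _ _) ⟩
      s ++ u ++ t ++ pow g (d * i')     ≈⟨ ++-congˡ s (++-congˡ u e) ⟨
      s ++ u ++ pow g (d * i) ++ t      ≡⟨ cong (s ++_) (++-assoc u _ _) ⟨
      s ++ (u ++ pow g (d * i)) ++ t    ∎

  quotientBy : Normal C g d → Congruence
  quotientBy normal = record
    { _≈_ = _~_
    ; ≈-refl = ≈⇒~ ≈-refl
    ; ≈-sym = λ (i , j , e) → j , i , ≈-sym e
    ; ≈-trans = ~-trans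
    ; ≈-cancel = λ x → ≈⇒~ (≈-cancel x)
    ; ≈-ctx = ~-ctx normal }

  pow~[] : pow g d ~ []
  pow~[] = 0 , 1 , ≈-reflexive (trans (cong (pow g d ++_) (cong (pow g) (*-zeroʳ d)))
    (trans (++-identityʳ _) (cong (pow g) (sym (*-identityʳ d)))))

module _ {C : Congruence} {p q : ℕ} (tight : TightPair C p q) where
  open TightProperties tight
  open ≈-Reasoning

  -- An equation `aⁱ = bʲ` in the quotient lifts to one in which the exponent of `b` has changed by
  -- a multiple of `d`; as `d ∣ q`, divisibility by `q` upstairs still gives `d ∣ j`.
  tight-/b : ∀ {d} → d ∣ q → (normal : Normal C g₂ d) → TightPair (quotientBy C g₂ d normal) p d
  tight-/b {d} d∣q normal = record
    { q≢0 = ≢-nonZero λ { refl → contradiction (0∣⇒≡0 d∣q) (≢-nonZero⁻¹ q) }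
    ; a-order = ≈⇒~ C g₂ d a-order
    ; b-order = pow~[] C g₂ d
    ; abab = ≈⇒~ C g₂ d abab
    ; factor = λ w → let i , j , e = factor w in i , j , ≈⇒~ C g₂ d e
    ; indep = indep~ }
    where
    indep~ : ∀ i j → _~_ C g₂ d (A i) (B j) → p ∣ i × d ∣ j
    indep~ i j (x , y , e) = proj₁ ind ,
      ∣m+n∣m⇒∣n (subst (d ∣_) (+-comm j _) (∣-trans d∣q (proj₂ ind)))
        (∣m∣n⇒∣m+n (m∣m*n y) (∣-trans (m∣m*n x) (m∣m*n (q ∸ 1))))
      where
      ind : p ∣ i × q ∣ j + (d * y + B̄ (d * x))
      ind = indep i (j + (d * y + B̄ (d * x))) (begin
        A i                                          ≈⟨ group (A i ∷ B (d * x) ∷ []) v₀ ((v₀ ⊙ v₁) ⊙ v₁ ⁻) refl ⟩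
        (A i ++ B (d * x)) ++ winv (B (d * x))       ≈⟨ ++-cong e (winv-B (d * x)) ⟩
        (B j ++ B (d * y)) ++ B (B̄ (d * x))          ≡⟨ ++-assoc (B j) _ _ ⟩
        B j ++ B (d * y) ++ B (B̄ (d * x))            ≡⟨ cong (B j ++_) (pow-+ g₂ (d * y) _) ⟨
        B j ++ B (d * y + B̄ (d * x))                 ≡⟨ pow-+ g₂ j _ ⟨
        B (j + (d * y + B̄ (d * x)))                  ∎)

  tight-/a : ∀ {d} → d ∣ p → (normal : Normal C g₁ d) → TightPair (quotientBy C g₁ d normal) d q
  tight-/a {d} d∣p normal = record
    { p≢0 = ≢-nonZero λ { refl → contradiction (0∣⇒≡0 d∣p) (≢-nonZero⁻¹ p) }
    ; a-order = pow~[] C g₁ d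
    ; b-order = ≈⇒~ C g₁ d b-order
    ; abab = ≈⇒~ C g₁ d abab
    ; factor = λ w → let i , j , e = factor w in i , j , ≈⇒~ C g₁ d e
    ; indep = indep~ }
    where
    indep~ : ∀ i j → _~_ C g₁ d (A i) (B j) → d ∣ i × q ∣ j
    indep~ i j (x , y , e) =
      ∣m+n∣m⇒∣n (subst (d ∣_) (+-comm i _) (∣-trans d∣p (proj₁ ind)))
        (∣m∣n⇒∣m+n (m∣m*n x) (∣-trans (m∣m*n y) (m∣m*n (p ∸ 1)))) , proj₂ ind
      where
      ind : p ∣ i + (d * x + Ā (d * y)) × q ∣ j
      ind = indep (i + (d * x + Ā (d * y))) j (≈-sym (begin
        B j                                          ≈⟨ group (B j ∷ A (d * y) ∷ []) v₀ ((v₀ ⊙ v₁) ⊙ v₁ ⁻) refl ⟩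
        (B j ++ A (d * y)) ++ winv (A (d * y))       ≈⟨ ++-cong (≈-sym e) (winv-A (d * y)) ⟩
        (A i ++ A (d * x)) ++ A (Ā (d * y))          ≡⟨ ++-assoc (A i) _ _ ⟩
        A i ++ A (d * x) ++ A (Ā (d * y))            ≡⟨ cong (A i ++_) (pow-+ g₁ (d * x) _) ⟨
        A i ++ A (d * x + Ā (d * y))                 ≡⟨ pow-+ g₁ i _ ⟨
        A (i + (d * x + Ā (d * y)))                  ∎))

  -- Conjugation preserves orders, and a cyclic group of order n contains only
  -- one subgroup of order n/d.
  conjugate-power : ∀ g n d → NonZero n → (pow g n ≈ []) → (∀ i → pow g i ≈ [] → n ∣ i) → d ∣ n →
    (∀ w → ∃[ l ] pow g d ++ w ≈ w ++ pow g l) → Normal C g d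
  conjugate-power g n d n≢0 gn order (divides c n≡cd) conj i w with conj w
  ... | l , e with l-multiple
    where
    iterated : ∀ k → pow g (k * d) ++ w ≈ w ++ pow g (k * l)
    iterated zero    = ≈-reflexive (sym (++-identityʳ w))
    iterated (suc k) = begin
      pow g (d + k * d) ++ w              ≡⟨ cong (_++ w) (pow-+ g d _) ⟩
      (pow g d ++ pow g (k * d)) ++ w     ≡⟨ ++-assoc (pow g d) _ _ ⟩
      pow g d ++ pow g (k * d) ++ w       ≈⟨ ++-congˡ (pow g d) (iterated k) ⟩
      pow g d ++ w ++ pow g (k * l)       ≡⟨ ++-assoc (pow g d) _ _ ⟨
      (pow g d ++ w) ++ pow g (k * l)     ≈⟨ ++-congʳ _ e ⟩
      (w ++ pow g l) ++ pow g (k * l)     ≡⟨ ++-assoc w _ _ ⟩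
      w ++ pow g l ++ pow g (k * l)       ≡⟨ cong (w ++_) (pow-+ g l _) ⟨
      w ++ pow g (l + k * l)              ∎
    -- With `n = c d`, the `c`-th power of `pow g d` is trivial, so its conjugate `pow g (c * l)` is
    -- trivial as well; `n` divides `c l`, and `c` cancels.
    l-multiple : d ∣ l × (∀ k → pow g (k * d) ++ w ≈ w ++ pow g (k * l))
    l-multiple = *-cancelˡ-∣ c {{c≢0}} (subst (_∣ c * l) n≡cd (order (c * l) (++-cancelˡ w (begin
        w ++ pow g (c * l)     ≈⟨ iterated c ⟨
        pow g (c * d) ++ w     ≡⟨ cong (λ z → pow g z ++ w) n≡cd ⟨
        pow g n ++ w           ≈⟨ ++-congʳ w gn ⟩
        w                      ≡⟨ ++-identityʳ w ⟨
        w ++ []                ∎)))) , iterated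
      where
      c≢0 : NonZero c
      c≢0 = ≢-nonZero λ { refl → contradiction n≡cd (≢-nonZero⁻¹ n {{n≢0}}) }
  ... | divides l' refl , iterated = i * l' , (begin
    pow g (d * i) ++ w          ≡⟨ cong (λ z → pow g z ++ w) (*-comm d i) ⟩
    pow g (i * d) ++ w          ≈⟨ iterated i ⟩
    w ++ pow g (i * (l' * d))   ≡⟨ cong (λ z → w ++ pow g z) (trans (sym (*-assoc i l' d)) (*-comm (i * l') d)) ⟩
    w ++ pow g (d * (i * l'))   ∎)

  a-order∣ : ∀ i → A i ≈ [] → p ∣ i
  a-order∣ i e = proj₁ (indep i 0 e)

  b-order∣ : ∀ j → B j ≈ [] → q ∣ j
  b-order∣ j e = proj₂ (indep 0 j (≈-sym e))

  -- f w stands for a point of a set on which the group acts.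
  fixing-exponents : ∀ {N} (f : Word → Fin N) → (∀ {u w} → u ≈ w → f u ≡ f w) →
    (∀ s u w → f u ≡ f w → f (s ++ u) ≡ f (s ++ w)) → ∀ g d w →
    ExponentGroup (λ l → f (pow g (d * l) ++ w) ≡ f w) ×
    (∀ i l → f (pow g (d * i) ++ w) ≡ f (pow g (d * (i + l)) ++ w) → f (pow g (d * l) ++ w) ≡ f w)
  fixing-exponents f f-cong f-act g d w = record
    { has-0 = cong (λ z → f (pow g z ++ w)) (*-zeroʳ d)
    ; closed-+ = λ i j ei ej → trans (split i j) (trans (f-act (pow g (d * i)) _ _ ej) ei)
    ; closed-∸ = λ i j ei eij → uncancel i j (trans ei (sym eij)) }
    , uncancel
    where
    split : ∀ i j → f (pow g (d * (i + j)) ++ w) ≡ f (pow g (d * i) ++ pow g (d * j) ++ w)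
    split i j = cong f (trans (cong (_++ w) (pow-split C g d i j)) (++-assoc (pow g (d * i)) _ _))
    uncancel : ∀ i l → f (pow g (d * i) ++ w) ≡ f (pow g (d * (i + l)) ++ w) → f (pow g (d * l) ++ w) ≡ f w
    uncancel i l e = trans (f-cong (group (x ∷ pow g (d * l) ∷ w ∷ []) (v₁ ⊙ v₂) (v₀ ⁻ ⊙ v₀ ⊙ v₁ ⊙ v₂) refl))
        (trans (sym (f-act (winv x) _ _ (trans e (split i l))))
          (f-cong (group (x ∷ w ∷ []) (v₀ ⁻ ⊙ v₀ ⊙ v₁) v₁ refl)))
      where x = pow g (d * i)

  vtx-act : ∀ s u w → vtx u ≡ vtx w → vtx (s ++ u) ≡ vtx (s ++ w)
  vtx-act s u w eq with vtx-sound u w eq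
  ... | j , e = vtx-complete _ _ j (≈-trans (++-congˡ s e) (≈-reflexive (sym (++-assoc s u (B j)))))

  fac-act : ∀ s u w → fac u ≡ fac w → fac (s ++ u) ≡ fac (s ++ w)
  fac-act s u w eq with fac-sound u w eq
  ... | j , e = fac-complete _ _ j (≈-trans (++-congˡ s e) (≈-reflexive (sym (++-assoc s u (A j)))))

-- Cores, and the regular case

-- A map that misses a point has a target with one element less. This turns an orbit bound `≤ N`
-- into `< N`, which for prime powers means the next smaller power.
avoid : ∀ {N} (c : Fin N) (f : ℕ → Fin N) → (∀ l → c ≢ f l) →
  ∃[ N' ] suc N' ≡ N × Σ (ℕ → Fin N') λ f' → ∀ i j → f' i ≡ f' j → f i ≡ f j
avoid {suc N'} c f c≢f = N' , refl , (λ l → Fin.punchOut (c≢f l)) ,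
  λ i j → Fin.punchOut-injective (c≢f i) (c≢f j)

-- The automorphism of the free group that inverts both generators; unlike `winv` it keeps the order
-- of the letters.
bar : Word → Word
bar = map inv

bar-involutive : ∀ w → bar (bar w) ≡ w
bar-involutive []      = refl
bar-involutive (x ∷ w) = cong₂ _∷_ (inv-involutive x) (bar-involutive w)

bar-pow : ∀ g n → bar (pow g n) ≡ winv (pow g n)
bar-pow g zero    = refl
bar-pow g (suc n) = trans (snoc n) (cong (_++ (g , false) ∷ []) (bar-pow g n))
  where
  snoc : ∀ n → (g , false) ∷ bar (pow g n) ≡ bar (pow g n) ++ (g , false) ∷ []
  snoc zero    = refl
  snoc (suc n) = cong (_ ∷_) (snoc n)

-- A reflection conjugates both generators to their inverses, so for rotation
-- groups this property expresses regularity.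
BarInvariant : Congruence → Set
BarInvariant C = ∀ u w → u ≈ w → bar u ≈ bar w
  where open Congruence C

A²-commutes : Congruence → Set
A²-commutes C = A 2 ++ b ≈ b ++ A 2
  where open Congruence C

module _ {C : Congruence} {p q : ℕ} (tight : TightPair C p q) (z : Word) where
  open TightProperties tight
  open ≈-Reasoning

  private
    ab≈ : a ++ b ≈ winv b ++ winv a
    ab≈ = ≈-trans (group (a ∷ b ∷ []) (v₀ ⊙ v₁) ((v₀ ⊙ v₁ ⊙ v₀ ⊙ v₁) ⊙ (v₁ ⁻ ⊙ v₀ ⁻)) refl)
            (++-congʳ (winv b ++ winv a) abab)

  -- The exponent 3 arises here: `(ab)² = 1` gives `b⁻¹a⁻¹ = ab`, so `b⁻¹a = (ab)a²`, and the twist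
  -- moves `a²` to the left to join the first `a`.
  b⁻¹a≈ : b ++ A 2 ≈ A 2 ++ b ++ z → winv b ++ a ≈ A 3 ++ b ++ z
  b⁻¹a≈ twist = begin
    winv b ++ a                        ≈⟨ group (a ∷ b ∷ []) (v₁ ⁻ ⊙ v₀) ((v₁ ⁻ ⊙ v₀ ⁻) ⊙ v₀ ⊙ v₀) refl ⟩
    (winv b ++ winv a) ++ A 2          ≈⟨ ++-congʳ (A 2) ab≈ ⟨
    (a ++ b) ++ A 2                    ≈⟨ ++-congˡ a twist ⟩
    a ++ A 2 ++ b ++ z                 ∎

  -- Here `ba⁻¹ = a⁻¹(ab)a⁻¹ = a⁻³ · a²b⁻¹a⁻²`. The twist gives `a⁻²ba² = bz`, hence
  -- `a²ba⁻² = bz⁻¹`, and inverting yields `b⁻¹z`; this is why `z` has the same sign in both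
  -- relations.
  ba⁻¹≈ : b ++ A 2 ≈ A 2 ++ b ++ z → A 2 ++ z ≈ z ++ A 2 → b ++ z ≈ z ++ b →
    b ++ winv a ≈ winv (A 3) ++ winv b ++ z
  ba⁻¹≈ twist A²z bz = begin
    b ++ winv a                                            ≈⟨ group (a ∷ b ∷ []) (v₁ ⊙ v₀ ⁻) (v₀ ⁻ ⊙ (v₀ ⊙ v₁) ⊙ v₀ ⁻) refl ⟩
    winv a ++ (a ++ b) ++ winv a                           ≈⟨ ≈-ctx (winv a) (winv a) ab≈ ⟩
    winv a ++ (winv b ++ winv a) ++ winv a                 ≈⟨ group (a ∷ b ∷ []) (v₀ ⁻ ⊙ (v₁ ⁻ ⊙ v₀ ⁻) ⊙ v₀ ⁻) ((v₀ ⊙ v₀ ⊙ v₀) ⁻ ⊙ (v₀ ⊙ v₀) ⊙ v₁ ⁻ ⊙ (v₀ ⊙ v₀) ⁻) refl ⟩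
    winv (A 3) ++ A 2 ++ winv b ++ winv (A 2)              ≈⟨ ++-congˡ (winv (A 3)) conjugate ⟩
    winv (A 3) ++ winv b ++ z                              ∎
    where
    conjugate : A 2 ++ winv b ++ winv (A 2) ≈ winv b ++ z
    conjugate = begin
      A 2 ++ winv b ++ winv (A 2)                ≈⟨ group (A 2 ∷ b ∷ z ∷ []) (v₀ ⊙ v₁ ⁻ ⊙ v₀ ⁻) ((v₀ ⊙ v₂) ⊙ (v₀ ⊙ v₁ ⊙ v₂) ⁻) refl ⟩
      (A 2 ++ z) ++ winv (A 2 ++ b ++ z)         ≈⟨ ++-cong A²z (winv-cong (≈-sym twist)) ⟩
      (z ++ A 2) ++ winv (b ++ A 2)              ≈⟨ group (A 2 ∷ b ∷ z ∷ []) ((v₂ ⊙ v₀) ⊙ (v₁ ⊙ v₀) ⁻) (v₁ ⁻ ⊙ (v₁ ⊙ v₂) ⊙ v₁ ⁻) refl ⟩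
      winv b ++ (b ++ z) ++ winv b               ≈⟨ ≈-ctx (winv b) (winv b) bz ⟩
      winv b ++ (z ++ b) ++ winv b               ≈⟨ group (b ∷ z ∷ []) (v₀ ⁻ ⊙ (v₁ ⊙ v₀) ⊙ v₀ ⁻) (v₀ ⁻ ⊙ v₁) refl ⟩
      winv b ++ z                                ∎

-- Cores in type {2m^α, m^γ} and the exponents of b⁻¹a

module OddPrime {m : ℕ} (m-prime : Prime m) (m-odd : ¬ (2 ∣ m)) where

  instance
    m≢0 : NonZero m
    m≢0 = prime⇒nonZero m-prime

  m>2 : 2 < m
  m>2 = ≤∧≢⇒< (prime>1 m-prime) λ { refl → m-odd ∣-refl }

  m∤2 : ¬ (m ∣ 2)
  m∤2 m∣2 = <⇒≱ m>2 (∣⇒≤ m∣2)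

  ^-∣ : ∀ {i j} → i ≤ j → m ^ i ∣ m ^ j
  ^-∣ {i} {j} i≤j = divides (m ^ (j ∸ i))
    (trans (cong (m ^_) (sym (m∸n+n≡m i≤j))) (^-distribˡ-+-* m (j ∸ i) i))

  -- An orbit of `b` on the `2 * m ^ α` vertices has `m`-power length, and `2 < m` forces this
  -- length to be at most `m ^ α`. So `B (m ^ γ)` fixes every coset `w⟨b⟩`, which means that its
  -- conjugates stay in `⟨b⟩`.
  b-core : ∀ {C} α γ → α ≤ γ → TightPair C (2 * m ^ α) (m ^ suc γ) → Normal C g₂ (m ^ γ)
  b-core {C} α γ α≤γ tight =
    conjugate-power tight g₂ (m ^ suc γ) (m ^ γ) q≢0 b-order (b-order∣ tight) (^-∣ (n≤1+n γ)) conj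
    where
    open TightProperties tight
    conj : ∀ w → ∃[ l ] B (m ^ γ) ++ w ≈ w ++ B l
    conj w = vtx-sound w (B (m ^ γ) ++ w)
      (sym (subst (λ z → vtx (B z ++ w) ≡ vtx w) (*-identityˡ (m ^ γ)) (closed-∣ (^-∣ (≤-trans δ≤α α≤γ)) D-δ)))
      where
      fixing = fixing-exponents tight vtx vtx-cong (vtx-act tight) g₂ 1 w
      open ExponentGroup (proj₁ fixing)
      bound = orbit-bound m-prime (proj₁ fixing) (λ l → vtx (B (1 * l) ++ w) Fin.≟ vtx w)
        (λ l → vtx (B (1 * l) ++ w)) (proj₂ fixing) (suc γ)
        (vtx-cong (++-congʳ w (≈-trans (≈-reflexive (cong B (*-identityˡ (m ^ suc γ)))) b-order)))
      δ = proj₁ bound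
      D-δ = proj₁ (proj₂ bound)
      δ≤α : δ ≤ α
      δ≤α = ^-cancelˡ-≤ m-prime (≤-<-trans (proj₂ (proj₂ bound))
        (*-monoˡ-< (m ^ α) {{m^n≢0 m α}} m>2))

  -- The square `a²` has `m`-power order, so its orbits on faces have `m`-power length. The base
  -- face is fixed, and an orbit of any other face misses it, hence is shorter than
  -- `m ^ γ ≤ m ^ suc α` and has length at most `m ^ α`. For the base face itself `w` is a power of
  -- `a`.
  a-core : ∀ {C} α γ → γ ≤ suc α → TightPair C (2 * m ^ suc α) (m ^ γ) → Normal C g₁ (2 * m ^ α)
  a-core {C} α γ γ≤α tight =
    conjugate-power tight g₁ (2 * m ^ suc α) (2 * m ^ α) p≢0 a-order (a-order∣ tight)
      (*-monoʳ-∣ 2 (^-∣ (n≤1+n α))) conj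
    where
    open TightProperties tight
    conj : ∀ w → ∃[ l ] A (2 * m ^ α) ++ w ≈ w ++ A l
    conj w with fac [] Fin.≟ fac w
    ... | yes e with fac-sound [] w e
    ...   | i , w≈ = 2 * m ^ α , ≈-trans (++-congˡ (A (2 * m ^ α)) w≈)
              (≈-trans (≈-reflexive (pow-comm g₁ (2 * m ^ α) i)) (++-congʳ (A (2 * m ^ α)) (≈-sym w≈)))
    conj w | no ¬e with avoid (fac []) (λ l → fac (A (2 * l) ++ w)) off-base
      where
      off-base : ∀ l → fac [] ≢ fac (A (2 * l) ++ w)
      off-base l e = ¬e (trans (fac-complete [] (winv (A (2 * l)) ++ []) (Ā (2 * l))
          (≈-trans (≈-reflexive (++-identityʳ _)) (winv-A (2 * l))))
        (trans (fac-act tight (winv (A (2 * l))) [] _ e)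
          (fac-cong (group (A (2 * l) ∷ w ∷ []) (v₀ ⁻ ⊙ v₀ ⊙ v₁) v₁ refl))))
    ... | N' , suc-N' , f' , reflects = fac-sound w (A (2 * m ^ α) ++ w) (sym (closed-∣ (^-∣ δ≤α) D-δ))
      where
      fixing = fixing-exponents tight fac fac-cong (fac-act tight) g₁ 2 w
      open ExponentGroup (proj₁ fixing)
      bound = orbit-bound m-prime (proj₁ fixing) (λ l → fac (A (2 * l) ++ w) Fin.≟ fac w)
        f' (λ i l e → proj₂ fixing i l (reflects i (i + l) e)) (suc α)
        (fac-cong (++-congʳ w a-order))
      δ = proj₁ bound
      D-δ = proj₁ (proj₂ bound)
      δ≤α : δ ≤ α
      δ≤α = ^-cancelˡ-≤ m-prime (<-≤-trans (≤-<-trans (proj₂ (proj₂ bound)) (≤-reflexive suc-N')) (^-monoʳ-≤ m γ≤α))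

  odd-coprime-2 : Coprime 2 m
  odd-coprime-2 = Coprimality.sym (Coprimality.prime⇒coprime m-prime m>2)

  -- The involution ab shows that b² centralises a² as soon as ⟨a²⟩ is normal.
  normal⇒commutes : ∀ {C p} (tight : TightPair C p (m ^ 1)) → Normal C g₁ 2 → A²-commutes C
  normal⇒commutes {C} tight normal with normal 1 b
  ... | j , e = closed-coprime odd-coprime-2 b²-commutes bᵐ-commutes
    where
    open TightProperties tight
    open ≈-Reasoning
    open ExponentGroup (commuting-exponents C g₂ 1 (A 2))
    y = winv b ++ A 2 ++ b
    y≈ : y ≈ A (2 * j)
    y≈ = ≈-trans (++-congˡ (winv b) e) (group (b ∷ A (2 * j) ∷ []) (v₀ ⁻ ⊙ v₀ ⊙ v₁) v₁ refl)
    y-commutes : winv a ++ y ++ a ≈ y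
    y-commutes = begin
      winv a ++ y ++ a                 ≈⟨ ≈-ctx (winv a) a y≈ ⟩
      winv a ++ A (2 * j) ++ A 1       ≡⟨ cong (winv a ++_) (pow-comm g₁ (2 * j) 1) ⟩
      winv a ++ a ++ A (2 * j)         ≈⟨ group (a ∷ A (2 * j) ∷ []) (v₀ ⁻ ⊙ v₀ ⊙ v₁) v₁ refl ⟩
      A (2 * j)                        ≈⟨ y≈ ⟨
      y                                ∎
    s = a ++ b
    ss : winv (s ++ s) ≈ []
    ss = winv-cong (≈-trans (group (a ∷ b ∷ []) ((v₀ ⊙ v₁) ⊙ (v₀ ⊙ v₁)) (v₀ ⊙ v₁ ⊙ v₀ ⊙ v₁) refl) abab)
    -- Since `y` is a power of `a`, it may be replaced by `a⁻¹ya`. This changes conjugation of `a²`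
    -- by `b²` into conjugation by `bab`, or equally by `abab = 1`.
    b²-conjugate : winv (b ++ b) ++ (a ++ a) ++ (b ++ b) ≈ a ++ a
    b²-conjugate = begin
      winv (b ++ b) ++ (a ++ a) ++ (b ++ b)      ≈⟨ group (a ∷ b ∷ []) ((v₁ ⊙ v₁) ⁻ ⊙ (v₀ ⊙ v₀) ⊙ (v₁ ⊙ v₁)) (v₁ ⁻ ⊙ (v₁ ⁻ ⊙ (v₀ ⊙ v₀) ⊙ v₁) ⊙ v₁) refl ⟩
      winv b ++ y ++ b                           ≈⟨ ≈-ctx (winv b) b y-commutes ⟨
      winv b ++ (winv a ++ y ++ a) ++ b          ≈⟨ group (a ∷ b ∷ []) (v₁ ⁻ ⊙ (v₀ ⁻ ⊙ (v₁ ⁻ ⊙ (v₀ ⊙ v₀) ⊙ v₁) ⊙ v₀) ⊙ v₁) (((v₀ ⊙ v₁) ⊙ (v₀ ⊙ v₁)) ⁻ ⊙ (v₀ ⊙ v₀) ⊙ ((v₀ ⊙ v₁) ⊙ (v₀ ⊙ v₁))) refl ⟩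
      winv (s ++ s) ++ (a ++ a) ++ (s ++ s)      ≈⟨ ++-cong ss (++-congˡ (a ++ a) abab) ⟩
      a ++ a                                     ∎
    b²-commutes : A 2 ++ B 2 ≈ B 2 ++ A 2
    b²-commutes = begin
      A 2 ++ B 2                                  ≈⟨ group (A 2 ∷ B 2 ∷ []) (v₀ ⊙ v₁) (v₁ ⊙ v₁ ⁻ ⊙ v₀ ⊙ v₁) refl ⟩
      B 2 ++ winv (B 2) ++ A 2 ++ B 2             ≈⟨ ++-congˡ (B 2) b²-conjugate ⟩
      B 2 ++ A 2                                  ∎
    bᵐ≈ : B (1 * m) ≈ []
    bᵐ≈ = ≈-trans (≈-reflexive (cong B (*-comm 1 m))) b-order
    bᵐ-commutes : A 2 ++ B (1 * m) ≈ B (1 * m) ++ A 2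
    bᵐ-commutes = ≈-trans (++-congˡ (A 2) bᵐ≈) (++-congʳ (A 2) (≈-sym bᵐ≈))

  instance
    2m≢0 : NonZero (2 * m ^ 1)
    2m≢0 = m*n≢0 2 (m ^ 1) {{_}} {{m^n≢0 m 1}}
    m^1≢0 : NonZero (m ^ 1)
    m^1≢0 = m^n≢0 m 1

  -- The moduli belong to the quotient of type `{2m, m}` in which the exponents are finally read
  -- off. The claim passes back from a quotient because `b⁻¹a = aⁱbʲ` holds there with the same
  -- words, hence the same `i` and `j`.
  Twist : Congruence → Set
  Twist C = ∀ i j → Congruence._≈_ C (winv b ++ a) (A i ++ B j) →
    i % (2 * m ^ 1) ≡ 3 % (2 * m ^ 1) × j % (m ^ 1) ≡ 1 % (m ^ 1)

  -- Quotients by core subgroups lead down to type {2m, m}, where a² is central.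
  twist-exponents : ∀ α γ {C} → TightPair C (2 * m ^ suc α) (m ^ suc γ) → Twist C
  via-b : ∀ α γ {C} → α ≤ γ → TightPair C (2 * m ^ suc α) (m ^ suc (suc γ)) → Twist C
  via-a : ∀ α γ {C} → γ ≤ suc α → TightPair C (2 * m ^ suc (suc α)) (m ^ suc γ) → Twist C

  -- In type `{2m, m}` the subgroup from `a-core` is generated by `A (2 * m ^ 0)`, which is `a²`. So
  -- `a²` commutes with `b`, the twist `z` is empty, and `b⁻¹a = a³b`.
  twist-exponents zero    zero    {C} tight i j e =
    unique i j 3 1 (≈-trans (≈-sym e) (b⁻¹a≈ tight [] (≈-sym (normal⇒commutes tight (a-core 0 1 ≤-refl tight)))))
    where open TightProperties tight
  twist-exponents (suc α) zero    tight = via-a α zero z≤n tight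
  twist-exponents zero    (suc γ) tight = via-b zero γ z≤n tight
  -- The two counts complement each other: if the power of `m` in `q` exceeds the one in `p`, the
  -- core of `⟨b⟩` is available, and otherwise the core of `⟨a⟩`.
  twist-exponents (suc α) (suc γ) tight with suc α ≤? γ
  ... | yes α≤γ = via-b (suc α) γ α≤γ tight
  ... | no  α≰γ = via-a α (suc γ) (≰⇒> α≰γ) tight

  via-b α γ {C} α≤γ tight i j e =
    twist-exponents α γ (tight-/b tight (^-∣ (n≤1+n (suc γ))) (b-core (suc α) (suc γ) (s≤s α≤γ) tight)) i j
      (≈⇒~ C g₂ (m ^ suc γ) e)
  via-a α γ {C} γ≤α tight i j e =
    twist-exponents α γ (tight-/a tight (*-monoʳ-∣ 2 (^-∣ (n≤1+n (suc α)))) (a-core (suc α) (suc γ) (s≤s γ≤α) tight)) i j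
      (≈⇒~ C g₁ (2 * m ^ suc α) e)

  -- Applying `bar` to `b⁻¹a = aⁱbʲ` and inverting gives `ab⁻¹ = bʲaⁱ`. Reading `ab⁻¹a` in both
  -- ways, `bʲaⁱ⁺¹ = aⁱ⁺¹bʲ`. Taking gcds with the two orders reduces the exponents to 2 and 1.
  barInvariant⇒commutes : ∀ α γ {C} → TightPair C (2 * m ^ suc α) (m ^ suc γ) → BarInvariant C → A²-commutes C
  barInvariant⇒commutes α γ {C} tight invariant with TightPair.factor tight (winv b ++ a)
  ... | i , j , e with twist-exponents α γ tight i j e
  ... | i≡3 , j≡1 = closed-coprime (∤⇒coprime-^ m-prime m∤j (suc γ)) A²-commutes-j A²-commutes-q
    where
    open TightProperties tight
    open ≈-Reasoning
    open ExponentGroup (commuting-exponents C g₂ 1 (A 2))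
    e' : a ++ winv b ≈ B j ++ A i
    e' = begin
      a ++ winv b                        ≈⟨ group (a ∷ b ∷ []) (v₀ ⊙ v₁ ⁻) ((v₁ ⊙ v₀ ⁻) ⁻) refl ⟩
      winv (b ++ winv a)                 ≈⟨ winv-cong (invariant _ _ e) ⟩
      winv (bar (A i ++ B j))            ≡⟨ cong winv (trans (map-++ inv (A i) (B j)) (cong₂ _++_ (bar-pow g₁ i) (bar-pow g₂ j))) ⟩
      winv (winv (A i) ++ winv (B j))    ≈⟨ group (A i ∷ B j ∷ []) ((v₀ ⁻ ⊙ v₁ ⁻) ⁻) (v₁ ⊙ v₀) refl ⟩
      B j ++ A i                         ∎
    k = i / (2 * m ^ 1)
    -- From `i = 3 + 2mk`, where 3 is its own residue because `3 < 2m`, one gets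
    -- `i + 1 = 2(2 + mk)`; and `m` does not divide `2 + mk` since it does not divide 2.
    l = 2 + m * k
    suc-i≡ : 1 + i ≡ 2 * l
    suc-i≡ = trans (cong suc (trans (m≡m%n+[m/n]*n i (2 * m ^ 1))
        (cong (_+ k * (2 * m ^ 1)) (trans i≡3 (m<n⇒m%n≡m 3<2m))))) (arith k m)
      where
      3<2m : 3 < 2 * m ^ 1
      3<2m = ≤-trans (s≤s (s≤s (s≤s (s≤s z≤n)))) (*-monoʳ-≤ 2 (subst (3 ≤_) (sym (*-identityʳ m)) m>2))
      arith : ∀ k m → 1 + (3 + k * (2 * (m * 1))) ≡ 2 * (2 + m * k)
      arith = solve-∀
    commutes-l : B j ++ A (2 * l) ≈ A (2 * l) ++ B j
    commutes-l = subst (λ z → B j ++ A z ≈ A z ++ B j) suc-i≡ (begin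
      B j ++ A (1 + i)            ≡⟨ cong (B j ++_) (pow-comm g₁ 1 i) ⟩
      B j ++ A i ++ a             ≡⟨ ++-assoc (B j) _ _ ⟨
      (B j ++ A i) ++ a           ≈⟨ ++-congʳ a e' ⟨
      (a ++ winv b) ++ a          ≈⟨ ++-congˡ a e ⟩
      A (1 + i) ++ B j            ∎)
    m∤l : ¬ (m ∣ l)
    m∤l m∣l = m∤2 (∣m+n∣m⇒∣n (subst (m ∣_) (+-comm 2 (m * k)) m∣l) (m∣m*n k))
    commutes-p : B j ++ A (2 * m ^ suc α) ≈ A (2 * m ^ suc α) ++ B j
    commutes-p = ≈-trans (++-congˡ (B j) a-order) (≈-trans (≈-reflexive (++-identityʳ (B j))) (++-congʳ (B j) (≈-sym a-order)))
    A²-commutes-j : A 2 ++ B (1 * j) ≈ B (1 * j) ++ A 2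
    A²-commutes-j = subst (λ z → A 2 ++ B z ≈ B z ++ A 2) (sym (*-identityˡ j))
      (≈-sym (ExponentGroup.closed-coprime (commuting-exponents C g₁ 2 (B j))
        (∤⇒coprime-^ m-prime m∤l (suc α)) commutes-l commutes-p))
    b-order' : B (1 * m ^ suc γ) ≈ []
    b-order' = ≈-trans (≈-reflexive (cong B (*-identityˡ (m ^ suc γ)))) b-order
    A²-commutes-q : A 2 ++ B (1 * m ^ suc γ) ≈ B (1 * m ^ suc γ) ++ A 2
    A²-commutes-q = ≈-trans (++-congˡ (A 2) b-order') (++-congʳ (A 2) (≈-sym b-order'))
    m∤j : ¬ (m ∣ j)
    m∤j m∣j = contradiction (trans (sym j≡1) (n∣m⇒m%n≡0 j (m ^ 1) (subst (_∣ j) (sym (*-identityʳ m)) m∣j)))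
      (λ eq → contradiction (trans (sym (m<n⇒m%n≡m (subst (1 <_) (sym (*-identityʳ m)) (prime>1 m-prime)))) eq) λ ())

-- Presentations

parity : ∀ i → (∃[ k ] i ≡ k * 2) ⊎ (∃[ k ] i ≡ suc (k * 2))
parity zero = inj₁ (0 , refl)
parity (suc i) with parity i
... | inj₁ (k , refl) = inj₂ (k , refl)
... | inj₂ (k , refl) = inj₁ (suc k , refl)

twist-power : (C : Congruence) → let open Congruence C in ∀ j₁ →
  b ++ A 2 ≈ A 2 ++ B j₁ → ∀ l → B l ++ A 2 ≈ A 2 ++ B (l * j₁)
twist-power C j₁ twist = go
  where
  open CongruenceProperties C
  open ≈-Reasoning
  go : ∀ l → B l ++ A 2 ≈ A 2 ++ B (l * j₁)
  go zero    = ≈-refl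
  go (suc l) = begin
    b ++ B l ++ A 2                ≈⟨ ++-congˡ b (go l) ⟩
    b ++ A 2 ++ B (l * j₁)         ≈⟨ ++-congʳ (B (l * j₁)) twist ⟩
    A 2 ++ B j₁ ++ B (l * j₁)      ≡⟨ cong (A 2 ++_) (pow-+ g₂ j₁ (l * j₁)) ⟨
    A 2 ++ B (j₁ + l * j₁)         ∎

module _ (C : Congruence) {p q : ℕ} {{_ : NonZero p}} {{_ : NonZero q}} (j₁ : ℕ) where
  open CongruenceProperties C
  open ≈-Reasoning

  -- It suffices to move one `b` across `aⁱ`. Even powers of `a` pass every power of `b` by the
  -- twist; for odd `i` the word `ba` is first replaced by `a⁻¹b⁻¹`, which leaves an even power to
  -- cross. Inverse letters are positive powers by the orders.
  relations⇒factor : A p ≈ [] → B q ≈ [] → a ++ b ++ a ++ b ≈ [] → winv b ++ a ≈ A 3 ++ B j₁ →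
    ∀ w → ∃[ i ] ∃[ j ] w ≈ A i ++ B j
  relations⇒factor a-order b-order abab twist = factor
    where
    ba≈ : b ++ a ≈ winv a ++ winv b
    ba≈ = ≈-trans (group (a ∷ b ∷ []) (v₁ ⊙ v₀) (v₀ ⁻ ⊙ (v₀ ⊙ v₁ ⊙ v₀ ⊙ v₁) ⊙ v₁ ⁻) refl) (≈-ctx (winv a) (winv b) abab)

    bA²≈ : b ++ A 2 ≈ A 2 ++ B j₁
    bA²≈ = begin
      b ++ A 2                      ≈⟨ group (a ∷ b ∷ []) (v₁ ⊙ v₀ ⊙ v₀) ((v₁ ⊙ v₀) ⊙ v₀) refl ⟩
      (b ++ a) ++ a                 ≈⟨ ++-congʳ a ba≈ ⟩
      (winv a ++ winv b) ++ a       ≈⟨ ++-congˡ (winv a) twist ⟩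
      winv a ++ A 3 ++ B j₁         ≈⟨ group (a ∷ B j₁ ∷ []) (v₀ ⁻ ⊙ (v₀ ⊙ v₀ ⊙ v₀) ⊙ v₁) ((v₀ ⊙ v₀) ⊙ v₁) refl ⟩
      A 2 ++ B j₁                   ∎

    B-A² = twist-power C j₁ bA²≈

    B-even : ∀ k l → ∃[ l' ] B l ++ A (k * 2) ≈ A (k * 2) ++ B l'
    B-even zero    l = l , ≈-reflexive (++-identityʳ (B l))
    B-even (suc k) l with B-even k (l * j₁)
    ... | l' , e = l' , (begin
      B l ++ A 2 ++ A (k * 2)                   ≡⟨ ++-assoc (B l) (A 2) _ ⟨
      (B l ++ A 2) ++ A (k * 2)                 ≈⟨ ++-congʳ (A (k * 2)) (B-A² l) ⟩
      A 2 ++ B (l * j₁) ++ A (k * 2)            ≈⟨ ++-congˡ (A 2) e ⟩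
      A 2 ++ A (k * 2) ++ B l'                  ∎)

    a⁻¹≈ : winv a ≈ A (1 * (p ∸ 1))
    a⁻¹≈ = winv-pow C g₁ a-order 1

    b⁻¹≈ : winv b ≈ B (1 * (q ∸ 1))
    b⁻¹≈ = winv-pow C g₂ b-order 1

    Factored : Word → Set
    Factored w = ∃[ i ] ∃[ j ] w ≈ A i ++ B j

    Factored-resp : ∀ {u w} → u ≈ w → Factored w → Factored u
    Factored-resp e (i , j , e') = i , j , ≈-trans e e'

    A-Factored : ∀ i {w} → Factored w → Factored (A i ++ w)
    A-Factored i (k , j , e) = i + k , j , ≈-trans (++-congˡ (A i) e)
      (≈-reflexive (trans (sym (++-assoc (A i) _ _)) (cong (_++ B j) (sym (pow-+ g₁ i k)))))

    Factored-B : ∀ j {w} → Factored w → Factored (w ++ B j)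
    Factored-B j (i , k , e) = i , k + j , ≈-trans (++-congʳ (B j) e)
      (≈-reflexive (trans (++-assoc (A i) _ _) (cong (A i ++_) (sym (pow-+ g₂ k j)))))

    b-A : ∀ i → Factored (b ++ A i)
    b-A i with parity i
    ... | inj₁ (k , refl) = k * 2 , B-even k 1
    ... | inj₂ (k , refl) = Factored-resp (begin
        b ++ a ++ A (k * 2)                         ≈⟨ ++-congʳ (A (k * 2)) ba≈ ⟩
        winv a ++ winv b ++ A (k * 2)               ≈⟨ ++-cong a⁻¹≈ (++-congʳ (A (k * 2)) b⁻¹≈) ⟩
        A (1 * (p ∸ 1)) ++ B (1 * (q ∸ 1)) ++ A (k * 2) ∎)
      (A-Factored (1 * (p ∸ 1)) (k * 2 , B-even k (1 * (q ∸ 1))))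

    b-Factored : ∀ {w} → Factored w → Factored (b ++ w)
    b-Factored (i , j , e) = Factored-resp (≈-trans (++-congˡ b e) (≈-reflexive (sym (++-assoc b (A i) (B j)))))
      (Factored-B j (b-A i))

    B-Factored : ∀ n {w} → Factored w → Factored (B n ++ w)
    B-Factored zero    f = f
    B-Factored (suc n) f = b-Factored (B-Factored n f)

    factor : ∀ w → Factored w
    factor []                = 0 , 0 , ≈-refl
    factor ((g₁ , true)  ∷ w) = A-Factored 1 (factor w)
    factor ((g₁ , false) ∷ w) = Factored-resp (++-congʳ w a⁻¹≈) (A-Factored (1 * (p ∸ 1)) (factor w))
    factor ((g₂ , true)  ∷ w) = b-Factored (factor w)
    factor ((g₂ , false) ∷ w) = Factored-resp (++-congʳ w b⁻¹≈) (B-Factored (1 * (q ∸ 1)) (factor w))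

Holds : Congruence → List (Word × Word) → Set
Holds C rels = ∀ {u w} → (u , w) ∈ rels → u ≈ w
  where open Congruence C

-- Both words have normal forms `aⁱbʲ` derivable from the relations. If they agree in `C`, tightness
-- makes the exponents congruent modulo `p` and `q`, and such normal forms are already identified by
-- the relations.
ΓRels-complete : ∀ {C p q} → TightPair C p q → ∀ j₁ i₂ j₂ →
  Holds C (ΓRels p q (+ 3) (+ j₁) i₂ j₂) →
  ∀ u w → Congruence._≈_ C u w → Derivable (ΓRels p q (+ 3) (+ j₁) i₂ j₂) u w
ΓRels-complete {C} {p} {q} tight j₁ i₂ j₂ holds u w u≈w with factor u | factor w
  where
  rels = ΓRels p q (+ 3) (+ j₁) i₂ j₂
  open TightPair tight using (p≢0; q≢0)
  factor = relations⇒factor (derivable rels) {p} {q} j₁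
    (d-rel (here refl)) (d-rel (there (here refl))) (d-rel (there (there (here refl))))
    (d-rel (there (there (there (here refl)))))
... | i , j , e | i' , j' , e' with TightProperties.unique tight i j i' j'
        (≈-trans (≈-sym (derivable-least C holds e)) (≈-trans u≈w (derivable-least C holds e')))
  where open Congruence C
... | i≡i' , j≡j' = d-trans e (d-trans (D.++-cong
        (pow-≡% D g₁ (d-rel (here refl)) i i' i≡i') (pow-≡% D g₂ (d-rel (there (here refl))) j j' j≡j')) (d-sym e'))
  where
  open TightPair tight using (p≢0; q≢0)
  D = derivable (ΓRels p q (+ 3) (+ j₁) i₂ j₂)
  module D = CongruenceProperties D

-- The pullback of `C` along `bar`. Bar-invariance says that `C` is contained in it, which for a
-- presented group needs to be checked on the relators only.
barred : Congruence → Congruence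
barred C = record
  { _≈_ = λ u w → bar u ≈ bar w
  ; ≈-refl = ≈-refl ; ≈-sym = ≈-sym ; ≈-trans = ≈-trans
  ; ≈-cancel = λ x → ≈-cancel (inv x)
  ; ≈-ctx = λ s t {u} {w} e → subst₂ _≈_ (sym (bar-++ s u t)) (sym (bar-++ s w t)) (≈-ctx (bar s) (bar t) e) }
  where
  open Congruence C
  bar-++ : ∀ s u t → bar (s ++ u ++ t) ≡ bar s ++ bar u ++ bar t
  bar-++ s u t = trans (map-++ inv s (u ++ t)) (cong (bar s ++_) (map-++ inv u t))

-- With an empty twist the group has the presentation with exponents 3, 1, -3, -1. There `bar`
-- interchanges the two long relations and sends the other three to consequences of themselves.
commutes⇒barInvariant : ∀ {C p q} → TightPair C p q → A²-commutes C → BarInvariant C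
commutes⇒barInvariant {C} {p} {q} tight comm u w u≈w =
  derivable-least (barred C) barred-holds (ΓRels-complete tight 1 -[1+ 2 ] -[1+ 0 ] holds u w u≈w)
  where
  open TightProperties tight
  twist : b ++ A 2 ≈ A 2 ++ b ++ []
  twist = ≈-sym comm
  holds : Holds C (ΓRels p q (+ 3) (+ 1) -[1+ 2 ] -[1+ 0 ])
  holds (here refl) = a-order
  holds (there (here refl)) = b-order
  holds (there (there (here refl))) = abab
  holds (there (there (there (here refl)))) = b⁻¹a≈ tight [] twist
  holds (there (there (there (there (here refl))))) = ba⁻¹≈ tight [] twist ≈-refl ≈-refl
  barred-holds : Holds (barred C) (ΓRels p q (+ 3) (+ 1) -[1+ 2 ] -[1+ 0 ])
  barred-holds (here refl) = subst (_≈ []) (sym (bar-pow g₁ p)) (winv-cong a-order)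
  barred-holds (there (here refl)) = subst (_≈ []) (sym (bar-pow g₂ q)) (winv-cong b-order)
  barred-holds (there (there (here refl))) = winv-cong baba
  barred-holds (there (there (there (here refl)))) = ba⁻¹≈ tight [] twist ≈-refl ≈-refl
  barred-holds (there (there (there (there (here refl))))) = b⁻¹a≈ tight [] twist

-- Flags and automorphisms

other : ∀ {A P} → ExactlyTwo A P → ∀ x → P x →
  Σ A λ y → x ≢ y × P y × (∀ c → P c → c ≡ x ⊎ c ≡ y)
other (a , b , a≢b , Pa , Pb , only) x Px with only x Px
... | inj₁ refl = b , a≢b , Pb , only
... | inj₂ refl = a , (λ e → a≢b (sym e)) , Pa , λ c Pc → swap (only c Pc)
  where
  swap : ∀ {X Y : Set} → X ⊎ Y → Y ⊎ X
  swap (inj₁ x) = inj₂ x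
  swap (inj₂ y) = inj₁ y

module Flags (P : Polyhedron) where
  open Polyhedron P
  open Flag
  open Aut

  flag-≡ : {Φ Ψ : Flag P} → fv Φ ≡ fv Ψ → fe Φ ≡ fe Ψ → ff Φ ≡ ff Ψ → Φ ≡ Ψ
  flag-≡ {flag v e f x y} {flag _ _ _ x' y'} refl refl refl =
    cong₂ (flag v e f) (T-irrelevant x x') (T-irrelevant y y')

  fvf : (Φ : Flag P) → T (vf (fv Φ) (ff Φ))
  fvf Φ = ve-ef-trans _ _ _ (fve Φ) (fef Φ)

  private
    other-v : (Φ : Flag P) → _
    other-v Φ = other (edge-vertices (fe Φ)) (fv Φ) (fve Φ)
    other-e : (Φ : Flag P) → _
    other-e Φ = other (diamond (fv Φ) (ff Φ) (fvf Φ)) (fe Φ) (fve Φ , fef Φ)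
    other-f : (Φ : Flag P) → _
    other-f Φ = other (edge-faces (fe Φ)) (ff Φ) (fef Φ)

  r₀ r₁ r₂ : Flag P → Flag P
  r₀ Φ = flag (proj₁ (other-v Φ)) (fe Φ) (ff Φ) (proj₁ (proj₂ (proj₂ (other-v Φ)))) (fef Φ)
  r₁ Φ = flag (fv Φ) (proj₁ (other-e Φ)) (ff Φ) (proj₁ (proj₁ (proj₂ (proj₂ (other-e Φ))))) (proj₂ (proj₁ (proj₂ (proj₂ (other-e Φ)))))
  r₂ Φ = flag (fv Φ) (fe Φ) (proj₁ (other-f Φ)) (fve Φ) (proj₁ (proj₂ (proj₂ (other-f Φ))))

  adj₀ : ∀ Φ → Adj₀ P Φ (r₀ Φ)
  adj₀ Φ = proj₁ (proj₂ (other-v Φ)) , refl , refl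
  adj₁ : ∀ Φ → Adj₁ P Φ (r₁ Φ)
  adj₁ Φ = refl , proj₁ (proj₂ (other-e Φ)) , refl
  adj₂ : ∀ Φ → Adj₂ P Φ (r₂ Φ)
  adj₂ Φ = refl , refl , proj₁ (proj₂ (other-f Φ))

  same-ef : ∀ Φ Ψ → fe Φ ≡ fe Ψ → ff Φ ≡ ff Ψ → Ψ ≡ Φ ⊎ Ψ ≡ r₀ Φ
  same-ef Φ (flag v _ _ ve' _) refl refl with proj₂ (proj₂ (proj₂ (other-v Φ))) v ve'
  ... | inj₁ e = inj₁ (flag-≡ e refl refl)
  ... | inj₂ e = inj₂ (flag-≡ e refl refl)

  same-vf : ∀ Φ Ψ → fv Φ ≡ fv Ψ → ff Φ ≡ ff Ψ → Ψ ≡ Φ ⊎ Ψ ≡ r₁ Φ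
  same-vf Φ (flag _ e _ ve' ef') refl refl with proj₂ (proj₂ (proj₂ (other-e Φ))) e (ve' , ef')
  ... | inj₁ e = inj₁ (flag-≡ refl e refl)
  ... | inj₂ e = inj₂ (flag-≡ refl e refl)

  same-ve : ∀ Φ Ψ → fv Φ ≡ fv Ψ → fe Φ ≡ fe Ψ → Ψ ≡ Φ ⊎ Ψ ≡ r₂ Φ
  same-ve Φ (flag _ _ f _ ef') refl refl with proj₂ (proj₂ (proj₂ (other-f Φ))) f ef'
  ... | inj₁ e = inj₁ (flag-≡ refl refl e)
  ... | inj₂ e = inj₂ (flag-≡ refl refl e)

  unique₀ : ∀ Φ Ψ → Adj₀ P Φ Ψ → Ψ ≡ r₀ Φ
  unique₀ Φ Ψ (v≢ , e , f) with same-ef Φ Ψ e f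
  ... | inj₁ refl = contradiction refl v≢
  ... | inj₂ eq = eq

  unique₁ : ∀ Φ Ψ → Adj₁ P Φ Ψ → Ψ ≡ r₁ Φ
  unique₁ Φ Ψ (v , e≢ , f) with same-vf Φ Ψ v f
  ... | inj₁ refl = contradiction refl e≢
  ... | inj₂ eq = eq

  unique₂ : ∀ Φ Ψ → Adj₂ P Φ Ψ → Ψ ≡ r₂ Φ
  unique₂ Φ Ψ (v , e , f≢) with same-ve Φ Ψ v e
  ... | inj₁ refl = contradiction refl f≢
  ... | inj₂ eq = eq

  r₀-involutive : ∀ Φ → r₀ (r₀ Φ) ≡ Φ
  r₀-involutive Φ = sym (unique₀ (r₀ Φ) Φ (≢-sym (proj₁ (adj₀ Φ)) , refl , refl))
  r₁-involutive : ∀ Φ → r₁ (r₁ Φ) ≡ Φ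
  r₁-involutive Φ = sym (unique₁ (r₁ Φ) Φ (refl , ≢-sym (proj₁ (proj₂ (adj₁ Φ))) , refl))
  r₂-involutive : ∀ Φ → r₂ (r₂ Φ) ≡ Φ
  r₂-involutive Φ = sym (unique₂ (r₂ Φ) Φ (refl , refl , ≢-sym (proj₂ (proj₂ (adj₂ Φ)))))

  act-r₀ : ∀ γ Φ → act P γ (r₀ Φ) ≡ r₀ (act P γ Φ)
  act-r₀ γ Φ = unique₀ (act P γ Φ) (act P γ (r₀ Φ))
    ((λ e → proj₁ (adj₀ Φ) (trans (sym (gfV γ _)) (trans (cong (gV γ) e) (gfV γ _)))) , refl , refl)
  act-r₁ : ∀ γ Φ → act P γ (r₁ Φ) ≡ r₁ (act P γ Φ)
  act-r₁ γ Φ = unique₁ (act P γ Φ) (act P γ (r₁ Φ))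
    (refl , (λ e → proj₁ (proj₂ (adj₁ Φ)) (trans (sym (gfE γ _)) (trans (cong (gE γ) e) (gfE γ _)))) , refl)
  act-r₂ : ∀ γ Φ → act P γ (r₂ Φ) ≡ r₂ (act P γ Φ)
  act-r₂ γ Φ = unique₂ (act P γ Φ) (act P γ (r₂ Φ))
    (refl , refl , λ e → proj₂ (proj₂ (adj₂ Φ)) (trans (sym (gfF γ _)) (trans (cong (gF γ) e) (gfF γ _))))

  Closed : (Flag P → Flag P) → (Flag P → Set) → Set
  Closed r S = ∀ Φ → S Φ → S (r Φ)

  module _ (S : Flag P → Set) where

    closed-ef : Closed r₀ S → ∀ Φ Ψ → fe Φ ≡ fe Ψ → ff Φ ≡ ff Ψ → S Φ → S Ψ
    closed-ef cl Φ Ψ e f s with same-ef Φ Ψ e f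
    ... | inj₁ refl = s
    ... | inj₂ refl = cl Φ s

    closed-vf : Closed r₁ S → ∀ Φ Ψ → fv Φ ≡ fv Ψ → ff Φ ≡ ff Ψ → S Φ → S Ψ
    closed-vf cl Φ Ψ v f s with same-vf Φ Ψ v f
    ... | inj₁ refl = s
    ... | inj₂ refl = cl Φ s

    closed-ve : Closed r₂ S → ∀ Φ Ψ → fv Φ ≡ fv Ψ → fe Φ ≡ fe Ψ → S Φ → S Ψ
    closed-ve cl Φ Ψ v e s with same-ve Φ Ψ v e
    ... | inj₁ refl = s
    ... | inj₂ refl = cl Φ s

    -- Connectedness of the neighbours of `v` enters here. Along a path the invariant is that every
    -- flag through `v` and the current element lies in `S`; a step between an edge and a face fixes
    -- two entries of a flag, so the third varies by `r₁` or `r₂`.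
    vertex-induction : Closed r₁ S → Closed r₂ S → ∀ Φ Ψ → fv Φ ≡ fv Ψ → S Φ → S Ψ
    vertex-induction cl₁ cl₂ Φ Ψ refl s = walk (start Φ refl) (start Ψ refl)
        (vertex-nbr-connected v (start Φ refl) (start Ψ refl)) (λ f h → closed-ve cl₂ Φ _ refl refl s) (ff Ψ) (fef Ψ)
      where
      v = fv Φ
      start : (Θ : Flag P) → fv Θ ≡ v → Nbr ve ef vf (inj₁ v)
      start Θ refl = inj₂ (inj₁ (fe Θ)) , fve Θ
      Good : Nbr ve ef vf (inj₁ v) → Set
      Good (inj₂ (inj₁ e) , x) = ∀ f (h : T (ef e f)) → S (flag v e f x h)
      Good (inj₂ (inj₂ f) , _) = ∀ e (x : T (ve v e)) (h : T (ef e f)) → S (flag v e f x h)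
      walk : ∀ c d → Star (λ c d → Inc ve ef vf (proj₁ c) (proj₁ d)) c d → Good c → Good d
      step : ∀ c d → Inc ve ef vf (proj₁ c) (proj₁ d) → Good c → Good d
      walk c d ε good = good
      walk c d (_◅_ {j = j} i path) good = walk j d path (step c j i good)
      step (inj₂ (inj₁ e) , x) (inj₂ (inj₂ f) , y) h good =
        λ e' x' h' → closed-vf cl₁ (flag v e f x h) _ refl refl (good f h)
      step (inj₂ (inj₂ f) , y) (inj₂ (inj₁ e) , x) h good =
        λ f' h' → closed-ve cl₂ (flag v e f x h) _ refl refl (good e x h)

    face-induction : Closed r₀ S → Closed r₁ S → ∀ Φ Ψ → ff Φ ≡ ff Ψ → S Φ → S Ψ
    face-induction cl₀ cl₁ Φ Ψ refl s = walk (start Φ refl) (start Ψ refl)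
        (face-nbr-connected f (start Φ refl) (start Ψ refl)) (λ v h → closed-ef cl₀ Φ _ refl refl s) (fv Ψ) (fve Ψ)
      where
      f = ff Φ
      start : (Θ : Flag P) → ff Θ ≡ f → Nbr ve ef vf (inj₂ (inj₂ f))
      start Θ refl = inj₂ (inj₁ (fe Θ)) , fef Θ
      Good : Nbr ve ef vf (inj₂ (inj₂ f)) → Set
      Good (inj₂ (inj₁ e) , x) = ∀ v (h : T (ve v e)) → S (flag v e f h x)
      Good (inj₁ v , _) = ∀ e (h : T (ve v e)) (x : T (ef e f)) → S (flag v e f h x)
      walk : ∀ c d → Star (λ c d → Inc ve ef vf (proj₁ c) (proj₁ d)) c d → Good c → Good d
      step : ∀ c d → Inc ve ef vf (proj₁ c) (proj₁ d) → Good c → Good d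
      walk c d ε good = good
      walk c d (_◅_ {j = j} i path) good = walk j d path (step c j i good)
      step (inj₂ (inj₁ e) , x) (inj₁ v , y) h good =
        λ e' x' h' → closed-vf cl₁ (flag v e f h x) _ refl refl (good v h)
      step (inj₂ (inj₁ _) , _) (inj₂ (inj₁ _) , _) ()
      step (inj₁ v , y) (inj₂ (inj₁ e) , x) h good =
        λ v' h' → closed-ef cl₀ (flag v e f h x) _ refl refl (good e h x)

    edge-induction : Closed r₀ S → Closed r₂ S → ∀ Φ Ψ → fe Φ ≡ fe Ψ → S Φ → S Ψ
    edge-induction cl₀ cl₂ Φ Ψ refl s =
      closed-ve cl₂ (flag (fv Ψ) (fe Φ) (ff Φ) (fve Ψ) (fef Φ)) Ψ refl refl
        (closed-ef cl₀ Φ _ refl refl s)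

  On : Elt V E F → Flag P → Set
  On (inj₁ v)        Φ = fv Φ ≡ v
  On (inj₂ (inj₁ e)) Φ = fe Φ ≡ e
  On (inj₂ (inj₂ f)) Φ = ff Φ ≡ f

  incident⇒flag : ∀ x y → Inc ve ef vf x y → Σ (Flag P) λ Φ → On x Φ × On y Φ
  incident⇒flag (inj₁ v) (inj₂ (inj₁ e)) h =
    let f , _ , _ , h' , _ = edge-faces e in flag v e f h h' , refl , refl
  incident⇒flag (inj₁ v) (inj₂ (inj₂ f)) h =
    let e , _ , _ , (h' , h'') , _ = diamond v f h in flag v e f h' h'' , refl , refl
  incident⇒flag (inj₂ (inj₁ e)) (inj₂ (inj₂ f)) h =
    let v , _ , _ , h' , _ = edge-vertices e in flag v e f h' h , refl , refl
  incident⇒flag (inj₂ (inj₁ e)) (inj₁ v) h =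
    let f , _ , _ , h' , _ = edge-faces e in flag v e f h h' , refl , refl
  incident⇒flag (inj₂ (inj₂ f)) (inj₁ v) h =
    let e , _ , _ , (h' , h'') , _ = diamond v f h in flag v e f h' h'' , refl , refl
  incident⇒flag (inj₂ (inj₂ f)) (inj₂ (inj₁ e)) h =
    let v , _ , _ , h' , _ = edge-vertices e in flag v e f h' h , refl , refl

  flag-on : Flag P → ∀ x → Σ (Flag P) (On x)
  flag-on Φ x = walk (inj₁ (fv Φ)) x (connected _ x) (Φ , refl)
    where
    walk : ∀ x y → Star (Inc ve ef vf) x y → Σ (Flag P) (On x) → Σ (Flag P) (On y)
    walk x y ε on = on
    walk x y (_◅_ {j = z} i path) on with incident⇒flag x z i
    ... | Ψ , _ , onz = walk z y path (Ψ , onz)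

  -- Consecutive elements of a path in the incidence graph lie in a common flag, and at that flag
  -- the local induction around one element hands over to that around the next.
  flag-induction : (S : Flag P → Set) → Closed r₀ S → Closed r₁ S → Closed r₂ S → ∀ Φ → S Φ → ∀ Ψ → S Ψ
  flag-induction S cl₀ cl₁ cl₂ Φ s Ψ =
    walk (inj₁ (fv Φ)) (inj₁ (fv Ψ)) (connected _ _)
      (λ Θ on → local (inj₁ (fv Φ)) Φ Θ refl on s) Ψ refl
    where
    local : ∀ x Φ Ψ → On x Φ → On x Ψ → S Φ → S Ψ
    local (inj₁ v)        Φ Ψ e e' = vertex-induction S cl₁ cl₂ Φ Ψ (trans e (sym e'))
    local (inj₂ (inj₁ x)) Φ Ψ e e' = edge-induction S cl₀ cl₂ Φ Ψ (trans e (sym e'))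
    local (inj₂ (inj₂ f)) Φ Ψ e e' = face-induction S cl₀ cl₁ Φ Ψ (trans e (sym e'))
    walk : ∀ x y → Star (Inc ve ef vf) x y → (∀ Θ → On x Θ → S Θ) → ∀ Θ → On y Θ → S Θ
    walk x y ε good = good
    walk x y (_◅_ {j = z} i path) good with incident⇒flag x z i
    ... | Ψ , onx , onz = walk z y path λ Θ on → local z Ψ Θ onz on (good Ψ onx)

  invert : Aut P → Aut P
  invert γ = record
    { fV = gV γ ; gV = fV γ ; fE = gE γ ; gE = fE γ ; fF = gF γ ; gF = fF γ
    ; fgV = gfV γ ; gfV = fgV γ ; fgE = gfE γ ; gfE = fgE γ ; fgF = gfF γ ; gfF = fgF γ
    ; pres-ve = λ v e → trans (sym (pres-ve γ _ _)) (cong₂ ve (fgV γ v) (fgE γ e))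
    ; pres-ef = λ e f → trans (sym (pres-ef γ _ _)) (cong₂ ef (fgE γ e) (fgF γ f))
    ; pres-vf = λ v f → trans (sym (pres-vf γ _ _)) (cong₂ vf (fgV γ v) (fgF γ f)) }

  compose : Aut P → Aut P → Aut P
  compose γ δ = record
    { fV = λ x → fV γ (fV δ x) ; gV = λ x → gV δ (gV γ x)
    ; fE = λ x → fE γ (fE δ x) ; gE = λ x → gE δ (gE γ x)
    ; fF = λ x → fF γ (fF δ x) ; gF = λ x → gF δ (gF γ x)
    ; fgV = λ x → trans (cong (fV γ) (fgV δ _)) (fgV γ x) ; gfV = λ x → trans (cong (gV δ) (gfV γ _)) (gfV δ x)
    ; fgE = λ x → trans (cong (fE γ) (fgE δ _)) (fgE γ x) ; gfE = λ x → trans (cong (gE δ) (gfE γ _)) (gfE δ x)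
    ; fgF = λ x → trans (cong (fF γ) (fgF δ _)) (fgF γ x) ; gfF = λ x → trans (cong (gF δ) (gfF γ _)) (gfF δ x)
    ; pres-ve = λ v e → trans (pres-ve γ _ _) (pres-ve δ v e)
    ; pres-ef = λ e f → trans (pres-ef γ _ _) (pres-ef δ e f)
    ; pres-vf = λ v f → trans (pres-vf γ _ _) (pres-vf δ v f) }

  act-invertʳ : ∀ γ Ψ → act P γ (act P (invert γ) Ψ) ≡ Ψ
  act-invertʳ γ Ψ = flag-≡ (fgV γ _) (fgE γ _) (fgF γ _)

  act-invertˡ : ∀ γ Ψ → act P (invert γ) (act P γ Ψ) ≡ Ψ
  act-invertˡ γ Ψ = flag-≡ (gfV γ _) (gfE γ _) (gfF γ _)

  act-injective : ∀ γ {Φ Ψ} → act P γ Φ ≡ act P γ Ψ → Φ ≡ Ψ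
  act-injective γ {Φ} {Ψ} e = trans (sym (act-invertˡ γ Φ)) (trans (cong (act P (invert γ)) e) (act-invertˡ γ Ψ))

-- The action of words on flags, and the rotation group as a congruence

module WordAction (P : Polyhedron) {Φ : Flag P} (R : Rotations P Φ) where
  open Polyhedron P
  open Flag
  open Aut
  open Flags P public
  open Rotations R

  σ₁Φ : act P σ₁ Φ ≡ r₀ (r₁ Φ)
  σ₁Φ with σ₁-spec
  ... | Φ' , adj , adj' = trans (unique₀ Φ' _ adj') (cong r₀ (unique₁ Φ Φ' adj))

  σ₂Φ : act P σ₂ Φ ≡ r₁ (r₂ Φ)
  σ₂Φ with σ₂-spec
  ... | Φ' , adj , adj' = trans (unique₁ Φ' _ adj') (cong r₁ (unique₂ Φ Φ' adj))

  letter : Letter → Aut P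
  letter (g , true)  = gen P R g
  letter (g , false) = invert (gen P R g)

  infixr 6 _·_
  _·_ : Word → Flag P → Flag P
  []      · Ψ = Ψ
  (x ∷ w) · Ψ = act P (letter x) (w · Ψ)

  ·-fv : ∀ w Ψ → fv (w · Ψ) ≡ evV P R w (fv Ψ)
  ·-fv []                Ψ = refl
  ·-fv ((g , true)  ∷ w) Ψ = cong (fV (gen P R g)) (·-fv w Ψ)
  ·-fv ((g , false) ∷ w) Ψ = cong (gV (gen P R g)) (·-fv w Ψ)

  ·-fe : ∀ w Ψ → fe (w · Ψ) ≡ evE P R w (fe Ψ)
  ·-fe []                Ψ = refl
  ·-fe ((g , true)  ∷ w) Ψ = cong (fE (gen P R g)) (·-fe w Ψ)
  ·-fe ((g , false) ∷ w) Ψ = cong (gE (gen P R g)) (·-fe w Ψ)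

  ·-ff : ∀ w Ψ → ff (w · Ψ) ≡ evF P R w (ff Ψ)
  ·-ff []                Ψ = refl
  ·-ff ((g , true)  ∷ w) Ψ = cong (fF (gen P R g)) (·-ff w Ψ)
  ·-ff ((g , false) ∷ w) Ψ = cong (gF (gen P R g)) (·-ff w Ψ)

  ·-++ : ∀ u w Ψ → (u ++ w) · Ψ ≡ u · w · Ψ
  ·-++ []      w Ψ = refl
  ·-++ (x ∷ u) w Ψ = cong (act P (letter x)) (·-++ u w Ψ)

  ·-cancel : ∀ x Ψ → (x ∷ inv x ∷ []) · Ψ ≡ Ψ
  ·-cancel (g , true)  = act-invertʳ (gen P R g)
  ·-cancel (g , false) = act-invertˡ (gen P R g)

  ·-r₀ : ∀ w Ψ → w · r₀ Ψ ≡ r₀ (w · Ψ)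
  ·-r₀ []      Ψ = refl
  ·-r₀ (x ∷ w) Ψ = trans (cong (act P (letter x)) (·-r₀ w Ψ)) (act-r₀ (letter x) (w · Ψ))
  ·-r₁ : ∀ w Ψ → w · r₁ Ψ ≡ r₁ (w · Ψ)
  ·-r₁ []      Ψ = refl
  ·-r₁ (x ∷ w) Ψ = trans (cong (act P (letter x)) (·-r₁ w Ψ)) (act-r₁ (letter x) (w · Ψ))
  ·-r₂ : ∀ w Ψ → w · r₂ Ψ ≡ r₂ (w · Ψ)
  ·-r₂ []      Ψ = refl
  ·-r₂ (x ∷ w) Ψ = trans (cong (act P (letter x)) (·-r₂ w Ψ)) (act-r₂ (letter x) (w · Ψ))

  -- This is the freeness of automorphisms on flags, stated for all maps commuting with the `rᵢ` so
  -- that it applies to words and to products of automorphisms alike.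
  determined-by-flag : ∀ (φ ψ : Flag P → Flag P) → (∀ Ψ → φ (r₀ Ψ) ≡ r₀ (φ Ψ)) → (∀ Ψ → φ (r₁ Ψ) ≡ r₁ (φ Ψ)) →
    (∀ Ψ → φ (r₂ Ψ) ≡ r₂ (φ Ψ)) → (∀ Ψ → ψ (r₀ Ψ) ≡ r₀ (ψ Ψ)) → (∀ Ψ → ψ (r₁ Ψ) ≡ r₁ (ψ Ψ)) →
    (∀ Ψ → ψ (r₂ Ψ) ≡ r₂ (ψ Ψ)) → ∀ Ψ → φ Ψ ≡ ψ Ψ → ∀ Θ → φ Θ ≡ ψ Θ
  determined-by-flag φ ψ φ₀ φ₁ φ₂ ψ₀ ψ₁ ψ₂ = flag-induction (λ Ψ → φ Ψ ≡ ψ Ψ)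
    (λ Ψ e → trans (φ₀ Ψ) (trans (cong r₀ e) (sym (ψ₀ Ψ))))
    (λ Ψ e → trans (φ₁ Ψ) (trans (cong r₁ e) (sym (ψ₁ Ψ))))
    (λ Ψ e → trans (φ₂ Ψ) (trans (cong r₂ e) (sym (ψ₂ Ψ))))

  -- SameIn as a record, so that the words can be inferred from the type.
  infix 4 _≋_
  record _≋_ (u w : Word) : Set where
    constructor same
    field sameIn : SameIn P R u w

  ≋⇒ : ∀ {u w} → u ≋ w → ∀ Ψ → u · Ψ ≡ w · Ψ
  ≋⇒ {u} {w} (same (sv , se , sf)) Ψ = flag-≡
    (trans (·-fv u Ψ) (trans (sv _) (sym (·-fv w Ψ))))
    (trans (·-fe u Ψ) (trans (se _) (sym (·-fe w Ψ))))
    (trans (·-ff u Ψ) (trans (sf _) (sym (·-ff w Ψ))))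

  -- Agreement at one flag spreads to all flags, and every vertex, edge and face lies on some flag.
  ≋⇐ : ∀ {u w} Ψ → u · Ψ ≡ w · Ψ → u ≋ w
  ≋⇐ {u} {w} Ψ e = same (
      (λ v → onV v (flag-on Φ (inj₁ v))) , (λ x → onE x (flag-on Φ (inj₂ (inj₁ x)))) , (λ f → onF f (flag-on Φ (inj₂ (inj₂ f)))))
    where
    all : ∀ Θ → u · Θ ≡ w · Θ
    all = determined-by-flag (u ·_) (w ·_) (·-r₀ u) (·-r₁ u) (·-r₂ u) (·-r₀ w) (·-r₁ w) (·-r₂ w) Ψ e
    onV : ∀ v → Σ (Flag P) (On (inj₁ v)) → evV P R u v ≡ evV P R w v
    onV v (Θ , refl) = trans (sym (·-fv u Θ)) (trans (cong fv (all Θ)) (·-fv w Θ))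
    onE : ∀ x → Σ (Flag P) (On (inj₂ (inj₁ x))) → evE P R u x ≡ evE P R w x
    onE x (Θ , refl) = trans (sym (·-fe u Θ)) (trans (cong fe (all Θ)) (·-fe w Θ))
    onF : ∀ f → Σ (Flag P) (On (inj₂ (inj₂ f))) → evF P R u f ≡ evF P R w f
    onF f (Θ , refl) = trans (sym (·-ff u Θ)) (trans (cong ff (all Θ)) (·-ff w Θ))

  rotationCongruence : Congruence
  rotationCongruence = record
    { _≈_ = _≋_
    ; ≈-refl = ≋⇐ Φ refl
    ; ≈-sym = λ e → ≋⇐ Φ (sym (≋⇒ e Φ))
    ; ≈-trans = λ e e' → ≋⇐ Φ (trans (≋⇒ e Φ) (≋⇒ e' Φ))
    ; ≈-cancel = λ x → ≋⇐ {x ∷ inv x ∷ []} {[]} Φ (·-cancel x Φ)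
    ; ≈-ctx = λ s t {u} {w} e → ≋⇐ {s ++ u ++ t} {s ++ w ++ t} Φ
        (trans (split s u t) (trans (cong (s ·_) (≋⇒ e (t · Φ))) (sym (split s w t)))) }
    where
    split : ∀ s u t → (s ++ u ++ t) · Φ ≡ s · u · t · Φ
    split s u t = trans (·-++ s (u ++ t) Φ) (cong (s ·_) (·-++ u t Φ))

  σ₁r₀Φ : act P σ₁ (r₀ Φ) ≡ r₁ Φ
  σ₁r₀Φ = trans (act-r₀ σ₁ Φ) (trans (cong r₀ σ₁Φ) (r₀-involutive (r₁ Φ)))

  σ₂r₁Φ : act P σ₂ (r₁ Φ) ≡ r₂ Φ
  σ₂r₁Φ = trans (act-r₁ σ₂ Φ) (trans (cong r₁ σ₂Φ) (r₁-involutive (r₂ Φ)))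

  -- A reflection Φ ↦ Φ¹ conjugates each generator to its inverse.
  reflection⇒barInvariant : (γ : Aut P) → act P γ Φ ≡ r₁ Φ → BarInvariant rotationCongruence
  reflection⇒barInvariant γ γΦ u w e = ≋⇐ {bar u} {bar w} (act P γ Φ)
    (trans (sym (conj u Φ)) (trans (cong (act P γ) (≋⇒ e Φ)) (conj w Φ)))
    where
    conj-gen : ∀ g Ψ → act P γ (act P (gen P R g) Ψ) ≡ act P (invert (gen P R g)) (act P γ Ψ)
    conj-gen g = determined-by-flag (λ Ψ → act P γ (act P (gen P R g) Ψ)) (λ Ψ → act P (invert (gen P R g)) (act P γ Ψ))
      (λ Ψ → trans (cong (act P γ) (act-r₀ (gen P R g) Ψ)) (act-r₀ γ _))
      (λ Ψ → trans (cong (act P γ) (act-r₁ (gen P R g) Ψ)) (act-r₁ γ _))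
      (λ Ψ → trans (cong (act P γ) (act-r₂ (gen P R g) Ψ)) (act-r₂ γ _))
      (λ Ψ → trans (cong (act P (invert (gen P R g))) (act-r₀ γ Ψ)) (act-r₀ (invert (gen P R g)) _))
      (λ Ψ → trans (cong (act P (invert (gen P R g))) (act-r₁ γ Ψ)) (act-r₁ (invert (gen P R g)) _))
      (λ Ψ → trans (cong (act P (invert (gen P R g))) (act-r₂ γ Ψ)) (act-r₂ (invert (gen P R g)) _))
      Φ (act-injective (gen P R g) (trans (base g) (sym (act-invertʳ (gen P R g) (act P γ Φ)))))
      where
      -- The identity `γσ = σ⁻¹γ` is tested at `Φ` in the form `σγσΦ = γΦ`, where `σΦ` is a product
      -- of two `rᵢ` that commute with `γ`.
      base : ∀ g → act P (gen P R g) (act P γ (act P (gen P R g) Φ)) ≡ act P γ Φ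
      base g₁ = trans (cong (act P σ₁) (trans (cong (act P γ) σ₁Φ) (trans (act-r₀ γ _) (cong r₀ (trans (act-r₁ γ Φ) (trans (cong r₁ γΦ) (r₁-involutive Φ)))))))
        (trans σ₁r₀Φ (sym γΦ))
      base g₂ = trans (cong (act P σ₂) (trans (cong (act P γ) σ₂Φ) (trans (act-r₁ γ _) (cong r₁ (trans (act-r₂ γ Φ) (cong r₂ γΦ))))))
        (trans (act-r₁ σ₂ _) (trans (cong r₁ (trans (act-r₂ σ₂ _) (trans (cong r₂ σ₂r₁Φ) (r₂-involutive Φ)))) (sym γΦ)))
    conj-letter : ∀ x Ψ → act P γ (act P (letter x) Ψ) ≡ act P (letter (inv x)) (act P γ Ψ)
    conj-letter (g , true)  Ψ = conj-gen g Ψ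
    conj-letter (g , false) Ψ = trans (sym (act-invertʳ (gen P R g) _))
      (cong (act P (gen P R g)) (trans (sym (conj-gen g _)) (cong (act P γ) (act-invertʳ (gen P R g) Ψ))))
    conj : ∀ u Ψ → act P γ (u · Ψ) ≡ bar u · act P γ Ψ
    conj []      Ψ = refl
    conj (x ∷ u) Ψ = trans (conj-letter x (u · Ψ)) (cong (act P (letter (inv x))) (conj u Ψ))

-- Rotation groups of chiral polyhedra

injective⇒surjective : ∀ {n} (f : Fin n → Fin n) → (∀ i j → f i ≡ f j → i ≡ j) → ∀ y → ∃[ x ] f x ≡ y
injective⇒surjective {n} f inj y with Fin.any? (λ x → f x Fin.≟ y)
... | yes found = found
... | no ¬found = contradiction (Fin.injective⇒≤ {f = g} g-inj) 1+n≰n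
  where
  g : Fin (suc n) → Fin n
  g zero    = y
  g (suc i) = f i
  g-inj : ∀ {i j} → g i ≡ g j → i ≡ j
  g-inj {zero}  {zero}  _ = refl
  g-inj {zero}  {suc j} e = contradiction (j , sym e) ¬found
  g-inj {suc i} {zero}  e = contradiction (i , e) ¬found
  g-inj {suc i} {suc j} e = cong suc (inj i j e)

surjective⇒≤ : ∀ {d n} (f : Fin d → Fin n) → (∀ y → ∃[ x ] f x ≡ y) → n ≤ d
surjective⇒≤ f surj = Fin.injective⇒≤ {f = λ y → proj₁ (surj y)}
  λ {y} {y'} e → trans (sym (proj₂ (surj y))) (trans (cong f e) (proj₂ (surj y')))

remQuot-injective : ∀ {m} k (x y : Fin (m * k)) → remQuot {m} k x ≡ remQuot {m} k y → x ≡ y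
remQuot-injective {m} k x y eq = trans (sym (Fin.combine-remQuot {m} k x))
  (trans (cong (λ z → combine (proj₁ z) (proj₂ z)) eq) (Fin.combine-remQuot {m} k y))

abstract
  triple : ∀ p q → Fin (2 * p * q) → Fin 2 × Fin p × Fin q
  triple p q n = let k , j = remQuot {2 * p} q n
                     t , i = remQuot {2} p k
                 in t , i , j

  triple-injective : ∀ p q n n' → triple p q n ≡ triple p q n' → n ≡ n'
  triple-injective p q n n' eq = remQuot-injective {2 * p} q n n'
    (cong₂ _,_ (remQuot-injective {2} p _ _ (cong₂ _,_ (cong proj₁ eq) (cong (λ x → proj₁ (proj₂ x)) eq))) (cong (λ x → proj₂ (proj₂ x)) eq))

  triple-surjective : ∀ p q x → ∃[ n ] triple p q n ≡ x
  triple-surjective p q (t , i , j) = combine (combine t i) j ,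
    trans (cong (λ (k , j) → let t , i = remQuot {2} p k in t , i , j) (Fin.remQuot-combine (combine t i) j))
      (cong (λ (t , i) → t , i , j) (Fin.remQuot-combine t i))

from-injective : ∀ {X Y : Set} (iso : X ↔ Y) {x y} → Inverse.from iso x ≡ Inverse.from iso y → x ≡ y
from-injective iso eq = trans (sym (Inverse.strictlyInverseˡ iso _))
  (trans (cong (Inverse.to iso) eq) (Inverse.strictlyInverseˡ iso _))

-- Among `n + 1` powers two have the same image, which gives a return time `d ≤ n`. Only then is
-- surjectivity available, since walking backwards along the orbit requires `g⁻¹` to be a positive
-- power; it shows that each return time is at least `n`.
simply-transitive-order : (C : Congruence) → let open Congruence C in ∀ g {n} {X : Set} → Fin n ↔ X →
  (orb : ℕ → X) → (∀ i j → orb i ≡ orb j → pow g i ≈ pow g j) → (∀ i j → pow g i ≈ pow g j → orb i ≡ orb j) →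
  ((∃[ d ] pow g (suc d) ≈ []) → ∀ x → ∃[ j ] orb j ≡ x) →
  NonZero n × pow g n ≈ [] × (∀ i → pow g i ≈ [] → n ∣ i)
simply-transitive-order C g {n} {X} iso orb reflects respects surj with Fin.pigeonhole (n<1+n n) (λ i → Inverse.from iso (orb (toℕ i)))
... | i , j , i<j , e = >-nonZero n>0 , subst (λ z → pow g z ≈ []) d≡n gᵈ , divides-all
  where
  open CongruenceProperties C
  orb-≡ : orb (toℕ i) ≡ orb (toℕ j)
  orb-≡ = from-injective iso e
  d = toℕ j ∸ toℕ i
  d>0 : 0 < d
  d>0 = m<n⇒0<n∸m i<j
  gᵈ : pow g d ≈ []
  gᵈ = ≈-sym (++-cancelˡ (pow g (toℕ i)) (≈-trans (≈-reflexive (++-identityʳ _)) (≈-trans (reflects _ _ orb-≡)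
    (≈-reflexive (trans (cong (pow g) (sym (m+[n∸m]≡n (<⇒≤ i<j)))) (pow-+ g (toℕ i) d))))))
  n≤ : ∀ d → 0 < d → pow g d ≈ [] → n ≤ d
  n≤ d@(suc d-1) _ gᵈ = surjective⇒≤ (λ k → Inverse.from iso (orb (toℕ k))) λ y →
    let k , e = surj (d-1 , gᵈ) (Inverse.to iso y) in
    fromℕ< (m%n<n k d) ,
    trans (cong (Inverse.from iso) (trans (cong orb (Fin.toℕ-fromℕ< (m%n<n k d)))
      (trans (respects _ _ (≈-sym (pow-% C g gᵈ k))) e))) (Inverse.strictlyInverseʳ iso y)
  d≡n : d ≡ n
  d≡n = ≤-antisym (≤-trans (m∸n≤m (toℕ j) (toℕ i)) (≤-pred (Fin.toℕ<n j))) (n≤ d d>0 gᵈ)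
  n>0 : 0 < n
  n>0 = subst (0 <_) d≡n d>0
  gⁿ : pow g n ≈ []
  gⁿ = subst (λ z → pow g z ≈ []) d≡n gᵈ
  divides-all : ∀ i → pow g i ≈ [] → n ∣ i
  divides-all i gⁱ with i % n in eq
    where instance _ = >-nonZero n>0
  ... | zero  = m%n≡0⇒n∣m i n {{>-nonZero n>0}} eq
  ... | suc r = contradiction (n≤ (suc r) (s≤s z≤n) (subst (λ z → pow g z ≈ []) eq (≈-trans (≈-sym (pow-% C g gⁿ i)) gⁱ)))
      (<⇒≱ (subst (_< n) eq (m%n<n i n)))
    where instance _ = >-nonZero n>0

T-ext : ∀ {x y} → (T x → T y) → (T y → T x) → x ≡ y
T-ext {true}  {true}  _ _ = refl
T-ext {true}  {false} f _ = ⊥-elim (f _)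
T-ext {false} {true}  _ g = ⊥-elim (g _)
T-ext {false} {false} _ _ = refl

module ChiralRotations (P : Polyhedron) {Φ : Flag P} (R : Rotations P Φ) (chiral : IsChiral P) where
  open Polyhedron P
  open Flag
  open Aut
  open WordAction P R public
  open Rotations R
  open CongruenceProperties rotationCongruence

  private
    c = proj₁ chiral

  ≈-at-Φ : ∀ u w → u · Φ ≡ w · Φ → u ≈ w
  ≈-at-Φ u w = ≋⇐ {u} {w} Φ

  flip₀ : ∀ Ψ → c (r₀ Ψ) ≡ not (c Ψ)
  flip₀ Ψ = ¬-not λ e → proj₁ (proj₂ chiral) Ψ (r₀ Ψ) (inj₁ (adj₀ Ψ)) (sym e)
  flip₁ : ∀ Ψ → c (r₁ Ψ) ≡ not (c Ψ)
  flip₁ Ψ = ¬-not λ e → proj₁ (proj₂ chiral) Ψ (r₁ Ψ) (inj₂ (inj₁ (adj₁ Ψ))) (sym e)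
  flip₂ : ∀ Ψ → c (r₂ Ψ) ≡ not (c Ψ)
  flip₂ Ψ = ¬-not λ e → proj₁ (proj₂ chiral) Ψ (r₂ Ψ) (inj₂ (inj₂ (adj₂ Ψ))) (sym e)

  -- Each adjacency changes the colour and automorphisms commute with adjacency, so it suffices to
  -- look at `Φ`, which a generator moves along two adjacencies.
  colour-gen : ∀ g Ψ → c (act P (gen P R g) Ψ) ≡ c Ψ
  colour-gen g = flag-induction (λ Ψ → c (act P γ Ψ) ≡ c Ψ)
      (λ Ψ e → trans (cong c (act-r₀ γ Ψ)) (trans (flip₀ _) (trans (cong not e) (sym (flip₀ Ψ)))))
      (λ Ψ e → trans (cong c (act-r₁ γ Ψ)) (trans (flip₁ _) (trans (cong not e) (sym (flip₁ Ψ)))))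
      (λ Ψ e → trans (cong c (act-r₂ γ Ψ)) (trans (flip₂ _) (trans (cong not e) (sym (flip₂ Ψ)))))
      Φ (base g)
    where
    γ = gen P R g
    base : ∀ g → c (act P (gen P R g) Φ) ≡ c Φ
    base g₁ = trans (cong c σ₁Φ) (trans (flip₀ _) (trans (cong not (flip₁ Φ)) (not-involutive (c Φ))))
    base g₂ = trans (cong c σ₂Φ) (trans (flip₁ _) (trans (cong not (flip₂ Φ)) (not-involutive (c Φ))))

  colour : ∀ w Ψ → c (w · Ψ) ≡ c Ψ
  colour []                Ψ = refl
  colour ((g , true)  ∷ w) Ψ = trans (colour-gen g (w · Ψ)) (colour w Ψ)
  colour ((g , false) ∷ w) Ψ = trans (sym (trans (cong c (sym (act-invertʳ (gen P R g) (w · Ψ)))) (colour-gen g _))) (colour w Ψ)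

  white≢black : ∀ u w → u · Φ ≢ w · r₁ Φ
  white≢black u w e = not-¬ refl (trans (sym (colour u Φ)) (trans (cong c e) (trans (colour w (r₁ Φ)) (flip₁ Φ))))

  r₂r₁Φ : r₂ (r₁ Φ) ≡ winv b · Φ
  r₂r₁Φ = act-injective σ₂ (trans (act-r₂ σ₂ (r₁ Φ)) (trans (cong r₂ σ₂r₁Φ)
    (trans (r₂-involutive Φ) (sym (act-invertʳ σ₂ Φ)))))

  r₀Φ : r₀ Φ ≡ winv a · r₁ Φ
  r₀Φ = act-injective σ₁ (trans σ₁r₀Φ (sym (act-invertʳ σ₁ (r₁ Φ))))

  -- With flags written as `w · Φ` (white) or `w · r₁ Φ` (black), this and the next four identities
  -- express the `rᵢ` as a change of colour combined with right multiplication of the word.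
  white₁ : ∀ w → r₁ (w · r₁ Φ) ≡ w · Φ
  white₁ w = trans (sym (·-r₁ w (r₁ Φ))) (cong (w ·_) (r₁-involutive Φ))

  white₂ : ∀ w → r₂ (w · r₁ Φ) ≡ (w ++ winv b) · Φ
  white₂ w = trans (sym (·-r₂ w (r₁ Φ))) (trans (cong (w ·_) r₂r₁Φ) (sym (·-++ w (winv b) Φ)))

  white₀ : ∀ w → r₀ (w · r₁ Φ) ≡ (w ++ a) · Φ
  white₀ w = trans (sym (·-r₀ w (r₁ Φ))) (trans (cong (w ·_) (sym σ₁Φ)) (sym (·-++ w a Φ)))

  black₂ : ∀ w → r₂ (w · Φ) ≡ (w ++ b) · r₁ Φ
  black₂ w = trans (sym (·-r₂ w Φ)) (trans (cong (w ·_) (sym σ₂r₁Φ)) (sym (·-++ w b (r₁ Φ))))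

  black₀ : ∀ w → r₀ (w · Φ) ≡ (w ++ winv a) · r₁ Φ
  black₀ w = trans (sym (·-r₀ w Φ)) (trans (cong (w ·_) r₀Φ) (sym (·-++ w (winv a) (r₁ Φ))))

  -- The set `W` selects the flags to be reached: all words for the whole polyhedron, powers of `b`
  -- for the base vertex, powers of `a` for the base face.
  Orbit : (Word → Set) → Flag P → Set
  Orbit W Ψ = Σ Word λ w → W w × (Ψ ≡ w · Φ ⊎ Ψ ≡ w · r₁ Φ)

  module _ {W : Word → Set} where

    orbit-r₁ : Closed r₁ (Orbit W)
    orbit-r₁ _ (w , Ww , inj₁ refl) = w , Ww , inj₂ (sym (·-r₁ w Φ))
    orbit-r₁ _ (w , Ww , inj₂ refl) = w , Ww , inj₁ (white₁ w)

    orbit-r₀ : (∀ w → W w → W (w ++ a)) → (∀ w → W w → W (w ++ winv a)) → Closed r₀ (Orbit W)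
    orbit-r₀ cl cl⁻ _ (w , Ww , inj₁ refl) = w ++ winv a , cl⁻ w Ww , inj₂ (black₀ w)
    orbit-r₀ cl cl⁻ _ (w , Ww , inj₂ refl) = w ++ a , cl w Ww , inj₁ (white₀ w)

    orbit-r₂ : (∀ w → W w → W (w ++ b)) → (∀ w → W w → W (w ++ winv b)) → Closed r₂ (Orbit W)
    orbit-r₂ cl cl⁻ _ (w , Ww , inj₁ refl) = w ++ b , cl w Ww , inj₂ (black₂ w)
    orbit-r₂ cl cl⁻ _ (w , Ww , inj₂ refl) = w ++ winv b , cl⁻ w Ww , inj₁ (white₂ w)

  data Any : Word → Set where
    any : ∀ w → Any w

  orbit : ∀ Ψ → Orbit Any Ψ
  orbit = flag-induction (Orbit Any) (orbit-r₀ (λ _ _ → any _) (λ _ _ → any _)) orbit-r₁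
    (orbit-r₂ (λ _ _ → any _) (λ _ _ → any _)) Φ ([] , any _ , inj₁ refl)

  Power : Gen → Word → Set
  Power g w = ∃[ j ] w ≈ pow g j

  power-closed : ∀ g → (∃[ d ] pow g (suc d) ≈ []) →
    (∀ w → Power g w → Power g (w ++ pow g 1)) × (∀ w → Power g w → Power g (w ++ winv (pow g 1)))
  power-closed g (d , gᵈ) =
    (λ { w (j , e) → j + 1 , ≈-trans (++-congʳ (pow g 1) e) (≈-reflexive (sym (pow-+ g j 1))) }) ,
    (λ { w (j , e) → j + 1 * d , ≈-trans (++-cong e (winv-pow rotationCongruence g gᵈ 1)) (≈-reflexive (sym (pow-+ g j (1 * d)))) })

  fv-B : ∀ j → fv (B j · Φ) ≡ fv Φ
  fv-B zero    = refl
  fv-B (suc j) = trans (cong (fV σ₂) (fv-B j)) (cong fv σ₂Φ)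

  ff-A : ∀ i → ff (A i · Φ) ≡ ff Φ
  ff-A zero    = refl
  ff-A (suc i) = trans (cong (fF σ₁) (ff-A i)) (cong ff σ₁Φ)

  at-vertex : (∃[ d ] B (suc d) ≈ []) → ∀ Ψ → fv Φ ≡ fv Ψ → Orbit (Power g₂) Ψ
  at-vertex fin Ψ e = vertex-induction (Orbit (Power g₂)) orbit-r₁
    (orbit-r₂ (proj₁ (power-closed g₂ fin)) (proj₂ (power-closed g₂ fin))) Φ Ψ e ([] , (0 , ≈-refl) , inj₁ refl)

  at-face : (∃[ d ] A (suc d) ≈ []) → ∀ Ψ → ff Φ ≡ ff Ψ → Orbit (Power g₁) Ψ
  at-face fin Ψ e = face-induction (Orbit (Power g₁))
    (orbit-r₀ (proj₁ (power-closed g₁ fin)) (proj₂ (power-closed g₁ fin))) orbit-r₁ Φ Ψ e ([] , (0 , ≈-refl) , inj₁ refl)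

  private
    Σ-≡ : (t : E → Bool) {x y : Σ E λ e → T (t e)} → proj₁ x ≡ proj₁ y → x ≡ y
    Σ-≡ t {x , h} {_ , h'} refl = cong (x ,_) (T-irrelevant h h')

  module _ {q : ℕ} (iso : Fin q ↔ (Σ E λ e → T (ve (fv Φ) e))) where

    -- The powers of `b` act simply transitively on the edges at the base vertex: vertex and edge
    -- leave a choice between a flag and its `r₂` neighbour, and exactly one of these two is white.
    b-cyclic : NonZero q × B q ≈ [] × (∀ i → B i ≈ [] → q ∣ i)
    b-cyclic = simply-transitive-order rotationCongruence g₂ iso orb reflects
        (λ i j e → Σ-≡ (ve (fv Φ)) (cong fe (≋⇒ e Φ))) surj
      where
      orb : ℕ → Σ E λ e → T (ve (fv Φ) e)
      orb j = fe (B j · Φ) , subst (λ v → T (ve v (fe (B j · Φ)))) (fv-B j) (fve (B j · Φ))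
      reflects : ∀ i j → orb i ≡ orb j → B i ≈ B j
      reflects i j e with same-ve (B i · Φ) (B j · Φ) (trans (fv-B i) (sym (fv-B j))) (cong proj₁ e)
      ... | inj₁ eq = ≈-at-Φ (B i) (B j) (sym eq)
      ... | inj₂ eq = contradiction (trans eq (black₂ (B i))) (white≢black (B j) (B i ++ b))
      surj : (∃[ d ] B (suc d) ≈ []) → ∀ x → ∃[ j ] orb j ≡ x
      surj fin (e , h) =
        let Ψ , v , e≡ = incident⇒flag (inj₁ (fv Φ)) (inj₂ (inj₁ e)) h
            j , fe≡ = from-orbit Ψ (at-vertex fin Ψ (sym v))
        in j , Σ-≡ (ve (fv Φ)) (trans fe≡ e≡)
        where
        from-orbit : ∀ Ψ → Orbit (Power g₂) Ψ → ∃[ j ] fe (B j · Φ) ≡ fe Ψ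
        from-orbit Ψ (w , (j , w≈) , inj₁ eq) = j , trans (cong fe (≋⇒ (≈-sym w≈) Φ)) (cong fe (sym eq))
        from-orbit Ψ (w , Pw , inj₂ eq) =
          let j , w≈ = proj₂ (power-closed g₂ fin) w Pw in
          j , trans (cong fe (≋⇒ (≈-sym w≈) Φ)) (cong fe (trans (sym (white₂ w)) (cong r₂ (sym eq))))

  module _ {p : ℕ} (iso : Fin p ↔ (Σ E λ e → T (ef e (ff Φ)))) where

    a-cyclic : NonZero p × A p ≈ [] × (∀ i → A i ≈ [] → p ∣ i)
    a-cyclic = simply-transitive-order rotationCongruence g₁ iso orb reflects
        (λ i j e → Σ-≡ (λ e → ef e (ff Φ)) (cong fe (≋⇒ e Φ))) surj
      where
      orb : ℕ → Σ E λ e → T (ef e (ff Φ))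
      orb j = fe (A j · Φ) , subst (λ f → T (ef (fe (A j · Φ)) f)) (ff-A j) (fef (A j · Φ))
      reflects : ∀ i j → orb i ≡ orb j → A i ≈ A j
      reflects i j e with same-ef (A i · Φ) (A j · Φ) (cong proj₁ e) (trans (ff-A i) (sym (ff-A j)))
      ... | inj₁ eq = ≈-at-Φ (A i) (A j) (sym eq)
      ... | inj₂ eq = contradiction (trans eq (black₀ (A i))) (white≢black (A j) (A i ++ winv a))
      surj : (∃[ d ] A (suc d) ≈ []) → ∀ x → ∃[ j ] orb j ≡ x
      surj fin (e , h) =
        let Ψ , e≡ , f = incident⇒flag (inj₂ (inj₁ e)) (inj₂ (inj₂ (ff Φ))) h
            j , fe≡ = from-orbit Ψ (at-face fin Ψ (sym f))
        in j , Σ-≡ (λ e → ef e (ff Φ)) (trans fe≡ e≡)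
        where
        from-orbit : ∀ Ψ → Orbit (Power g₁) Ψ → ∃[ j ] fe (A j · Φ) ≡ fe Ψ
        from-orbit Ψ (w , (j , w≈) , inj₁ eq) = j , trans (cong fe (≋⇒ (≈-sym w≈) Φ)) (cong fe (sym eq))
        from-orbit Ψ (w , Pw , inj₂ eq) =
          let j , w≈ = proj₁ (power-closed g₁ fin) w Pw in
          j , trans (cong fe (≋⇒ (≈-sym w≈) Φ)) (cong fe (trans (sym (white₀ w)) (cong r₀ (sym eq))))

  baΦ : (b ++ a) · Φ ≡ r₀ (r₂ Φ)
  baΦ = trans (cong (act P σ₂) σ₁Φ) (trans (act-r₀ σ₂ (r₁ Φ)) (cong r₀ σ₂r₁Φ))

  baba≈ : (b ++ a) ++ (b ++ a) ≈ []
  baba≈ = ≈-at-Φ ((b ++ a) ++ (b ++ a)) [] (trans (·-++ (b ++ a) (b ++ a) Φ) (trans (cong ((b ++ a) ·_) baΦ)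
    (trans (·-r₀ (b ++ a) (r₂ Φ)) (trans (cong r₀ (trans (·-r₂ (b ++ a) Φ) (cong r₂ baΦ)))
    (trans (cong r₀ (r₂-involutive (r₀ Φ))) (r₀-involutive Φ))))))

  module _ {p q : ℕ} (type : HasType P p q) (flags : Tight P p q) where

    private
      a-cyc = a-cyclic (proj₁ type (ff Φ))
      b-cyc = b-cyclic (proj₂ type (fv Φ))
      instance
        p≢0 : NonZero p
        p≢0 = proj₁ a-cyc
        q≢0 : NonZero q
        q≢0 = proj₁ b-cyc

    -- A common element of `⟨a⟩` and `⟨b⟩` fixes the base face and the base vertex, so it takes `Φ`
    -- to `Φ` or to `r₁ Φ`; the latter has the wrong colour.
    indep : ∀ i j → A i ≈ B j → p ∣ i × q ∣ j
    indep i j e = proj₂ (proj₂ a-cyc) i A≈[] , proj₂ (proj₂ b-cyc) j (≈-trans (≈-sym e) A≈[])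
      where
      A≈[] : A i ≈ []
      A≈[] with same-vf Φ (A i · Φ) (sym (trans (cong fv (≋⇒ e Φ)) (fv-B j))) (sym (ff-A i))
      ... | inj₁ eq = ≈-at-Φ (A i) [] eq
      ... | inj₂ eq = contradiction eq (white≢black (A i) [])

    private
      base : Fin 2 → Flag P
      base zero       = Φ
      base (suc zero) = r₁ Φ

      sweep : Fin 2 → Fin p → Fin q → Flag P
      sweep t i j = (A (toℕ i) ++ B (toℕ j)) · base t

      nth : Fin (2 * p * q) → Flag P
      nth n = sweep (proj₁ (triple p q n)) (proj₁ (proj₂ (triple p q n))) (proj₂ (proj₂ (triple p q n)))

      exponents-≡ : ∀ {n} {{_ : NonZero n}} (i i' : Fin n) → n ∣ toℕ i' * (n ∸ 1) + toℕ i → i ≡ i'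
      exponents-≡ {n} i i' d = Fin.toℕ-injective (trans (sym (m<n⇒m%n≡m (Fin.toℕ<n i)))
        (trans (sym (mod-eq n (toℕ i') (toℕ i) d)) (m<n⇒m%n≡m (Fin.toℕ<n i'))))

      coordinates-≡ : ∀ (i i' : Fin p) (j j' : Fin q) →
        A (toℕ i) ++ B (toℕ j) ≈ A (toℕ i') ++ B (toℕ j') → i ≡ i' × j ≡ j'
      coordinates-≡ i i' j j' e = exponents-≡ i i' (proj₁ ind) , sym (exponents-≡ j' j (subst (q ∣_) (+-comm (toℕ j') _) (proj₂ ind)))
        where
        open ≈-Reasoning
        x = A (toℕ i)
        x' = A (toℕ i')
        y = B (toℕ j)
        y' = B (toℕ j')
        ind : p ∣ toℕ i' * (p ∸ 1) + toℕ i × q ∣ toℕ j' + toℕ j * (q ∸ 1)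
        ind = indep (toℕ i' * (p ∸ 1) + toℕ i) (toℕ j' + toℕ j * (q ∸ 1)) (begin
          A (toℕ i' * (p ∸ 1) + toℕ i)         ≡⟨ pow-+ g₁ (toℕ i' * (p ∸ 1)) (toℕ i) ⟩
          A (toℕ i' * (p ∸ 1)) ++ x            ≈⟨ ++-congʳ x (winv-pow rotationCongruence g₁ (proj₁ (proj₂ a-cyc)) (toℕ i')) ⟨
          winv x' ++ x                         ≈⟨ group (x ∷ y ∷ x' ∷ []) (v₂ ⁻ ⊙ v₀) (v₂ ⁻ ⊙ (v₀ ⊙ v₁) ⊙ v₁ ⁻) refl ⟩
          winv x' ++ (x ++ y) ++ winv y        ≈⟨ ≈-ctx (winv x') (winv y) e ⟩
          winv x' ++ (x' ++ y') ++ winv y      ≈⟨ group (y ∷ x' ∷ y' ∷ []) (v₁ ⁻ ⊙ (v₁ ⊙ v₂) ⊙ v₀ ⁻) (v₂ ⊙ v₀ ⁻) refl ⟩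
          y' ++ winv y                         ≈⟨ ++-congˡ y' (winv-pow rotationCongruence g₂ (proj₁ (proj₂ b-cyc)) (toℕ j)) ⟩
          y' ++ B (toℕ j * (q ∸ 1))            ≡⟨ pow-+ g₂ (toℕ j') (toℕ j * (q ∸ 1)) ⟨
          B (toℕ j' + toℕ j * (q ∸ 1))         ∎)

      sweep-injective : ∀ t i j t' i' j' → sweep t i j ≡ sweep t' i' j' → t ≡ t' × i ≡ i' × j ≡ j'
      sweep-injective t i j t' i' j' eq with same-word t t' eq
        where
        same-word : ∀ t t' → sweep t i j ≡ sweep t' i' j' →
          t ≡ t' × A (toℕ i) ++ B (toℕ j) ≈ A (toℕ i') ++ B (toℕ j')
        same-word zero       zero       eq = refl , ≋⇐ {A (toℕ i) ++ B (toℕ j)} {A (toℕ i') ++ B (toℕ j')} Φ eq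
        same-word zero       (suc zero) eq = contradiction eq (white≢black (A (toℕ i) ++ B (toℕ j)) (A (toℕ i') ++ B (toℕ j')))
        same-word (suc zero) zero       eq = contradiction (sym eq) (white≢black (A (toℕ i') ++ B (toℕ j')) (A (toℕ i) ++ B (toℕ j)))
        same-word (suc zero) (suc zero) eq = refl , ≋⇐ {A (toℕ i) ++ B (toℕ j)} {A (toℕ i') ++ B (toℕ j')} (r₁ Φ) eq
      ... | t≡t' , w≈ = t≡t' , coordinates-≡ i i' j j' w≈

      nth-injective : ∀ n n' → nth n ≡ nth n' → n ≡ n'
      nth-injective n n' eq = triple-injective p q n n' (cong₂ _,_ (proj₁ same-triple) (cong₂ _,_ (proj₁ (proj₂ same-triple)) (proj₂ (proj₂ same-triple))))
        where
        same-triple = sweep-injective (proj₁ (triple p q n)) (proj₁ (proj₂ (triple p q n))) (proj₂ (proj₂ (triple p q n)))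
          (proj₁ (triple p q n')) (proj₁ (proj₂ (triple p q n'))) (proj₂ (proj₂ (triple p q n'))) eq

      -- Tightness enters here: the `2pq` flags `aⁱbʲ · Φ` and `aⁱbʲ · r₁ Φ` are distinct, so they
      -- are all flags. Applied to `w · Φ` this yields the factorisation of `w`.
      nth-surjective : ∀ Ψ → ∃[ n ] nth n ≡ Ψ
      nth-surjective Ψ =
        let n , eq = injective⇒surjective (λ n → Inverse.from flags (nth n))
              (λ n n' eq → nth-injective n n' (from-injective flags eq)) (Inverse.from flags Ψ)
        in n , from-injective flags eq

    rotations-tight : TightPair rotationCongruence p q
    rotations-tight = record
      { a-order = proj₁ (proj₂ a-cyc)
      ; b-order = proj₁ (proj₂ b-cyc)
      ; abab = ≈-trans (group (a ∷ b ∷ []) (v₀ ⊙ v₁ ⊙ v₀ ⊙ v₁) (v₀ ⊙ ((v₁ ⊙ v₀) ⊙ (v₁ ⊙ v₀)) ⊙ v₀ ⁻) refl)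
          (≈-trans (≈-ctx a (winv a) baba≈) (inverseʳ a))
      ; factor = factor
      ; indep = indep }
      where
      factor : ∀ w → ∃[ i ] ∃[ j ] w ≈ A i ++ B j
      factor w =
        let n , eq = nth-surjective (w · Φ) in
        from-sweep (proj₁ (triple p q n)) (proj₁ (proj₂ (triple p q n))) (proj₂ (proj₂ (triple p q n))) eq
        where
        from-sweep : ∀ t i j → sweep t i j ≡ w · Φ → ∃[ i ] ∃[ j ] w ≈ A i ++ B j
        from-sweep zero       i j eq = toℕ i , toℕ j , ≈-at-Φ w (A (toℕ i) ++ B (toℕ j)) (sym eq)
        from-sweep (suc zero) i j eq = contradiction (sym eq) (white≢black w (A (toℕ i) ++ B (toℕ j)))

-- Reflections

module Reflection (P : Polyhedron) {Φ : Flag P} (R : Rotations P Φ) (chiral : IsChiral P)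
    {p q : ℕ} (type : HasType P p q) where
  open Polyhedron P
  open Flag
  open Aut
  open ChiralRotations P R chiral
  open Rotations R
  open CongruenceProperties rotationCongruence

  private
    positive : ∀ g {n} → NonZero n → pow g n ≈ [] → ∃[ d ] pow g (suc d) ≈ []
    positive g {suc d} _ e = d , e

  a-finite : ∃[ d ] A (suc d) ≈ []
  a-finite = let p≢0 , Ap , _ = a-cyclic (proj₁ type (ff Φ)) in positive g₁ p≢0 Ap

  b-finite : ∃[ d ] B (suc d) ≈ []
  b-finite = let q≢0 , Bq , _ = b-cyclic (proj₂ type (fv Φ)) in positive g₂ q≢0 Bq

  white-orbit : ∀ {W u Ψ} → Ψ ≡ u · Φ → Orbit W Ψ → Σ Word λ w → W w × u ≈ w
  white-orbit {u = u} e (w , Ww , inj₁ e') = w , Ww , ≈-at-Φ u w (trans (sym e) e')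
  white-orbit {u = u} e (w , Ww , inj₂ e') = contradiction (trans (sym e) e') (white≢black u w)

  stabiliser-v : ∀ u → fv (u · Φ) ≡ fv Φ → ∃[ j ] u ≈ B j
  stabiliser-v u e =
    let w , (j , w≈) , u≈ = white-orbit {u = u} refl (at-vertex b-finite (u · Φ) (sym e)) in j , ≈-trans u≈ w≈

  stabiliser-f : ∀ u → ff (u · Φ) ≡ ff Φ → ∃[ i ] u ≈ A i
  stabiliser-f u e =
    let w , (i , w≈) , u≈ = white-orbit {u = u} refl (at-face a-finite (u · Φ) (sym e)) in i , ≈-trans u≈ w≈

  data Half : Word → Set where
    trivial : Half []
    turn    : Half (b ++ a)

  same-e : ∀ Ψ Θ → fe Ψ ≡ fe Θ → Θ ≡ Ψ ⊎ Θ ≡ r₀ Ψ ⊎ Θ ≡ r₂ Ψ ⊎ Θ ≡ r₂ (r₀ Ψ)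
  same-e Ψ (flag v _ f h h') refl = cases (same-ef Ψ (flag v (fe Ψ) (ff Ψ) h (fef Ψ)) refl refl)
      (same-ve (flag v (fe Ψ) (ff Ψ) h (fef Ψ)) (flag v (fe Ψ) f h h') refl refl)
    where
    cases : ∀ {Ψ' Θ} → Ψ' ≡ Ψ ⊎ Ψ' ≡ r₀ Ψ → Θ ≡ Ψ' ⊎ Θ ≡ r₂ Ψ' → Θ ≡ Ψ ⊎ Θ ≡ r₀ Ψ ⊎ Θ ≡ r₂ Ψ ⊎ Θ ≡ r₂ (r₀ Ψ)
    cases (inj₁ refl) (inj₁ e) = inj₁ e
    cases (inj₂ refl) (inj₁ e) = inj₂ (inj₁ e)
    cases (inj₁ refl) (inj₂ e) = inj₂ (inj₂ (inj₁ e))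
    cases (inj₂ refl) (inj₂ e) = inj₂ (inj₂ (inj₂ e))

  -- Four flags contain the base edge. The flags `r₀ Φ` and `r₂ Φ` are black, which leaves `Φ` and
  -- `r₂ (r₀ Φ)`, the image of `Φ` under `ba`.
  stabiliser-e : ∀ u → fe (u · Φ) ≡ fe Φ → Σ Word λ w → Half w × u ≈ w
  stabiliser-e u e = cases (same-e Φ (u · Φ) (sym e))
    where
    cases : u · Φ ≡ Φ ⊎ u · Φ ≡ r₀ Φ ⊎ u · Φ ≡ r₂ Φ ⊎ u · Φ ≡ r₂ (r₀ Φ) → Σ Word λ w → Half w × u ≈ w
    cases (inj₁ e) = [] , trivial , ≈-at-Φ u [] e
    cases (inj₂ (inj₁ e)) = contradiction (trans e r₀Φ) (white≢black u (winv a))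
    cases (inj₂ (inj₂ (inj₁ e))) = contradiction (trans e (black₂ [])) (white≢black u b)
    cases (inj₂ (inj₂ (inj₂ e))) = b ++ a , turn , ≈-at-Φ u (b ++ a) (trans e (sym baΦ))

  quotient-fixes : ∀ {X : Set} (π : Flag P → X) (act-π : Word → X → X) → (∀ w Ψ → π (w · Ψ) ≡ act-π w (π Ψ)) →
    ∀ u w → π (u · Φ) ≡ π (w · Φ) → π ((winv w ++ u) · Φ) ≡ π Φ
  quotient-fixes π act-π π-act u w e = trans (cong π (·-++ (winv w) u Φ)) (trans (π-act (winv w) (u · Φ))
    (trans (cong (act-π (winv w)) e) (trans (sym (π-act (winv w) (w · Φ)))
    (cong π (trans (sym (·-++ (winv w) w Φ)) (≋⇒ (inverseˡ w) Φ))))))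

  module _ (invariant : BarInvariant rotationCongruence) where

    private
      shift : ∀ u w h → winv w ++ u ≈ h → u ≈ w ++ h
      shift u w h e = ≈-trans (group (u ∷ w ∷ []) v₀ (v₁ ⊙ v₁ ⁻ ⊙ v₀) refl) (++-congˡ w e)

      bar-shift : ∀ u w h → winv w ++ u ≈ h → ∀ Ψ → bar u · Ψ ≡ bar w · bar h · Ψ
      bar-shift u w h e Ψ = trans (≋⇒ (invariant u (w ++ h) (shift u w h e)) Ψ)
        (trans (cong (_· Ψ) (map-++ inv w h)) (·-++ (bar w) (bar h) Ψ))

      fv-bar-B : ∀ j → fv (bar (B j) · r₁ Φ) ≡ fv Φ
      fv-bar-B zero    = refl
      fv-bar-B (suc j) = trans (cong (gV σ₂) (trans (fv-bar-B j) (sym (cong fv σ₂Φ)))) (gfV σ₂ (fv Φ))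

      ff-bar-A : ∀ i → ff (bar (A i) · r₁ Φ) ≡ ff Φ
      ff-bar-A zero    = refl
      ff-bar-A (suc i) = trans (cong (gF σ₁) (trans (ff-bar-A i) (sym (cong ff σ₁Φ)))) (gfF σ₁ (ff Φ))

      fe-bar-half : ∀ {h} → Half h → fe (bar h · r₁ Φ) ≡ fe (r₁ Φ)
      fe-bar-half trivial = refl
      fe-bar-half turn = cong fe (trans (cong (act P (invert σ₂)) (sym r₀Φ))
        (trans (act-r₀ (invert σ₂) Φ) (cong r₀ (sym r₂r₁Φ))))

      -- This makes the reflection well defined on vertices: `w⁻¹u` is a power of `b`, its image
      -- under `bar` is again one, and powers of `b` fix the vertex of `r₁ Φ`, which is the base
      -- vertex.
      transfer-v : ∀ u w → fv (u · Φ) ≡ fv (w · Φ) → fv (bar u · r₁ Φ) ≡ fv (bar w · r₁ Φ)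
      transfer-v u w e =
        let j , h≈ = stabiliser-v (winv w ++ u) (quotient-fixes fv (evV P R) ·-fv u w e) in
        trans (cong fv (bar-shift u w (B j) h≈ (r₁ Φ))) (trans (·-fv (bar w) _)
          (trans (cong (evV P R (bar w)) (fv-bar-B j)) (sym (·-fv (bar w) (r₁ Φ)))))

      transfer-f : ∀ u w → ff (u · Φ) ≡ ff (w · Φ) → ff (bar u · r₁ Φ) ≡ ff (bar w · r₁ Φ)
      transfer-f u w e =
        let i , h≈ = stabiliser-f (winv w ++ u) (quotient-fixes ff (evF P R) ·-ff u w e) in
        trans (cong ff (bar-shift u w (A i) h≈ (r₁ Φ))) (trans (·-ff (bar w) _)
          (trans (cong (evF P R (bar w)) (ff-bar-A i)) (sym (·-ff (bar w) (r₁ Φ)))))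

      transfer-e : ∀ u w → fe (u · Φ) ≡ fe (w · Φ) → fe (bar u · r₁ Φ) ≡ fe (bar w · r₁ Φ)
      transfer-e u w e =
        let h , half , h≈ = stabiliser-e (winv w ++ u) (quotient-fixes fe (evE P R) ·-fe u w e) in
        trans (cong fe (bar-shift u w h h≈ (r₁ Φ))) (trans (·-fe (bar w) _)
          (trans (cong (evE P R (bar w)) (fe-bar-half half)) (sym (·-fe (bar w) (r₁ Φ)))))

      -- A black flag may be replaced by its `r₁` neighbour, which is white and keeps vertex and
      -- face. The other two pairs of ranks use `r₂` and `r₀`.
      white-vf : ∀ Ψ → Σ Word λ w → fv (w · Φ) ≡ fv Ψ × ff (w · Φ) ≡ ff Ψ
      white-vf Ψ = cases (orbit Ψ)
        where
        cases : Orbit Any Ψ → _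
        cases (w , _ , inj₁ e) = w , cong fv (sym e) , cong ff (sym e)
        cases (w , _ , inj₂ e) = w , trans (cong fv (sym (white₁ w))) (cong fv (sym e)) , trans (cong ff (sym (white₁ w))) (cong ff (sym e))

      white-ve : ∀ Ψ → Σ Word λ w → fv (w · Φ) ≡ fv Ψ × fe (w · Φ) ≡ fe Ψ
      white-ve Ψ = cases (orbit Ψ)
        where
        cases : Orbit Any Ψ → _
        cases (w , _ , inj₁ e) = w , cong fv (sym e) , cong fe (sym e)
        cases (w , _ , inj₂ e) = w ++ winv b , trans (cong fv (sym (white₂ w))) (cong fv (sym e)) , trans (cong fe (sym (white₂ w))) (cong fe (sym e))

      white-ef : ∀ Ψ → Σ Word λ w → fe (w · Φ) ≡ fe Ψ × ff (w · Φ) ≡ ff Ψ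
      white-ef Ψ = cases (orbit Ψ)
        where
        cases : Orbit Any Ψ → _
        cases (w , _ , inj₁ e) = w , cong fe (sym e) , cong ff (sym e)
        cases (w , _ , inj₂ e) = w ++ a , trans (cong fe (sym (white₀ w))) (cong fe (sym e)) , trans (cong ff (sym (white₀ w))) (cong ff (sym e))

    abstract
      word-v : ∀ v → Σ Word λ w → fv (w · Φ) ≡ v
      word-v v = let Ψ , on = flag-on Φ (inj₁ v) ; w , e , _ = white-vf Ψ in w , trans e on
      word-e : ∀ e → Σ Word λ w → fe (w · Φ) ≡ e
      word-e e = let Ψ , on = flag-on Φ (inj₂ (inj₁ e)) ; w , _ , e' = white-ve Ψ in w , trans e' on
      word-f : ∀ f → Σ Word λ w → ff (w · Φ) ≡ f
      word-f f = let Ψ , on = flag-on Φ (inj₂ (inj₂ f)) ; w , _ , e = white-vf Ψ in w , trans e on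

    -- The reflection takes w · Φ to bar w · Φ¹.
    ρV : V → V
    ρV v = fv (bar (proj₁ (word-v v)) · r₁ Φ)
    ρE : E → E
    ρE e = fe (bar (proj₁ (word-e e)) · r₁ Φ)
    ρF : F → F
    ρF f = ff (bar (proj₁ (word-f f)) · r₁ Φ)

    ρV-white : ∀ w → ρV (fv (w · Φ)) ≡ fv (bar w · r₁ Φ)
    ρV-white w = transfer-v (proj₁ (word-v _)) w (proj₂ (word-v (fv (w · Φ))))
    ρE-white : ∀ w → ρE (fe (w · Φ)) ≡ fe (bar w · r₁ Φ)
    ρE-white w = transfer-e (proj₁ (word-e _)) w (proj₂ (word-e (fe (w · Φ))))
    ρF-white : ∀ w → ρF (ff (w · Φ)) ≡ ff (bar w · r₁ Φ)
    ρF-white w = transfer-f (proj₁ (word-f _)) w (proj₂ (word-f (ff (w · Φ))))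

    ρV-black : ∀ w → ρV (fv (w · r₁ Φ)) ≡ fv (bar w · Φ)
    ρV-black w = trans (cong ρV (cong fv (·-r₁ w Φ))) (trans (ρV-white w) (cong fv (·-r₁ (bar w) Φ)))
    ρF-black : ∀ w → ρF (ff (w · r₁ Φ)) ≡ ff (bar w · Φ)
    ρF-black w = trans (cong ρF (cong ff (·-r₁ w Φ))) (trans (ρF-white w) (cong ff (·-r₁ (bar w) Φ)))
    ρE-black : ∀ w → ρE (fe (w · r₁ Φ)) ≡ fe (bar w · Φ)
    ρE-black w = trans (cong ρE (cong fe (white₂ w))) (trans (ρE-white (w ++ winv b))
      (trans (cong (λ z → fe (z · r₁ Φ)) (map-++ inv w (winv b))) (trans (cong fe (·-++ (bar w) b (r₁ Φ)))
      (trans (cong (λ z → fe (bar w · z)) σ₂r₁Φ) (cong fe (·-r₂ (bar w) Φ))))))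

    private
      bar-bar : ∀ w Ψ → bar (bar w) · Ψ ≡ w · Ψ
      bar-bar w Ψ = cong (_· Ψ) (bar-involutive w)

      ρVρV : ∀ v → ρV (ρV v) ≡ v
      ρVρV v = trans (ρV-black (bar (proj₁ (word-v v)))) (trans (cong fv (bar-bar (proj₁ (word-v v)) Φ)) (proj₂ (word-v v)))
      ρEρE : ∀ e → ρE (ρE e) ≡ e
      ρEρE e = trans (ρE-black (bar (proj₁ (word-e e)))) (trans (cong fe (bar-bar (proj₁ (word-e e)) Φ)) (proj₂ (word-e e)))
      ρFρF : ∀ f → ρF (ρF f) ≡ f
      ρFρF f = trans (ρF-black (bar (proj₁ (word-f f)))) (trans (cong ff (bar-bar (proj₁ (word-f f)) Φ)) (proj₂ (word-f f)))

      ρ-ve : ∀ v e → T (ve v e) → T (ve (ρV v) (ρE e))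
      ρ-ve v e h =
        let Ψ , on-v , on-e = incident⇒flag (inj₁ v) (inj₂ (inj₁ e)) h
            w , v≡ , e≡ = white-ve Ψ
        in subst₂ (λ x y → T (ve x y)) (trans (sym (ρV-white w)) (cong ρV (trans v≡ on-v)))
             (trans (sym (ρE-white w)) (cong ρE (trans e≡ on-e))) (fve (bar w · r₁ Φ))
      ρ-ef : ∀ e f → T (ef e f) → T (ef (ρE e) (ρF f))
      ρ-ef e f h =
        let Ψ , on-e , on-f = incident⇒flag (inj₂ (inj₁ e)) (inj₂ (inj₂ f)) h
            w , e≡ , f≡ = white-ef Ψ
        in subst₂ (λ x y → T (ef x y)) (trans (sym (ρE-white w)) (cong ρE (trans e≡ on-e)))
             (trans (sym (ρF-white w)) (cong ρF (trans f≡ on-f))) (fef (bar w · r₁ Φ))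
      ρ-vf : ∀ v f → T (vf v f) → T (vf (ρV v) (ρF f))
      ρ-vf v f h =
        let Ψ , on-v , on-f = incident⇒flag (inj₁ v) (inj₂ (inj₂ f)) h
            w , v≡ , f≡ = white-vf Ψ
        in subst₂ (λ x y → T (vf x y)) (trans (sym (ρV-white w)) (cong ρV (trans v≡ on-v)))
             (trans (sym (ρF-white w)) (cong ρF (trans f≡ on-f))) (fvf (bar w · r₁ Φ))

    reflection : Aut P
    reflection = record
      { fV = ρV ; gV = ρV ; fE = ρE ; gE = ρE ; fF = ρF ; gF = ρF
      ; fgV = ρVρV ; gfV = ρVρV ; fgE = ρEρE ; gfE = ρEρE ; fgF = ρFρF ; gfF = ρFρF
      ; pres-ve = λ v e → T-ext (λ h → subst₂ (λ x y → T (ve x y)) (ρVρV v) (ρEρE e) (ρ-ve _ _ h)) (ρ-ve v e)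
      ; pres-ef = λ e f → T-ext (λ h → subst₂ (λ x y → T (ef x y)) (ρEρE e) (ρFρF f) (ρ-ef _ _ h)) (ρ-ef e f)
      ; pres-vf = λ v f → T-ext (λ h → subst₂ (λ x y → T (vf x y)) (ρVρV v) (ρFρF f) (ρ-vf _ _ h)) (ρ-vf v f) }

    reflection-Φ : act P reflection Φ ≡ r₁ Φ
    reflection-Φ = flag-≡ (ρV-white []) (ρE-white []) (ρF-white [])

  reflection⇒regular : (ρ : Aut P) → act P ρ Φ ≡ r₁ Φ → ∀ Ψ Θ → Σ (Aut P) λ γ → _≐_ P (act P γ Ψ) Θ
  reflection⇒regular ρ ρ-Φ Ψ Θ = cases (c Ψ Bool.≟ c Θ) (c Ψ Bool.≟ c Φ)
    where
    c = proj₁ chiral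
    move : ∀ Ψ Θ → c Ψ ≡ c Θ → Σ (Aut P) λ γ → act P γ Ψ ≡ Θ
    move Ψ Θ e = let γ , v , x , f = proj₁ (proj₂ (proj₂ chiral)) Ψ Θ e in γ , flag-≡ v x f
    ρ-r₁Φ : act P ρ (r₁ Φ) ≡ Φ
    ρ-r₁Φ = trans (act-r₁ ρ Φ) (trans (cong r₁ ρ-Φ) (r₁-involutive Φ))
    via : ∀ Ψ' Θ' → act P ρ Ψ' ≡ Θ' → c Ψ ≡ c Ψ' → c Θ' ≡ c Θ → Σ (Aut P) λ γ → _≐_ P (act P γ Ψ) Θ
    via Ψ' Θ' e cΨ cΘ =
      let γ , γ≡ = move Ψ Ψ' cΨ
          δ , δ≡ = move Θ' Θ cΘ
          eq = trans (cong (λ x → act P δ (act P ρ x)) γ≡) (trans (cong (act P δ) e) δ≡)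
      in compose δ (compose ρ γ) , cong fv eq , cong fe eq , cong ff eq
    cases : Dec (c Ψ ≡ c Θ) → Dec (c Ψ ≡ c Φ) → Σ (Aut P) λ γ → _≐_ P (act P γ Ψ) Θ
    cases (yes e) _       = proj₁ (proj₂ (proj₂ chiral)) Ψ Θ e
    cases (no ¬e) (yes e) = via Φ (r₁ Φ) ρ-Φ e
      (trans (flip₁ Φ) (sym (trans (¬-not (λ x → ¬e (sym x))) (cong not e))))
    cases (no ¬e) (no ¬e') = via (r₁ Φ) Φ ρ-r₁Φ (trans (¬-not ¬e') (sym (flip₁ Φ)))
      (sym (trans (¬-not (λ x → ¬e (sym x))) (trans (cong not (¬-not ¬e')) (not-involutive (c Φ)))))

  ¬barInvariant : ¬ BarInvariant rotationCongruence
  ¬barInvariant invariant = proj₂ (proj₂ (proj₂ chiral))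
    (reflection⇒regular (reflection invariant) (reflection-Φ invariant))

-- Coset polyhedra

bijection : ∀ {n} {X : Set} (f : Fin n → X) → (∀ i j → f i ≡ f j → i ≡ j) → (∀ x → ∃[ i ] f i ≡ x) → Fin n ↔ X
bijection f inj surj = mk↔ₛ′ f (λ x → proj₁ (surj x)) (λ x → proj₂ (surj x)) (λ i → inj _ _ (proj₂ (surj (f i))))

-- An orbit {k, τ k} is represented by its smaller element.
module Pairs {n : ℕ} (τ : Fin n → Fin n) (τ-involutive : ∀ k → τ (τ k) ≡ k) where

  low : Fin n → Bool
  low k = toℕ k ≤ᵇ toℕ (τ k)

  Pair : Set
  Pair = Σ (Fin n) λ k → T (low k)

  Pair-≡ : {x y : Pair} → proj₁ x ≡ proj₁ y → x ≡ y
  Pair-≡ {k , h} {_ , h'} refl = cong (k ,_) (T-irrelevant h h')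

  high : ∀ k → ¬ T (low k) → T (low (τ k))
  high k ¬h = ≤⇒≤ᵇ (subst (λ z → toℕ (τ k) ≤ toℕ z) (sym (τ-involutive k)) (≰⇒≥ λ h → ¬h (≤⇒≤ᵇ h)))

  choose : ∀ k → Dec (T (low k)) → Pair
  choose k (yes h) = k , h
  choose k (no ¬h) = τ k , high k ¬h

  pair : Fin n → Pair
  pair k = choose k (T? (low k))

  choose-member : ∀ k d → proj₁ (choose k d) ≡ k ⊎ proj₁ (choose k d) ≡ τ k
  choose-member k (yes _) = inj₁ refl
  choose-member k (no _)  = inj₂ refl

  pair-sound : ∀ k l → pair k ≡ pair l → k ≡ l ⊎ k ≡ τ l
  pair-sound k l eq = cases (choose-member k (T? (low k))) (choose-member l (T? (low l)))
    where
    x = proj₁ (pair k)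
    y = proj₁ (pair l)
    e : x ≡ y
    e = cong proj₁ eq
    cases : x ≡ k ⊎ x ≡ τ k → y ≡ l ⊎ y ≡ τ l → k ≡ l ⊎ k ≡ τ l
    cases (inj₁ p) (inj₁ q) = inj₁ (trans (sym p) (trans e q))
    cases (inj₁ p) (inj₂ q) = inj₂ (trans (sym p) (trans e q))
    cases (inj₂ p) (inj₁ q) = inj₂ (trans (sym (τ-involutive k)) (cong τ (trans (sym p) (trans e q))))
    cases (inj₂ p) (inj₂ q) = inj₁ (trans (sym (τ-involutive k)) (trans (cong τ (trans (sym p) (trans e q))) (τ-involutive l)))

  pair-τ : ∀ k → pair (τ k) ≡ pair k
  pair-τ k = cases (T? (low k)) (T? (low (τ k)))
    where
    cases : ∀ d d' → choose (τ k) d' ≡ choose k d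
    cases (yes h) (yes h') = Pair-≡ (Fin.toℕ-injective (≤-antisym
      (subst (λ z → toℕ (τ k) ≤ toℕ z) (τ-involutive k) (≤ᵇ⇒≤ _ _ h')) (≤ᵇ⇒≤ _ _ h)))
    cases (yes h) (no ¬h') = Pair-≡ (τ-involutive k)
    cases (no ¬h) (yes h') = Pair-≡ refl
    cases (no ¬h) (no ¬h') = contradiction (high k ¬h) ¬h'

  pair-proj₁ : ∀ x → pair (proj₁ x) ≡ x
  pair-proj₁ (k , h) = cases (T? (low k))
    where
    cases : ∀ d → choose k d ≡ (k , h)
    cases (yes h') = Pair-≡ refl
    cases (no ¬h)  = contradiction h ¬h

  _≟ᴾ_ : (x y : Pair) → Dec (x ≡ y)
  x ≟ᴾ y with proj₁ x Fin.≟ proj₁ y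
  ... | yes e = yes (Pair-≡ e)
  ... | no ¬e = no λ e → ¬e (cong proj₁ e)

-- The half-turn about the base edge.
t : Word
t = b ++ a

-- The sets of left cosets of ⟨b⟩, ⟨ba⟩ and ⟨a⟩.
record Cosets (C : Congruence) (p q : ℕ) : Set₁ where
  open Congruence C
  field
    Edge  : Set
    _≟ᴱ_  : (x y : Edge) → Dec (x ≡ y)
    vtx   : Word → Fin p
    edge  : Word → Edge
    fac   : Word → Fin q
    vlift : Fin p → Word
    elift : Edge → Word
    flift : Fin q → Word
    vtx-lift  : ∀ v → vtx (vlift v) ≡ v
    edge-lift : ∀ e → edge (elift e) ≡ e
    fac-lift  : ∀ f → fac (flift f) ≡ f
    vtx-sound     : ∀ g h → vtx g ≡ vtx h → ∃[ j ] h ≈ g ++ B j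
    vtx-complete  : ∀ g h j → h ≈ g ++ B j → vtx g ≡ vtx h
    edge-sound    : ∀ g h → edge g ≡ edge h → g ≈ h ⊎ g ≈ h ++ t
    edge-complete : ∀ g h → g ≈ h ⊎ g ≈ h ++ t → edge g ≡ edge h
    fac-sound     : ∀ g h → fac g ≡ fac h → ∃[ i ] h ≈ g ++ A i
    fac-complete  : ∀ g h i → h ≈ g ++ A i → fac g ≡ fac h
    meet : ∀ v f → Σ Word λ g → vtx g ≡ v × fac g ≡ f

module _ {C : Congruence} {p q : ℕ} (tight : TightPair C p q) where
  open TightProperties tight

  private
    code : Word → Fin (p * q)
    code w = combine (vtx w) (col w)

    lift : Fin (p * q) → Word
    lift k = A (toℕ (proj₁ (remQuot {p} q k))) ++ B (toℕ (proj₂ (remQuot {p} q k)))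

    code-lift : ∀ k → code (lift k) ≡ k
    code-lift k = let ei , ej = code-rep (proj₁ (remQuot {p} q k)) (proj₂ (remQuot {p} q k)) in
      trans (cong₂ combine ei ej) (Fin.combine-remQuot {p} q k)

    code-cong : ∀ {g h} → g ≈ h → code g ≡ code h
    code-cong e = cong₂ combine (vtx-cong e) (col-cong e)

    code-injective : ∀ g h → code g ≡ code h → g ≈ h
    code-injective g h e = let ei , ej = Fin.combine-injective (vtx g) (col g) (vtx h) (col h) e in code-sound g h ei ej

    tt≈ : ∀ w → (w ++ t) ++ t ≈ w
    tt≈ w = ≈-trans (≈-reflexive (++-assoc w t t)) (≈-trans (++-congˡ w baba) (≈-reflexive (++-identityʳ w)))

    -- Right multiplication by the half-turn, transported to the numbering of normal forms. It is an
    -- involution by `(ba)² = 1`, and its orbits are the left cosets of `⟨ba⟩`.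
    τ : Fin (p * q) → Fin (p * q)
    τ k = code (lift k ++ t)

    τ-code : ∀ w → τ (code w) ≡ code (w ++ t)
    τ-code w = code-cong (++-congʳ t (code-injective _ _ (code-lift (code w))))

    module Pr = Pairs τ (λ k → trans (τ-code (lift k ++ t)) (trans (code-cong (tt≈ (lift k))) (code-lift k)))

  cosets : Cosets C p q
  cosets = record
    { Edge = Pr.Pair ; _≟ᴱ_ = Pr._≟ᴾ_
    ; vtx = vtx ; edge = λ w → Pr.pair (code w) ; fac = fac
    ; vlift = λ v → A (toℕ v) ; elift = λ e → lift (proj₁ e) ; flift = λ f → winv (B (toℕ f))
    ; vtx-lift = vtx-rep
    ; edge-lift = λ e → trans (cong Pr.pair (code-lift (proj₁ e))) (Pr.pair-proj₁ e)
    ; fac-lift = fac-rep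
    ; vtx-sound = vtx-sound ; vtx-complete = vtx-complete
    ; edge-sound = λ g h e → Sum.map (code-injective g h) (λ e' → code-injective g (h ++ t) (trans e' (τ-code h)))
        (Pr.pair-sound (code g) (code h) e)
    ; edge-complete = λ { g h (inj₁ e) → cong Pr.pair (code-cong e)
                        ; g h (inj₂ e) → trans (cong Pr.pair (trans (code-cong e) (sym (τ-code h)))) (Pr.pair-τ (code h)) }
    ; fac-sound = fac-sound ; fac-complete = fac-complete
    ; meet = meet }

module CosetPolyhedron {C : Congruence} {p q : ℕ} (tight : TightPair C p q) (cos : Cosets C p q)
    (p>1 : 1 < p) (q>1 : 1 < q) where
  open TightProperties tight hiding (vtx; fac; vtx-sound; vtx-complete; fac-sound; fac-complete; meet; vtx-cong; fac-cong; vtx-fac-injective)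
  open Cosets cos
  open ≈-Reasoning

  a∉⟨b⟩ : ∀ j → ¬ (a ≈ B j)
  a∉⟨b⟩ j e = <⇒≱ p>1 (∣⇒≤ (proj₁ (indep 1 j e)))

  b∉⟨a⟩ : ∀ i → ¬ (b ≈ A i)
  b∉⟨a⟩ i e = <⇒≱ q>1 (∣⇒≤ (proj₂ (indep i 1 (≈-sym e))))

  t∉⟨a⟩ : ∀ i → ¬ (t ≈ A i)
  t∉⟨a⟩ i e = b∉⟨a⟩ (i + Ā 1) (begin
    b                  ≈⟨ group (a ∷ b ∷ []) v₁ ((v₁ ⊙ v₀) ⊙ v₀ ⁻) refl ⟩
    t ++ winv a        ≈⟨ ++-cong e (winv-A 1) ⟩
    A i ++ A (Ā 1)     ≡⟨ pow-+ g₁ i (Ā 1) ⟨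
    A (i + Ā 1)        ∎)

  t∉⟨b⟩ : ∀ j → ¬ (t ≈ B j)
  t∉⟨b⟩ j e = a∉⟨b⟩ (B̄ 1 + j) (begin
    a                  ≈⟨ group (a ∷ b ∷ []) v₀ (v₁ ⁻ ⊙ v₁ ⊙ v₀) refl ⟩
    winv b ++ t        ≈⟨ ++-cong (winv-B 1) e ⟩
    B (B̄ 1) ++ B j     ≡⟨ pow-+ g₂ (B̄ 1) j ⟨
    B (B̄ 1 + j)        ∎)

  -- Thus `ga` and `gb⁻¹` name the same edge. The first name shows that it lies on the face of `g`,
  -- the second that it contains the vertex of `g`.
  at≈ : ∀ g → (g ++ a) ++ t ≈ g ++ winv b
  at≈ g = begin
    (g ++ a) ++ t                            ≈⟨ group (a ∷ b ∷ g ∷ []) ((v₂ ⊙ v₀) ⊙ (v₁ ⊙ v₀)) (v₂ ⊙ (v₀ ⊙ v₁ ⊙ v₀ ⊙ v₁) ⊙ v₁ ⁻) refl ⟩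
    g ++ (a ++ b ++ a ++ b) ++ winv b        ≈⟨ ≈-ctx g (winv b) abab ⟩
    g ++ winv b                              ∎

  tt≈ : ∀ w → (w ++ t) ++ t ≈ w
  tt≈ w = ≈-trans (≈-reflexive (++-assoc w t t)) (≈-trans (++-congˡ w baba) (≈-reflexive (++-identityʳ w)))

  vtx-cong : ∀ {g h} → g ≈ h → vtx g ≡ vtx h
  vtx-cong {g} {h} e = vtx-complete g h 0 (≈-trans (≈-sym e) (≈-reflexive (sym (++-identityʳ g))))
  fac-cong : ∀ {g h} → g ≈ h → fac g ≡ fac h
  fac-cong {g} {h} e = fac-complete g h 0 (≈-trans (≈-sym e) (≈-reflexive (sym (++-identityʳ g))))
  edge-cong : ∀ {g h} → g ≈ h → edge g ≡ edge h
  edge-cong {g} {h} e = edge-complete g h (inj₁ e)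
  edge-t : ∀ g → edge (g ++ t) ≡ edge g
  edge-t g = edge-complete (g ++ t) g (inj₂ ≈-refl)

  vtx-B : ∀ g j → vtx (g ++ B j) ≡ vtx g
  vtx-B g j = sym (vtx-complete g (g ++ B j) j ≈-refl)
  vtx-b⁻¹ : ∀ g → vtx (g ++ winv b) ≡ vtx g
  vtx-b⁻¹ g = sym (vtx-complete g (g ++ winv b) (B̄ 1) (++-congˡ g (winv-B 1)))
  fac-A : ∀ g i → fac (g ++ A i) ≡ fac g
  fac-A g i = sym (fac-complete g (g ++ A i) i ≈-refl)
  fac-t : ∀ g → fac (g ++ t) ≡ fac (g ++ b)
  fac-t g = trans (cong fac (sym (++-assoc g b a))) (fac-A (g ++ b) 1)
  edge-a : ∀ g → edge (g ++ a) ≡ edge (g ++ winv b)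
  edge-a g = trans (sym (edge-t (g ++ a))) (edge-cong (at≈ g))

  vtx-fac-injective : ∀ g h → vtx g ≡ vtx h → fac g ≡ fac h → g ≈ h
  vtx-fac-injective g h ev ef = powers-meet g h _ _ (proj₂ (fac-sound g h ef)) (proj₂ (vtx-sound g h ev))

  vtx≢t : ∀ g → vtx g ≢ vtx (g ++ t)
  vtx≢t g e = let j , e' = vtx-sound g (g ++ t) e in t∉⟨b⟩ j (++-cancelˡ g e')
  fac≢t : ∀ g → fac g ≢ fac (g ++ t)
  fac≢t g e = let i , e' = fac-sound g (g ++ t) e in t∉⟨a⟩ i (++-cancelˡ g e')
  vtx≢a : ∀ g → vtx g ≢ vtx (g ++ a)
  vtx≢a g e = let j , e' = vtx-sound g (g ++ a) e in a∉⟨b⟩ j (++-cancelˡ g e')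
  fac≢b : ∀ g → fac g ≢ fac (g ++ b)
  fac≢b g e = let i , e' = fac-sound g (g ++ b) e in b∉⟨a⟩ i (++-cancelˡ g e')

  edge≢a : ∀ g → edge g ≢ edge (g ++ a)
  edge≢a g e = cases (edge-sound g (g ++ a) e)
    where
    cases : g ≈ g ++ a ⊎ g ≈ (g ++ a) ++ t → ⊥
    cases (inj₁ e) = vtx≢a g (vtx-cong e)
    cases (inj₂ e) = fac≢b (g ++ winv b) (trans (fac-cong (≈-sym (≈-trans e (at≈ g)))) (fac-cong (group (g ∷ b ∷ []) v₀ ((v₀ ⊙ v₁ ⁻) ⊙ v₁) refl)))

  edge-vtx-injective : ∀ g h → edge g ≡ edge h → vtx g ≡ vtx h → g ≈ h
  edge-vtx-injective g h e v = cases (edge-sound g h e)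
    where
    cases : g ≈ h ⊎ g ≈ h ++ t → g ≈ h
    cases (inj₁ e) = e
    cases (inj₂ e) = contradiction (trans (sym v) (vtx-cong e)) (vtx≢t h)
  edge-fac-injective : ∀ g h → edge g ≡ edge h → fac g ≡ fac h → g ≈ h
  edge-fac-injective g h e f = cases (edge-sound g h e)
    where
    cases : g ≈ h ⊎ g ≈ h ++ t → g ≈ h
    cases (inj₁ e) = e
    cases (inj₂ e) = contradiction (trans (sym f) (fac-cong e)) (fac≢t h)

  OnVE : Fin p → Edge → Set
  OnVE v e = vtx (elift e) ≡ v ⊎ vtx (elift e ++ t) ≡ v
  OnEF : Edge → Fin q → Set
  OnEF e f = fac (elift e) ≡ f ⊎ fac (elift e ++ t) ≡ f

  -- Incidence means that the cosets intersect. An edge coset has just the two elements `elift e`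
  -- and `elift e ++ t`, so this is a finite check.
  veᑫ : Fin p → Edge → Bool
  veᑫ v e = isYes ((vtx (elift e) Fin.≟ v) ⊎-dec (vtx (elift e ++ t) Fin.≟ v))
  efᑫ : Edge → Fin q → Bool
  efᑫ e f = isYes ((fac (elift e) Fin.≟ f) ⊎-dec (fac (elift e ++ t) Fin.≟ f))

  ve-elim : ∀ v e → T (veᑫ v e) → Σ Word λ g → vtx g ≡ v × edge g ≡ e
  ve-elim v e h = cases (toWitness h)
    where
    cases : OnVE v e → _
    cases (inj₁ x) = elift e , x , edge-lift e
    cases (inj₂ x) = elift e ++ t , x , trans (edge-t (elift e)) (edge-lift e)

  ef-elim : ∀ e f → T (efᑫ e f) → Σ Word λ g → edge g ≡ e × fac g ≡ f
  ef-elim e f h = cases (toWitness h)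
    where
    cases : OnEF e f → _
    cases (inj₁ x) = elift e , edge-lift e , x
    cases (inj₂ x) = elift e ++ t , trans (edge-t (elift e)) (edge-lift e) , x

  elift-edge : ∀ g e → edge g ≡ e → g ≈ elift e ⊎ g ≈ elift e ++ t
  elift-edge g e x = edge-sound g (elift e) (trans x (sym (edge-lift e)))

  ve-intro : ∀ g v e → vtx g ≡ v → edge g ≡ e → T (veᑫ v e)
  ve-intro g v e x y = fromWitness (Sum.map (λ z → trans (vtx-cong (≈-sym z)) x) (λ z → trans (vtx-cong (≈-sym z)) x) (elift-edge g e y))

  ef-intro : ∀ g e f → edge g ≡ e → fac g ≡ f → T (efᑫ e f)
  ef-intro g e f y x = fromWitness (Sum.map (λ z → trans (fac-cong (≈-sym z)) x) (λ z → trans (fac-cong (≈-sym z)) x) (elift-edge g e y))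

  edge-vertices : ∀ e → ExactlyTwo (Fin p) (λ v → T (veᑫ v e))
  edge-vertices e = vtx g , vtx (g ++ t) , vtx≢t g , ve-intro g _ e refl (edge-lift e) ,
    ve-intro (g ++ t) _ e refl (trans (edge-t g) (edge-lift e)) , λ c h → Sum.map sym sym (toWitness h)
    where g = elift e

  edge-faces : ∀ e → ExactlyTwo (Fin q) (λ f → T (efᑫ e f))
  edge-faces e = fac g , fac (g ++ t) , fac≢t g , ef-intro g e _ (edge-lift e) refl ,
    ef-intro (g ++ t) e _ (trans (edge-t g) (edge-lift e)) refl , λ c h → Sum.map sym sym (toWitness h)
    where g = elift e

  -- Every vertex is incident with every face, in exactly one element g, and
  -- the two edges between them are those of g and g a.
  two-edges : ∀ g e → T (veᑫ (vtx g) e) → T (efᑫ e (fac g)) → e ≡ edge g ⊎ e ≡ edge (g ++ a)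
  two-edges g e hv hf =
    let h , hv≡ , he≡ = ve-elim (vtx g) e hv
        k , ke≡ , kf≡ = ef-elim e (fac g) hf
    in cases h k hv≡ he≡ kf≡ (edge-sound k h (trans ke≡ (sym he≡)))
    where
    cases : ∀ h k → vtx h ≡ vtx g → edge h ≡ e → fac k ≡ fac g → k ≈ h ⊎ k ≈ h ++ t → e ≡ edge g ⊎ e ≡ edge (g ++ a)
    cases h k hv≡ he≡ kf≡ (inj₁ x) =
      inj₁ (trans (sym he≡) (edge-cong (vtx-fac-injective h g hv≡ (trans (fac-cong (≈-sym x)) kf≡))))
    cases h k hv≡ he≡ kf≡ (inj₂ x) =
      inj₂ (trans (sym he≡) (trans (edge-cong h≈) (sym (edge-a g))))
      where
      -- The edge reaches the face only through `ht`, whose face is that of `hb`. Since `hb` also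
      -- has the vertex of `h`, it shares vertex and face with `g`.
      hb≈g : h ++ b ≈ g
      hb≈g = vtx-fac-injective (h ++ b) g (trans (vtx-B h 1) hv≡) (trans (sym (fac-t h)) (trans (fac-cong (≈-sym x)) kf≡))
      h≈ : h ≈ g ++ winv b
      h≈ = ≈-trans (group (h ∷ b ∷ []) v₀ ((v₀ ⊙ v₁) ⊙ v₁ ⁻) refl) (++-congʳ (winv b) hb≈g)

  ve-a : ∀ g → T (veᑫ (vtx g) (edge (g ++ a)))
  ve-a g = ve-intro (g ++ winv b) _ _ (vtx-b⁻¹ g) (sym (edge-a g))

  diamond : ∀ v f → ExactlyTwo Edge (λ e → T (veᑫ v e) × T (efᑫ e f))
  diamond v f =
    let g , gv , gf = meet v f in
    edge g , edge (g ++ a) , edge≢a g ,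
    (ve-intro g v _ gv refl , ef-intro g _ f refl gf) ,
    (subst (λ z → T (veᑫ z (edge (g ++ a)))) gv (ve-a g) , ef-intro (g ++ a) _ f refl (trans (fac-A g 1) gf)) ,
    λ e (hv , hf) → two-edges g e (subst (λ z → T (veᑫ z e)) (sym gv) hv) (subst (λ z → T (efᑫ e z)) (sym gf) hf)

  -- By `meet` every coset of `⟨b⟩` intersects every coset of `⟨a⟩`, so vertices and faces are
  -- always incident.
  vfᑫ : Fin p → Fin q → Bool
  vfᑫ _ _ = true

  Incᑫ : Elt (Fin p) Edge (Fin q) → Elt (Fin p) Edge (Fin q) → Set
  Incᑫ = Inc veᑫ efᑫ vfᑫ

  Inc-sym : ∀ x y → Incᑫ x y → Incᑫ y x
  Inc-sym (inj₁ _)        (inj₂ (inj₁ _)) h = h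
  Inc-sym (inj₁ _)        (inj₂ (inj₂ _)) h = h
  Inc-sym (inj₂ (inj₁ _)) (inj₁ _)        h = h
  Inc-sym (inj₂ (inj₁ _)) (inj₂ (inj₂ _)) h = h
  Inc-sym (inj₂ (inj₂ _)) (inj₁ _)        h = h
  Inc-sym (inj₂ (inj₂ _)) (inj₂ (inj₁ _)) h = h

  connected : ∀ x y → Star Incᑫ x y
  connected x y = to-base x ◅◅ reverse (λ {x} {y} → Inc-sym x y) (to-base y)
    where
    v→base : ∀ v → Star Incᑫ (inj₁ v) (inj₁ (vtx []))
    v→base v = _◅_ {j = inj₂ (inj₂ (fac []))} tt (_◅_ {j = inj₁ (vtx [])} tt ε)
    to-base : ∀ x → Star Incᑫ x (inj₁ (vtx []))
    to-base (inj₁ v)        = v→base v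
    to-base (inj₂ (inj₁ e)) = _◅_ {j = inj₁ (vtx (elift e))} (ve-intro (elift e) _ e refl (edge-lift e)) (v→base _)
    to-base (inj₂ (inj₂ f)) = _◅_ {j = inj₁ (vtx [])} tt ε

  module _ (v : Fin p) where
    private
      N = Nbr veᑫ efᑫ vfᑫ (inj₁ v)
      _~ᴺ_ : N → N → Set
      c ~ᴺ d = Incᑫ (proj₁ c) (proj₁ d)
      face : Fin q → N
      face f = inj₂ (inj₂ f) , tt
      g₀ = vlift v
      -- Consecutive faces are joined by the edge of `g = g₀bʲ`: it lies on the face of `g`, and on
      -- that of `gt`, which is the face of `g₀bʲ⁺¹`.
      walk : ∀ j → Star _~ᴺ_ (face (fac (g₀ ++ B j))) (face (fac g₀))
      walk zero    = subst (λ z → Star _~ᴺ_ (face z) (face (fac g₀))) (sym (cong fac (++-identityʳ g₀))) ε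
      walk (suc j) = _◅_ {j = inj₂ (inj₁ (edge g)) , ve-intro g v _ (trans (vtx-B g₀ j) (vtx-lift v)) refl}
          (ef-intro (g ++ t) (edge g) _ (edge-t g) (trans (fac-t g) (cong fac suc-j)))
          (_◅_ {j = face (fac g)} (ef-intro g (edge g) (fac g) refl refl) (walk j))
        where
        g = g₀ ++ B j
        suc-j : (g₀ ++ B j) ++ b ≡ g₀ ++ B (suc j)
        suc-j = trans (++-assoc g₀ (B j) b) (cong (g₀ ++_) (pow-comm g₂ j 1))
      face→base : ∀ f → Star _~ᴺ_ (face f) (face (fac g₀))
      face→base f =
        let g , gv , gf = meet v f
            j , e = vtx-sound g₀ g (trans (vtx-lift v) (sym gv))
        in subst (λ z → Star _~ᴺ_ (face z) (face (fac g₀))) (trans (fac-cong (≈-sym e)) gf) (walk j)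
      to-base : ∀ c → Star _~ᴺ_ c (face (fac g₀))
      to-base (inj₂ (inj₁ e) , h) =
        let g , _ , ge = ve-elim v e h in _◅_ {j = face (fac g)} (ef-intro g e (fac g) ge refl) (face→base (fac g))
      to-base (inj₂ (inj₂ f) , _) = face→base f

    vertex-nbr-connected : NbrConnected veᑫ efᑫ vfᑫ (inj₁ v)
    vertex-nbr-connected c d = to-base c ◅◅ reverse (λ {x} {y} → Inc-sym (proj₁ x) (proj₁ y)) (to-base d)

  module _ (f : Fin q) where
    private
      N = Nbr veᑫ efᑫ vfᑫ (inj₂ (inj₂ f))
      _~ᴺ_ : N → N → Set
      c ~ᴺ d = Incᑫ (proj₁ c) (proj₁ d)
      vertex : Fin p → N
      vertex v = inj₁ v , tt
      g₀ = flift f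
      walk : ∀ i → Star _~ᴺ_ (vertex (vtx (g₀ ++ A i))) (vertex (vtx g₀))
      walk zero    = subst (λ z → Star _~ᴺ_ (vertex z) (vertex (vtx g₀))) (sym (cong vtx (++-identityʳ g₀))) ε
      walk (suc i) = _◅_ {j = inj₂ (inj₁ (edge (g ++ a))) , ef-intro (g ++ a) _ f refl (trans (fac-A g 1) (trans (fac-A g₀ i) (fac-lift f)))}
          (ve-intro (g ++ a) _ (edge (g ++ a)) (cong vtx suc-i) refl)
          (_◅_ {j = vertex (vtx g)} (ve-a g) (walk i))
        where
        g = g₀ ++ A i
        suc-i : (g₀ ++ A i) ++ a ≡ g₀ ++ A (suc i)
        suc-i = trans (++-assoc g₀ (A i) a) (cong (g₀ ++_) (pow-comm g₁ i 1))
      vertex→base : ∀ v → Star _~ᴺ_ (vertex v) (vertex (vtx g₀))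
      vertex→base v =
        let g , gv , gf = meet v f
            i , e = fac-sound g₀ g (trans (fac-lift f) (sym gf))
        in subst (λ z → Star _~ᴺ_ (vertex z) (vertex (vtx g₀))) (trans (vtx-cong (≈-sym e)) gv) (walk i)
      to-base : ∀ c → Star _~ᴺ_ c (vertex (vtx g₀))
      to-base (inj₂ (inj₁ e) , h) =
        let g , ge , _ = ef-elim e f h in _◅_ {j = vertex (vtx g)} (ve-intro g (vtx g) e refl ge) (vertex→base (vtx g))
      to-base (inj₁ v , _) = vertex→base v

    face-nbr-connected : NbrConnected veᑫ efᑫ vfᑫ (inj₂ (inj₂ f))
    face-nbr-connected c d = to-base c ◅◅ reverse (λ {x} {y} → Inc-sym (proj₁ x) (proj₁ y)) (to-base d)

  polyhedron : Polyhedron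
  polyhedron = record
    { V = Fin p ; E = Edge ; F = Fin q ; ve = veᑫ ; ef = efᑫ ; vf = vfᑫ
    ; ve-ef-trans = λ _ _ _ _ _ → tt
    ; edge-vertices = edge-vertices
    ; edge-faces = edge-faces
    ; diamond = λ v f _ → diamond v f
    ; connected = connected
    ; vertex-nbr-connected = vertex-nbr-connected
    ; face-nbr-connected = face-nbr-connected }

isYes-true : ∀ {X : Set} (d : Dec X) → X → isYes d ≡ true
isYes-true (yes _) _ = refl
isYes-true (no ¬x) x = contradiction x ¬x

isYes-false : ∀ {X : Set} (d : Dec X) → ¬ X → isYes d ≡ false
isYes-false (yes x) ¬x = contradiction x ¬x
isYes-false (no _)  _  = refl

-- Colouring, type, tightness and rotations of the coset polyhedron

module CosetPolyhedronProperties {C : Congruence} {p q : ℕ} (tight : TightPair C p q) (cos : Cosets C p q)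
    (p>1 : 1 < p) (q>1 : 1 < q) where
  open TightProperties tight hiding (vtx; fac; vtx-sound; vtx-complete; fac-sound; fac-complete; meet; vtx-cong; fac-cong; vtx-fac-injective)
  open Cosets cos
  open CosetPolyhedron tight cos p>1 q>1
  open Flag
  open Aut

  Q : Polyhedron
  Q = polyhedron

  -- The flag `black g` is 1-adjacent to `white g`; in both, `g` is the only group element common to
  -- the vertex and the face.
  white black : Word → Flag Q
  white g = flag (vtx g) (edge g) (fac g) (ve-intro g _ _ refl refl) (ef-intro g _ _ refl refl)
  black g = flag (vtx g) (edge (g ++ a)) (fac g) (ve-a g) (ef-intro (g ++ a) _ _ refl (fac-A g 1))

  white-cong : ∀ {g h} → g ≈ h → white g ≡ white h
  white-cong e = Flags.flag-≡ Q (vtx-cong e) (edge-cong e) (fac-cong e)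
  black-cong : ∀ {g h} → g ≈ h → black g ≡ black h
  black-cong e = Flags.flag-≡ Q (vtx-cong e) (edge-cong (++-congʳ a e)) (fac-cong e)

  white≢black : ∀ g h → white g ≢ black h
  white≢black g h e = edge≢a h (trans (edge-cong (≈-sym (vtx-fac-injective g h (cong fv e) (cong ff e)))) (cong fe e))

  classify : ∀ Φ → Σ Word λ g → Φ ≡ white g ⊎ Φ ≡ black g
  classify (flag v e f hv hf) =
    let g , gv , gf = meet v f in
    g , cases g gv gf (two-edges g e (subst (λ z → T (veᑫ z e)) (sym gv) hv) (subst (λ z → T (efᑫ e z)) (sym gf) hf))
    where
    cases : ∀ g → vtx g ≡ v → fac g ≡ f → e ≡ edge g ⊎ e ≡ edge (g ++ a) → flag v e f hv hf ≡ white g ⊎ flag v e f hv hf ≡ black g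
    cases g gv gf (inj₁ x) = inj₁ (Flags.flag-≡ Q (sym gv) x (sym gf))
    cases g gv gf (inj₂ x) = inj₂ (Flags.flag-≡ Q (sym gv) x (sym gf))

  -- Vertex and face determine a group element, whose own edge belongs to the white flag. Comparing
  -- edges therefore decides the colour.
  colour : Flag Q → Bool
  colour Φ = isYes (edge (proj₁ (meet (fv Φ) (ff Φ))) ≟ᴱ fe Φ)

  private
    meet≈ : ∀ g → proj₁ (meet (vtx g) (fac g)) ≈ g
    meet≈ g = vtx-fac-injective _ g (proj₁ (proj₂ (meet (vtx g) (fac g)))) (proj₂ (proj₂ (meet (vtx g) (fac g))))

  colour-white : ∀ g → colour (white g) ≡ true
  colour-white g = isYes-true (_ ≟ᴱ _) (edge-cong (meet≈ g))

  colour-black : ∀ g → colour (black g) ≡ false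
  colour-black g = isYes-false (_ ≟ᴱ _) λ e → edge≢a g (trans (edge-cong (≈-sym (meet≈ g))) e)

  Adj : Flag Q → Flag Q → Set
  Adj Φ Ψ = Adj₀ Q Φ Ψ ⊎ Adj₁ Q Φ Ψ ⊎ Adj₂ Q Φ Ψ

  -- Any two of the three cosets of `g` determine `g`, so white flags agreeing in two entries agree
  -- in the third.
  white-nonadjacent : ∀ g h → ¬ Adj (white g) (white h)
  white-nonadjacent g h (inj₁ (v≢ , e , f))        = v≢ (vtx-cong (edge-fac-injective g h e f))
  white-nonadjacent g h (inj₂ (inj₁ (v , e≢ , f))) = e≢ (edge-cong (vtx-fac-injective g h v f))
  white-nonadjacent g h (inj₂ (inj₂ (v , e , f≢))) = f≢ (fac-cong (edge-vtx-injective g h e v))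

  -- The edge of `black g` has to be read as that of `ga` in combination with the face, and as that
  -- of `gb⁻¹` in combination with the vertex.
  black-nonadjacent : ∀ g h → ¬ Adj (black g) (black h)
  black-nonadjacent g h (inj₁ (v≢ , e , f)) = v≢ (vtx-cong (++-cancelʳ a
    (edge-fac-injective (g ++ a) (h ++ a) e (trans (fac-A g 1) (trans f (sym (fac-A h 1)))))))
  black-nonadjacent g h (inj₂ (inj₁ (v , e≢ , f))) = e≢ (edge-cong (++-congʳ a (vtx-fac-injective g h v f)))
  black-nonadjacent g h (inj₂ (inj₂ (v , e , f≢))) = f≢ (fac-cong (++-cancelʳ (winv b)
    (edge-vtx-injective (g ++ winv b) (h ++ winv b) (trans (sym (edge-a g)) (trans e (edge-a h)))
      (trans (vtx-b⁻¹ g) (trans v (sym (vtx-b⁻¹ h)))))))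

  colour-adjacent : ∀ Φ Ψ → Adj Φ Ψ → colour Φ ≢ colour Ψ
  colour-adjacent Φ Ψ adj eq = cases Φ Ψ adj eq (classify Φ) (classify Ψ)
    where
    cases : ∀ Φ Ψ → Adj Φ Ψ → colour Φ ≡ colour Ψ →
      (Σ Word λ g → Φ ≡ white g ⊎ Φ ≡ black g) → (Σ Word λ h → Ψ ≡ white h ⊎ Ψ ≡ black h) → ⊥
    cases _ _ adj eq (g , inj₁ refl) (h , inj₁ refl) = white-nonadjacent g h adj
    cases _ _ adj eq (g , inj₂ refl) (h , inj₂ refl) = black-nonadjacent g h adj
    cases _ _ adj eq (g , inj₁ refl) (h , inj₂ refl) = contradiction (trans (sym (colour-white g)) (trans eq (colour-black h))) λ ()
    cases _ _ adj eq (g , inj₂ refl) (h , inj₁ refl) = contradiction (trans (sym (colour-black g)) (trans eq (colour-white h))) λ ()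

  module _ (s : Word) where

    actV : Fin p → Fin p
    actV v = vtx (s ++ vlift v)
    actE : Edge → Edge
    actE e = edge (s ++ elift e)
    actF : Fin q → Fin q
    actF f = fac (s ++ flift f)

    actV-vtx : ∀ g → actV (vtx g) ≡ vtx (s ++ g)
    actV-vtx g = let j , e = vtx-sound (vlift (vtx g)) g (vtx-lift (vtx g)) in
      vtx-complete _ _ j (≈-trans (++-congˡ s e) (≈-reflexive (sym (++-assoc s _ (B j)))))
    actE-edge : ∀ g → actE (edge g) ≡ edge (s ++ g)
    actE-edge g = edge-complete _ _ (Sum.map (++-congˡ s)
      (λ e → ≈-trans (++-congˡ s e) (≈-reflexive (sym (++-assoc s g t)))) (edge-sound _ g (edge-lift (edge g))))
    actF-fac : ∀ g → actF (fac g) ≡ fac (s ++ g)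
    actF-fac g = let i , e = fac-sound (flift (fac g)) g (fac-lift (fac g)) in
      fac-complete _ _ i (≈-trans (++-congˡ s e) (≈-reflexive (sym (++-assoc s _ (A i)))))

    act-ve : ∀ v e → T (veᑫ v e) → T (veᑫ (actV v) (actE e))
    act-ve v e h = let g , gv , ge = ve-elim v e h in
      ve-intro (s ++ g) _ _ (trans (sym (actV-vtx g)) (cong actV gv)) (trans (sym (actE-edge g)) (cong actE ge))
    act-ef : ∀ e f → T (efᑫ e f) → T (efᑫ (actE e) (actF f))
    act-ef e f h = let g , ge , gf = ef-elim e f h in
      ef-intro (s ++ g) _ _ (trans (sym (actE-edge g)) (cong actE ge)) (trans (sym (actF-fac g)) (cong actF gf))

  actV-inverse : ∀ s s' → s ++ s' ≈ [] → ∀ v → actV s (actV s' v) ≡ v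
  actV-inverse s s' e v = trans (actV-vtx s (s' ++ vlift v)) (trans (vtx-cong
    (≈-trans (≈-reflexive (sym (++-assoc s s' (vlift v)))) (++-congʳ (vlift v) e))) (vtx-lift v))
  actE-inverse : ∀ s s' → s ++ s' ≈ [] → ∀ x → actE s (actE s' x) ≡ x
  actE-inverse s s' e x = trans (actE-edge s (s' ++ elift x)) (trans (edge-cong
    (≈-trans (≈-reflexive (sym (++-assoc s s' (elift x)))) (++-congʳ (elift x) e))) (edge-lift x))
  actF-inverse : ∀ s s' → s ++ s' ≈ [] → ∀ f → actF s (actF s' f) ≡ f
  actF-inverse s s' e f = trans (actF-fac s (s' ++ flift f)) (trans (fac-cong
    (≈-trans (≈-reflexive (sym (++-assoc s s' (flift f)))) (++-congʳ (flift f) e))) (fac-lift f))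

  translate : Word → Aut Q
  translate s = record
    { fV = actV s ; gV = actV s⁻¹ ; fE = actE s ; gE = actE s⁻¹ ; fF = actF s ; gF = actF s⁻¹
    ; fgV = actV-inverse s s⁻¹ (inverseʳ s) ; gfV = actV-inverse s⁻¹ s (inverseˡ s)
    ; fgE = actE-inverse s s⁻¹ (inverseʳ s) ; gfE = actE-inverse s⁻¹ s (inverseˡ s)
    ; fgF = actF-inverse s s⁻¹ (inverseʳ s) ; gfF = actF-inverse s⁻¹ s (inverseˡ s)
    ; pres-ve = λ v e → T-ext
        (λ h → subst₂ (λ x y → T (veᑫ x y)) (actV-inverse s⁻¹ s (inverseˡ s) v) (actE-inverse s⁻¹ s (inverseˡ s) e) (act-ve s⁻¹ _ _ h))
        (act-ve s v e)
    ; pres-ef = λ e f → T-ext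
        (λ h → subst₂ (λ x y → T (efᑫ x y)) (actE-inverse s⁻¹ s (inverseˡ s) e) (actF-inverse s⁻¹ s (inverseˡ s) f) (act-ef s⁻¹ _ _ h))
        (act-ef s e f)
    ; pres-vf = λ _ _ → refl }
    where s⁻¹ = winv s

  translate-white : ∀ s g h → s ++ g ≈ h → _≐_ Q (act Q (translate s) (white g)) (white h)
  translate-white s g h e = trans (actV-vtx s g) (vtx-cong e) , trans (actE-edge s g) (edge-cong e) , trans (actF-fac s g) (fac-cong e)

  translate-black : ∀ s g h → s ++ g ≈ h → _≐_ Q (act Q (translate s) (black g)) (black h)
  translate-black s g h e = trans (actV-vtx s g) (vtx-cong e) ,
    trans (actE-edge s (g ++ a)) (edge-cong (≈-trans (≈-reflexive (sym (++-assoc s g a))) (++-congʳ a e))) ,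
    trans (actF-fac s g) (fac-cong e)

  colour-transitive : ∀ Φ Ψ → colour Φ ≡ colour Ψ → Σ (Aut Q) λ γ → _≐_ Q (act Q γ Φ) Ψ
  colour-transitive Φ Ψ eq = cases Φ Ψ eq (classify Φ) (classify Ψ)
    where
    to : ∀ g h → (h ++ winv g) ++ g ≈ h
    to g h = group (g ∷ h ∷ []) ((v₁ ⊙ v₀ ⁻) ⊙ v₀) v₁ refl
    cases : ∀ Φ Ψ → colour Φ ≡ colour Ψ → (Σ Word λ g → Φ ≡ white g ⊎ Φ ≡ black g) →
      (Σ Word λ h → Ψ ≡ white h ⊎ Ψ ≡ black h) → Σ (Aut Q) λ γ → _≐_ Q (act Q γ Φ) Ψ
    cases _ _ eq (g , inj₁ refl) (h , inj₁ refl) = translate (h ++ winv g) , translate-white (h ++ winv g) g h (to g h)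
    cases _ _ eq (g , inj₂ refl) (h , inj₂ refl) = translate (h ++ winv g) , translate-black (h ++ winv g) g h (to g h)
    cases _ _ eq (g , inj₁ refl) (h , inj₂ refl) = contradiction (trans (sym (colour-white g)) (trans eq (colour-black h))) λ ()
    cases _ _ eq (g , inj₂ refl) (h , inj₁ refl) = contradiction (trans (sym (colour-black g)) (trans eq (colour-white h))) λ ()

  private
    toℕ-mod : ∀ {n} {{_ : NonZero n}} k → toℕ (k mod n) ≡ k % n
    toℕ-mod {n} k = Fin.toℕ-fromℕ< (m%n<n k n)

    A-mod : ∀ k → A (toℕ (k mod p)) ≈ A k
    A-mod k = ≈-trans (≈-reflexive (cong A (toℕ-mod k))) (≈-sym (pow-% C g₁ a-order k))
    B-mod : ∀ k → B (toℕ (k mod q)) ≈ B k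
    B-mod k = ≈-trans (≈-reflexive (cong B (toℕ-mod k))) (≈-sym (pow-% C g₂ b-order k))

    AB-injective : ∀ (i i' : Fin p) (j j' : Fin q) → A (toℕ i) ++ B (toℕ j) ≈ A (toℕ i') ++ B (toℕ j') → i ≡ i' × j ≡ j'
    AB-injective i i' j j' e =
      let ei , ej = unique (toℕ i) (toℕ j) (toℕ i') (toℕ j') e in small i i' ei , small j j' ej
      where
      small : ∀ {n} {{_ : NonZero n}} (i i' : Fin n) → toℕ i % n ≡ toℕ i' % n → i ≡ i'
      small i i' e = Fin.toℕ-injective (trans (sym (m<n⇒m%n≡m (Fin.toℕ<n i))) (trans e (m<n⇒m%n≡m (Fin.toℕ<n i'))))

    zeroF : Fin q
    zeroF = 0 mod q
    zeroV : Fin p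
    zeroV = 0 mod p

    Σ-≡ : (τ : Edge → Bool) {x y : Σ Edge λ e → T (τ e)} → proj₁ x ≡ proj₁ y → x ≡ y
    Σ-≡ τ {x , h} {_ , h'} refl = cong (x ,_) (T-irrelevant h h')

  face-edges : ∀ f → Fin p ↔ (Σ Edge λ e → T (efᑫ e f))
  face-edges f = bijection to inj surj
    where
    F₀ = flift f
    on : ∀ i → fac (F₀ ++ A i) ≡ f
    on i = trans (fac-A F₀ i) (fac-lift f)
    to : Fin p → Σ Edge λ e → T (efᑫ e f)
    to i = edge (F₀ ++ A (toℕ i)) , ef-intro (F₀ ++ A (toℕ i)) _ f refl (on (toℕ i))
    inj : ∀ i j → to i ≡ to j → i ≡ j
    inj i j e = proj₁ (AB-injective i j zeroF zeroF (++-congʳ (B (toℕ zeroF)) (++-cancelˡ F₀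
      (edge-fac-injective _ _ (cong proj₁ e) (trans (on (toℕ i)) (sym (on (toℕ j))))))))
    surj : ∀ x → ∃[ i ] to i ≡ x
    surj (e , h) =
      let g , ge , gf = ef-elim e f h
          k , g≈ = fac-sound F₀ g (trans (fac-lift f) (sym gf))
      in k mod p , Σ-≡ (λ e → efᑫ e f) (trans (edge-cong (≈-trans (++-congˡ F₀ (A-mod k)) (≈-sym g≈))) ge)

  vertex-edges : ∀ v → Fin q ↔ (Σ Edge λ e → T (veᑫ v e))
  vertex-edges v = bijection to inj surj
    where
    V₀ = vlift v
    on : ∀ j → vtx (V₀ ++ B j) ≡ v
    on j = trans (vtx-B V₀ j) (vtx-lift v)
    to : Fin q → Σ Edge λ e → T (veᑫ v e)
    to j = edge (V₀ ++ B (toℕ j)) , ve-intro (V₀ ++ B (toℕ j)) v _ (on (toℕ j)) refl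
    inj : ∀ i j → to i ≡ to j → i ≡ j
    inj i j e = proj₂ (AB-injective zeroV zeroV i j (++-congˡ (A (toℕ zeroV)) (++-cancelˡ V₀
      (edge-vtx-injective _ _ (cong proj₁ e) (trans (on (toℕ i)) (sym (on (toℕ j))))))))
    surj : ∀ x → ∃[ i ] to i ≡ x
    surj (e , h) =
      let g , gv , ge = ve-elim v e h
          k , g≈ = vtx-sound V₀ g (trans (vtx-lift v) (sym gv))
      in k mod q , Σ-≡ (veᑫ v) (trans (edge-cong (≈-trans (++-congˡ V₀ (B-mod k)) (≈-sym g≈))) ge)

  Q-type : HasType Q p q
  Q-type = face-edges , vertex-edges

  Q-tight : Tight Q p q
  Q-tight = bijection (λ n → enum (triple p q n)) (λ n n' e → triple-injective p q n n' (enum-injective _ _ e))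
      (λ Φ → let x , e = enum-surjective Φ ; n , e' = triple-surjective p q x in n , trans (cong enum e') e)
    where
    word : Fin p → Fin q → Word
    word i j = A (toℕ i) ++ B (toℕ j)
    enum : Fin 2 × Fin p × Fin q → Flag Q
    enum (zero , i , j)     = white (word i j)
    enum (suc zero , i , j) = black (word i j)
    same-word : ∀ i j i' j' (k : Fin 2) → vtx (word i j) ≡ vtx (word i' j') → fac (word i j) ≡ fac (word i' j') → (k , i , j) ≡ (k , i' , j')
    same-word i j i' j' k ev ef =
      let ei , ej = AB-injective i i' j j' (vtx-fac-injective _ _ ev ef) in cong₂ (λ x y → k , x , y) ei ej
    enum-injective : ∀ x y → enum x ≡ enum y → x ≡ y
    enum-injective (zero , i , j)     (zero , i' , j')     e = same-word i j i' j' zero (cong fv e) (cong ff e)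
    enum-injective (zero , i , j)     (suc zero , i' , j') e = contradiction e (white≢black (word i j) (word i' j'))
    enum-injective (suc zero , i , j) (zero , i' , j')     e = contradiction (sym e) (white≢black (word i' j') (word i j))
    enum-injective (suc zero , i , j) (suc zero , i' , j') e = same-word i j i' j' (suc zero) (cong fv e) (cong ff e)
    reduce : ∀ g → Σ (Fin p) λ i → Σ (Fin q) λ j → word i j ≈ g
    reduce g = let i , j , e = factor g in i mod p , j mod q , ≈-trans (++-cong (A-mod i) (B-mod j)) (≈-sym e)
    enum-surjective : ∀ Φ → ∃[ x ] enum x ≡ Φ
    enum-surjective Φ = cases Φ (classify Φ)
      where
      cases : ∀ Φ → (Σ Word λ g → Φ ≡ white g ⊎ Φ ≡ black g) → ∃[ x ] enum x ≡ Φ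
      cases _ (g , inj₁ refl) = let i , j , e = reduce g in (zero , i , j) , white-cong e
      cases _ (g , inj₂ refl) = let i , j , e = reduce g in (suc zero , i , j) , black-cong e

  Φ₀ : Flag Q
  Φ₀ = white []

  rotations : Rotations Q Φ₀
  rotations = record
    { σ₁ = translate a ; σ₂ = translate b
    ; σ₁-spec = black [] , (refl , edge≢a [] , refl) ,
        ((λ e → vtx≢a [] (trans e (actV-vtx a []))) , sym (actE-edge a []) , trans (sym (fac-A [] 1)) (sym (actF-fac a [])))
    ; σ₂-spec = flag (vtx []) (edge []) (fac b) (ve-intro [] _ _ refl refl) (ef-intro t _ _ (edge-t []) (fac-t [])) ,
        (refl , refl , fac≢b []) ,
        (trans (sym (vtx-B [] 1)) (sym (actV-vtx b [])) ,
         (λ e → edge≢b (trans e (actE-edge b []))) , sym (actF-fac b [])) }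
    where
    edge≢b : edge [] ≢ edge b
    edge≢b e = edge≢a b (trans (sym e) (trans (edge-cong (≈-sym (inverseʳ b))) (sym (edge-a b))))

  evV-vtx : ∀ w g → evV Q rotations w (vtx g) ≡ vtx (w ++ g)
  evV-vtx [] g = refl
  evV-vtx ((g₁ , true)  ∷ w) g = trans (cong (actV a) (evV-vtx w g)) (actV-vtx a (w ++ g))
  evV-vtx ((g₁ , false) ∷ w) g = trans (cong (actV (winv a)) (evV-vtx w g)) (actV-vtx (winv a) (w ++ g))
  evV-vtx ((g₂ , true)  ∷ w) g = trans (cong (actV b) (evV-vtx w g)) (actV-vtx b (w ++ g))
  evV-vtx ((g₂ , false) ∷ w) g = trans (cong (actV (winv b)) (evV-vtx w g)) (actV-vtx (winv b) (w ++ g))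

  evE-edge : ∀ w g → evE Q rotations w (edge g) ≡ edge (w ++ g)
  evE-edge [] g = refl
  evE-edge ((g₁ , true)  ∷ w) g = trans (cong (actE a) (evE-edge w g)) (actE-edge a (w ++ g))
  evE-edge ((g₁ , false) ∷ w) g = trans (cong (actE (winv a)) (evE-edge w g)) (actE-edge (winv a) (w ++ g))
  evE-edge ((g₂ , true)  ∷ w) g = trans (cong (actE b) (evE-edge w g)) (actE-edge b (w ++ g))
  evE-edge ((g₂ , false) ∷ w) g = trans (cong (actE (winv b)) (evE-edge w g)) (actE-edge (winv b) (w ++ g))

  evF-fac : ∀ w g → evF Q rotations w (fac g) ≡ fac (w ++ g)
  evF-fac [] g = refl
  evF-fac ((g₁ , true)  ∷ w) g = trans (cong (actF a) (evF-fac w g)) (actF-fac a (w ++ g))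
  evF-fac ((g₁ , false) ∷ w) g = trans (cong (actF (winv a)) (evF-fac w g)) (actF-fac (winv a) (w ++ g))
  evF-fac ((g₂ , true)  ∷ w) g = trans (cong (actF b) (evF-fac w g)) (actF-fac b (w ++ g))
  evF-fac ((g₂ , false) ∷ w) g = trans (cong (actF (winv b)) (evF-fac w g)) (actF-fac (winv b) (w ++ g))

  ≈⇒SameIn : ∀ u w → u ≈ w → SameIn Q rotations u w
  ≈⇒SameIn u w e =
    (λ v → subst (λ z → evV Q rotations u z ≡ evV Q rotations w z) (vtx-lift v)
      (trans (evV-vtx u _) (trans (vtx-cong (++-congʳ (vlift v) e)) (sym (evV-vtx w _))))) ,
    (λ x → subst (λ z → evE Q rotations u z ≡ evE Q rotations w z) (edge-lift x)
      (trans (evE-edge u _) (trans (edge-cong (++-congʳ (elift x) e)) (sym (evE-edge w _))))) ,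
    (λ f → subst (λ z → evF Q rotations u z ≡ evF Q rotations w z) (fac-lift f)
      (trans (evF-fac u _) (trans (fac-cong (++-congʳ (flift f) e)) (sym (evF-fac w _)))))

  SameIn⇒≈ : ∀ u w → SameIn Q rotations u w → u ≈ w
  SameIn⇒≈ u w (sv , _ , sf) = ++-cancelʳ [] (vtx-fac-injective (u ++ []) (w ++ [])
    (trans (sym (evV-vtx u [])) (trans (sv (vtx [])) (evV-vtx w [])))
    (trans (sym (evF-fac u [])) (trans (sf (fac [])) (evF-fac w []))))

  -- An automorphism taking the base flag to its 1-adjacent flag inverts both rotations under
  -- conjugation, and the relations between the rotations of `Q` are exactly those of `C`. The
  -- contrapositive supplies the failure of transitivity in `Q-chiral`.
  regular⇒barInvariant : (∀ Φ Ψ → Σ (Aut Q) λ γ → _≐_ Q (act Q γ Φ) Ψ) → BarInvariant C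
  regular⇒barInvariant regular u w e =
    let γ , v , x , f = regular Φ₀ (r₁ Φ₀) in
    SameIn⇒≈ (bar u) (bar w) (_≋_.sameIn (reflection⇒barInvariant γ (flag-≡ v x f) u w (same (≈⇒SameIn u w e))))
    where open WordAction Q rotations

  Q-chiral : ¬ BarInvariant C → IsChiral Q
  Q-chiral ¬invariant = colour , colour-adjacent , colour-transitive , λ regular → ¬invariant (regular⇒barInvariant regular)

-- Atomic chiral polyhedra

module _ (C : Congruence) where
  open CongruenceProperties C
  open ≈-Reasoning

  -- Powers of `a` commute with `a`, so commuting with `b` makes `A n` central, and its powers cross
  -- each word with unchanged exponent.
  A-central : ∀ n → b ++ A n ≈ A n ++ b → Normal C g₁ n
  A-central n comm i w = i , commutes w
    where
    x = A (n * i)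
    b-x : b ++ x ≈ x ++ b
    b-x = subst (λ z → b ++ A z ≈ A z ++ b) (trans (*-identityʳ (i * n)) (*-comm i n))
      (subst (λ z → b ++ A z ≈ A z ++ b) (trans (*-identityˡ (i * n)) (sym (*-identityʳ (i * n))))
        (ExponentGroup.closed-* (commuting-exponents C g₁ 1 b) i n (subst (λ z → b ++ A z ≈ A z ++ b) (sym (*-identityˡ n)) comm)))
    letter-inverse : ∀ y → y ++ x ≈ x ++ y → x ++ winv y ≈ winv y ++ x
    letter-inverse y e = begin
      x ++ winv y                              ≈⟨ group (x ∷ y ∷ []) (v₀ ⊙ v₁ ⁻) (v₁ ⁻ ⊙ (v₁ ⊙ v₀) ⊙ v₁ ⁻) refl ⟩
      winv y ++ (y ++ x) ++ winv y             ≈⟨ ≈-ctx (winv y) (winv y) e ⟩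
      winv y ++ (x ++ y) ++ winv y             ≈⟨ group (x ∷ y ∷ []) (v₁ ⁻ ⊙ (v₀ ⊙ v₁) ⊙ v₁ ⁻) (v₁ ⁻ ⊙ v₀) refl ⟩
      winv y ++ x                              ∎
    a-x : a ++ x ≈ x ++ a
    a-x = ≈-reflexive (pow-comm g₁ 1 (n * i))
    letter : ∀ y → x ++ y ∷ [] ≈ y ∷ x
    letter (g₁ , true)  = ≈-sym a-x
    letter (g₁ , false) = letter-inverse a a-x
    letter (g₂ , true)  = ≈-sym b-x
    letter (g₂ , false) = letter-inverse b b-x
    commutes : ∀ w → x ++ w ≈ w ++ x
    commutes []      = ≈-reflexive (++-identityʳ x)
    commutes (y ∷ w) = begin
      x ++ y ∷ w               ≡⟨ ++-assoc x (y ∷ []) w ⟨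
      (x ++ y ∷ []) ++ w       ≈⟨ ++-congʳ w (letter y) ⟩
      y ∷ x ++ w               ≈⟨ ++-congˡ (y ∷ []) (commutes w) ⟩
      y ∷ w ++ x               ∎

module _ {C : Congruence} {p q : ℕ} (tight : TightPair C p q) (e : ℕ) where
  open TightProperties tight
  open ≈-Reasoning

  module _ (twist : b ++ A 2 ≈ A 2 ++ b ++ B e) (q∣e² : q ∣ e * e) where

    -- Moving `a²` across a power of `b` multiplies the exponent by `1 + e`. For the exponent `e`
    -- the increase is `e * e`, a multiple of the order of `b`.
    twist-central : A 2 ++ B e ≈ B e ++ A 2
    twist-central = ≈-sym (begin
      B e ++ A 2                  ≈⟨ twist-power C (1 + e) twist e ⟩
      A 2 ++ B (e * (1 + e))      ≡⟨ cong (λ z → A 2 ++ B z) (*-suc e e) ⟩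
      A 2 ++ B (e + e * e)        ≡⟨ cong (A 2 ++_) (pow-+ g₂ e (e * e)) ⟩
      A 2 ++ B e ++ B (e * e)     ≈⟨ ++-congˡ (A 2) (++-congˡ (B e) (pow-∣ C g₂ b-order q∣e²)) ⟩
      A 2 ++ B e ++ []            ≡⟨ cong (A 2 ++_) (++-identityʳ (B e)) ⟩
      A 2 ++ B e                  ∎)

    -- Each `a²` that passes `b` leaves one factor `B e`, and these factors can be collected on the
    -- right because they commute with `a²` and `b`.
    b-A²ˡ : ∀ l → b ++ A (2 * l) ≈ A (2 * l) ++ b ++ B (l * e)
    b-A²ˡ zero    = ≈-refl
    b-A²ˡ (suc l) = begin
      b ++ A (2 * suc l)                              ≡⟨ cong (b ++_) split ⟩
      b ++ A 2 ++ x                                   ≈⟨ ++-congʳ x twist ⟩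
      (A 2 ++ b ++ B e) ++ x                          ≈⟨ group (A 2 ∷ b ∷ B e ∷ x ∷ []) ((v₀ ⊙ v₁ ⊙ v₂) ⊙ v₃) (v₀ ⊙ v₁ ⊙ v₂ ⊙ v₃) refl ⟩
      A 2 ++ b ++ B e ++ x                            ≈⟨ ++-congˡ (A 2) (++-congˡ b B-x) ⟩
      A 2 ++ b ++ x ++ B e                            ≈⟨ ++-congˡ (A 2) (++-congʳ (B e) (b-A²ˡ l)) ⟩
      A 2 ++ (x ++ b ++ B (l * e)) ++ B e             ≈⟨ group (A 2 ∷ x ∷ (b ++ B (l * e)) ∷ B e ∷ []) (v₀ ⊙ (v₁ ⊙ v₂) ⊙ v₃) ((v₀ ⊙ v₁) ⊙ v₂ ⊙ v₃) refl ⟩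
      (A 2 ++ x) ++ b ++ B (l * e) ++ B e             ≡⟨ cong₂ (λ y z → y ++ b ++ z) (sym split) (trans (pow-comm g₂ (l * e) e) (sym (pow-+ g₂ e (l * e)))) ⟩
      A (2 * suc l) ++ b ++ B (e + l * e)             ∎
      where
      x = A (2 * l)
      split : A (2 * suc l) ≡ A 2 ++ x
      split = trans (cong A (*-suc 2 l)) (pow-+ g₁ 2 (2 * l))
      B-x : B e ++ x ≈ x ++ B e
      B-x = subst (λ z → B e ++ A (2 * z) ≈ A (2 * z) ++ B e) (*-identityʳ l)
        (ExponentGroup.closed-* (commuting-exponents C g₁ 2 (B e)) l 1 (≈-sym twist-central))

  twist-Holds : b ++ A 2 ≈ A 2 ++ b ++ B e → A 2 ++ B e ≈ B e ++ A 2 →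
    Holds C (ΓRels p q (+ 3) (+ (1 + e)) (ℤ.- (+ 3)) (-[1+ 0 ] ℤ.+ + e))
  twist-Holds twist A²z (here refl) = a-order
  twist-Holds twist A²z (there (here refl)) = b-order
  twist-Holds twist A²z (there (there (here refl))) = abab
  twist-Holds twist A²z (there (there (there (here refl)))) = b⁻¹a≈ tight (B e) twist
  twist-Holds twist A²z (there (there (there (there (here refl))))) =
    ≈-trans (ba⁻¹≈ tight (B e) twist A²z (≈-reflexive (pow-comm g₂ 1 e))) (++-congˡ (winv (A 3)) (shifted e))
    where
    -- The integer `-1 + e` is negative exactly for `e = 0`, where the word is `b⁻¹`; otherwise
    -- `zpow` gives the positive power with exponent `e - 1`.
    shifted : ∀ e → winv b ++ B e ≈ zpow g₂ (-[1+ 0 ] ℤ.+ + e)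
    shifted zero    = ≈-refl
    shifted (suc e) = group (b ∷ B e ∷ []) (v₀ ⁻ ⊙ v₀ ⊙ v₁) v₁ refl

module AtomicChiral {m : ℕ} (m-prime : Prime m) (m-odd : ¬ (2 ∣ m))
    (P : Polyhedron) {Φ : Flag P} (R : Rotations P Φ) {p q : ℕ} (atomic : Atomic P R p q) where
  open OddPrime m-prime m-odd

  chiral : IsChiral P
  chiral = proj₁ atomic
  type : HasType P p q
  type = proj₁ (proj₂ atomic)

  C : Congruence
  C = WordAction.rotationCongruence P R

  tight : TightPair C p q
  tight = ChiralRotations.rotations-tight P R chiral type (proj₁ (proj₂ (proj₂ atomic)))

  ¬commutes : ¬ A²-commutes C
  ¬commutes comm = Reflection.¬barInvariant P R chiral type (commutes⇒barInvariant tight comm)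

  -- If `a²` and `b` did not commute in `D`, then `D` would not be bar-invariant, and its coset
  -- polyhedron would be a tight chiral polyhedron of smaller type. The inclusion of `C` in `D` is a
  -- covering of it by `P`, contrary to atomicity.
  proper-quotient : ∀ {D} α γ → TightPair D (2 * m ^ suc α) (m ^ suc γ) →
    (∀ {u w} → Congruence._≈_ C u w → Congruence._≈_ D u w) →
    (2 * m ^ suc α < p × m ^ suc γ ≡ q) ⊎ (2 * m ^ suc α ≡ p × m ^ suc γ < q) → A²-commutes D
  proper-quotient {D} α γ tightD C⊆D proper = decide (TightProperties._≟ʷ_ tightD (A 2 ++ b) (b ++ A 2))
    where
    1<m^ : ∀ k → 1 < m ^ suc k
    1<m^ k = <-≤-trans (prime>1 m-prime) (m≤m*n m (m ^ k) {{m^n≢0 m k}})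
    module Q = CosetPolyhedronProperties tightD (cosets tightD)
      (<-≤-trans (1<m^ α) (m≤n*m (m ^ suc α) 2)) (1<m^ γ)
    decide : Dec (A²-commutes D) → A²-commutes D
    decide (yes comm) = comm
    decide (no ¬comm) = ⊥-elim (proj₂ (proj₂ (proj₂ atomic)) Q.Q _ _
      (Q.Q-chiral (λ inv → ¬comm (barInvariant⇒commutes α γ tightD inv))) Q.Q-type Q.Q-tight proper
      (Q.Φ₀ , Q.rotations , λ u w s → Q.≈⇒SameIn u w (C⊆D (WordAction.same s))))

-- The quotient by the subgroup of order m of ⟨b⟩ is not chiral, so a² is
-- central in ⟨a², b⟩ modulo that subgroup.
module _ {m : ℕ} (m-prime : Prime m) (m-odd : ¬ (2 ∣ m)) {α β : ℕ}
    (P : Polyhedron) {Φ : Flag P} (R : Rotations P Φ)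
    (atomic : Atomic P R (2 * m ^ suc α) (m ^ (suc α + suc β))) where
  open OddPrime m-prime m-odd
  open AtomicChiral m-prime m-odd P R atomic
  open TightProperties tight
  open ≈-Reasoning

  private
    γ = α + suc β
    d = m ^ γ
    p = 2 * m ^ suc α
    q = m ^ suc γ
    γ≡ : γ ≡ suc (α + β)
    γ≡ = +-suc α β

    normal : Normal C g₂ d
    -- The bound `suc α ≤ γ` reflects that the exponent written `suc β` is positive.
    normal = b-core (suc α) γ (subst (suc α ≤_) (sym γ≡) (s≤s (m≤m+n α β))) tight

    commutes-mod-b : A²-commutes (quotientBy C g₂ d normal)
    commutes-mod-b = proper-quotient α (α + β)
      (subst (TightPair _ p) (cong (m ^_) γ≡) (tight-/b tight (^-∣ (n≤1+n γ)) normal))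
      (≈⇒~ C g₂ d) (inj₂ (refl , ^-monoʳ-< m (prime>1 m-prime) (s≤s (≤-reflexive (sym γ≡)))))

    -- The quotient gives `a²b · b^(dx) = ba² · b^(dy)`, so the twist is `b^(d(x - y))`; `q ∸ 1`
    -- serves as `-1`. Since `b^d` has order `m`, only the residue of `k` modulo `m` counts.
    k = let x , y , _ = commutes-mod-b in x + y * (q ∸ 1)
    e = k % m * d

    twist : b ++ A 2 ≈ A 2 ++ b ++ B e
    twist = let x , y , eq = commutes-mod-b in begin
      b ++ A 2                                              ≈⟨ group (b ∷ A 2 ∷ B (d * y) ∷ []) (v₀ ⊙ v₁) (((v₀ ⊙ v₁) ⊙ v₂) ⊙ v₂ ⁻) refl ⟩
      ((b ++ A 2) ++ B (d * y)) ++ winv (B (d * y))         ≈⟨ ++-cong (≈-sym eq) (winv-B (d * y)) ⟩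
      ((A 2 ++ b) ++ B (d * x)) ++ B (d * y * (q ∸ 1))      ≈⟨ group (A 2 ∷ b ∷ B (d * x) ∷ B (d * y * (q ∸ 1)) ∷ []) (((v₀ ⊙ v₁) ⊙ v₂) ⊙ v₃) (v₀ ⊙ v₁ ⊙ v₂ ⊙ v₃) refl ⟩
      A 2 ++ b ++ B (d * x) ++ B (d * y * (q ∸ 1))          ≡⟨ cong (λ z → A 2 ++ b ++ z) (pow-+ g₂ (d * x) (d * y * (q ∸ 1))) ⟨
      A 2 ++ b ++ B (d * x + d * y * (q ∸ 1))               ≡⟨ cong (λ z → A 2 ++ b ++ B z) (trans (arith d x y (q ∸ 1)) (cong (_* d) (m≡m%n+[m/n]*n k m))) ⟩
      A 2 ++ b ++ B ((k % m + k / m * m) * d)               ≡⟨ cong (λ z → A 2 ++ b ++ B z) (arith' (k % m) (k / m) m d) ⟩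
      A 2 ++ b ++ B (e + k / m * q)                         ≡⟨ cong (λ z → A 2 ++ b ++ z) (pow-+ g₂ e (k / m * q)) ⟩
      A 2 ++ b ++ B e ++ B (k / m * q)                      ≈⟨ ++-congˡ (A 2) (++-congˡ b (++-congˡ (B e) (pow-∣ C g₂ b-order (divides (k / m) refl)))) ⟩
      A 2 ++ b ++ B e ++ []                                 ≡⟨ cong (λ z → A 2 ++ b ++ z) (++-identityʳ (B e)) ⟩
      A 2 ++ b ++ B e                                       ∎
      where
      arith : ∀ d x y n → d * x + d * y * n ≡ (x + y * n) * d
      arith = solve-∀
      arith' : ∀ r c m d → (r + c * m) * d ≡ r * d + c * (m * d)
      arith' = solve-∀

    -- As `γ` is positive, `d` and with it `e` is a multiple of `m`. One factor `e` supplies `m`,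
    -- the other supplies `d`, and `m * d` is `q`.
    q∣e² : q ∣ e * e
    q∣e² = ∣-trans (*-monoˡ-∣ d m∣e) (*-monoʳ-∣ e (n∣m*n (k % m)))
      where
      m∣e : m ∣ e
      m∣e = ∣-trans (subst (m ∣_) (cong (m ^_) (sym γ≡)) (m∣m*n (m ^ (α + β)))) (n∣m*n (k % m))

    trivial-twist : B e ≈ [] → A²-commutes C
    trivial-twist Be = ≈-sym (begin
      b ++ A 2              ≈⟨ twist ⟩
      A 2 ++ b ++ B e       ≈⟨ ++-congˡ (A 2) (++-congˡ b Be) ⟩
      A 2 ++ b ++ []        ∎)

    k>0 : 1 ≤ k % m
    k>0 = n≢0⇒n>0 λ k≡0 → ¬commutes (trivial-twist (≈-reflexive (cong (λ z → B (z * d)) k≡0)))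

  twisted : ∃[ k ] 1 ≤ k × k ≤ m ∸ 1 × (b ++ A 2 ≈ A 2 ++ b ++ B (k * d)) × A 2 ++ B (k * d) ≈ B (k * d) ++ A 2
  twisted = k % m , k>0 , <⇒≤pred (m%n<n k m) , twist , twist-central tight e twist q∣e²

  -- a^(2m) is central, and if α ≥ 2 then dividing it out is again a proper quotient.
  α≡1 : suc α ≡ 1
  α≡1 = cases α refl
    where
    cases : ∀ α' → α ≡ α' → suc α ≡ 1
    cases zero     eq = cong suc eq
    cases (suc α') eq = contradiction (trivial-twist (pow-∣ C g₂ b-order q∣e)) ¬commutes
      where
      c = 2 * m ^ 1
      -- Passing `a²` across `b` altogether `m` times collects `B (m * e)`, and `m * e` is a
      -- multiple of `m * d = q`.
      central : b ++ A c ≈ A c ++ b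
      central = begin
        b ++ A c                           ≈⟨ b-A²ˡ tight e twist q∣e² (m ^ 1) ⟩
        A c ++ b ++ B (m ^ 1 * e)          ≈⟨ ++-congˡ (A c) (++-congˡ b (pow-∣ C g₂ b-order q∣me)) ⟩
        A c ++ b ++ []                     ∎
        where
        q∣me : q ∣ m ^ 1 * e
        q∣me = divides (k % m) (arith m (k % m) d)
          where
          arith : ∀ m r d → m * 1 * (r * d) ≡ r * (m * d)
          arith = solve-∀
      normal-a : Normal C g₁ c
      normal-a = A-central C c central
      c<p : c < p
      c<p = *-monoʳ-< 2 (^-monoʳ-< m (prime>1 m-prime) (s≤s (subst (0 <_) (sym eq) (s≤s z≤n))))
      commutes-mod-a : A²-commutes (quotientBy C g₁ c normal-a)
      -- The quotient has type `{2m, q}`; its first entry is smaller than `p` because the exponent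
      -- `suc α` is at least 2 in this case.
      commutes-mod-a = proper-quotient 0 γ (tight-/a tight (*-monoʳ-∣ 2 (^-∣ (s≤s (z≤n {α})))) normal-a)
        (≈⇒~ C g₁ c) (inj₁ (c<p , refl))
      q∣e : q ∣ e
      q∣e = let x , y , eq' = commutes-mod-a in proj₂ (indep (c * x + Ā (c * y)) e (begin
        A (c * x + Ā (c * y))                     ≡⟨ pow-+ g₁ (c * x) (Ā (c * y)) ⟩
        A (c * x) ++ A (Ā (c * y))                ≈⟨ ++-congˡ (A (c * x)) (winv-A (c * y)) ⟨
        A (c * x) ++ winv (A (c * y))             ≈⟨ group ((A 2 ++ b) ∷ A (c * x) ∷ A (c * y) ∷ []) (v₁ ⊙ v₂ ⁻) (v₀ ⁻ ⊙ (v₀ ⊙ v₁) ⊙ v₂ ⁻) refl ⟩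
        winv (A 2 ++ b) ++ ((A 2 ++ b) ++ A (c * x)) ++ winv (A (c * y))  ≈⟨ ≈-ctx (winv (A 2 ++ b)) (winv (A (c * y))) eq' ⟩
        winv (A 2 ++ b) ++ ((b ++ A 2) ++ A (c * y)) ++ winv (A (c * y))  ≈⟨ group ((A 2 ++ b) ∷ (b ++ A 2) ∷ A (c * y) ∷ []) (v₀ ⁻ ⊙ (v₁ ⊙ v₂) ⊙ v₂ ⁻) (v₀ ⁻ ⊙ v₁) refl ⟩
        winv (A 2 ++ b) ++ b ++ A 2               ≈⟨ ++-congˡ (winv (A 2 ++ b)) twist ⟩
        winv (A 2 ++ b) ++ A 2 ++ b ++ B e        ≈⟨ group (A 2 ∷ b ∷ B e ∷ []) ((v₀ ⊙ v₁) ⁻ ⊙ v₀ ⊙ v₁ ⊙ v₂) v₂ refl ⟩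
        B e                                       ∎))

theorem4p11 : (m α β : ℕ) → Prime m → ¬ (2 ∣ m) → 1 ≤ α → 1 ≤ β →
    (P : Polyhedron) (Φ : Flag P) (R : Rotations P Φ) →
    Atomic P R (2 * m ^ α) (m ^ (α + β)) →
    α ≡ 1 ×
    Σ ℕ (λ k → 1 ≤ k × k ≤ m ∸ 1 ×
    IsPresentation P R (2 * m) (m ^ (β + 1))
    (+ 3) (+ (1 + k * m ^ β)) (ℤ.- (+ 3)) (-[1+ 0 ] ℤ.+ + (k * m ^ β)))
theorem4p11 m (suc α) (suc β) m-prime m-odd _ _ P Φ R atomic =
    α≡1 m-prime m-odd {α} {β} P R atomic , presentation (suc-injective (α≡1 m-prime m-odd {α} {β} P R atomic)) atomic
  where
  -- The exponent is generalised together with the atomicity of `P`, so that `α ≡ 0` can be matched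
  -- with `refl`. Then the subgroup of order `m` is generated by `b` to the power `m ^ suc β`, the
  -- modulus in the statement.
  presentation : ∀ {α} → α ≡ 0 → Atomic P R (2 * m ^ suc α) (m ^ (suc α + suc β)) →
    Σ ℕ (λ k → 1 ≤ k × k ≤ m ∸ 1 × IsPresentation P R (2 * m) (m ^ (suc β + 1))
      (+ 3) (+ (1 + k * m ^ suc β)) (ℤ.- (+ 3)) (-[1+ 0 ] ℤ.+ + (k * m ^ suc β)))
  presentation refl atomic =
    let k , 1≤k , k<m , twist , A²z = twisted m-prime m-odd {0} {β} P R atomic
        holds = twist-Holds tight′ (k * m ^ suc β) twist A²z
    in k , 1≤k , k<m , λ u w →
      (λ derivation → WordAction._≋_.sameIn (derivable-least C holds derivation)) ,
      (λ s → ΓRels-complete tight′ (1 + k * m ^ suc β) (ℤ.- (+ 3)) (-[1+ 0 ] ℤ.+ + (k * m ^ suc β)) holds u w (WordAction.same s))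
    where
    open AtomicChiral m-prime m-odd P R atomic
    tight′ : TightPair C (2 * m) (m ^ (suc β + 1))
    tight′ = subst₂ (TightPair C) (cong (2 *_) (*-identityʳ m)) (cong (m ^_) (+-comm 1 (suc β))) tight
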